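{- There is an algorithm that, given $k$ strings $A_1,\dots,A_k$ each of length at most $n$, computes a minimal common supersequence of $A_1,\dots,A_k$ in $O(kn(\log k+\log n))$ time.
   Context: A common supersequence of $A_1,\dots,A_k$ is a string $C$ having every $A_i$ as a (not necessarily contiguous) subsequence; it is minimal if no proper subsequence of $C$ is a common supersequence. Time in the standard RAM model with $O(1)$-time character comparisons. -}

module Defs where

open import Data.Bool using (Bool; true; false; if_then_else_; not; _∧_)
open import Data.Fin using (Fin)
open import Data.List using (List; []; _∷ʳ_; length; head; drop; concat)
open import Data.Maybe using (Maybe; just; maybe; zipWith)
import Data.Maybe as Maybe
open import Data.Nat using (ℕ; suc; _+_; _∸_; _≟_; _<?_)
import Data.Nat as ℕ
open import Data.Product using (_×_)
open import Data.Vec using (Vec; lookup; toList)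
open import Data.List.Relation.Binary.Sublist.Propositional using (_⊆_)
open import Level using (0ℓ)
open import Relation.Binary using (Rel; IsStrictTotalOrder)
open import Relation.Binary.PropositionalEquality using (_≡_; _≢_)
open import Relation.Nullary using (¬_; does)

-- xs ⊆ ys is the (not necessarily contiguous) subsequence relation on lists.

CommonSupersequence : {Char : Set} {k : ℕ} → Vec (List Char) k → List Char → Set
CommonSupersequence {k = k} A C = (i : Fin k) → lookup A i ⊆ C

MinimalCommonSupersequence : {Char : Set} {k : ℕ} → Vec (List Char) k → List Char → Set
MinimalCommonSupersequence A C =
  CommonSupersequence A C ×
  (∀ D → D ⊆ C → D ≢ C → ¬ CommonSupersequence A D)

-- RAM programs, written with structured control flow instead of jumps.  The
-- word store consists of registers and of arrays, both named by literal
-- numbers.  A program names only finitely many of them, so interleaving them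
-- in a single memory changes running times by a constant factor only.
-- Characters are reached solely through their position in the input, either
-- to compare two of them or to write one to the output.

data Expr : Set where
  lit : ℕ → Expr
  reg : ℕ → Expr
  arr : ℕ → Expr → Expr
  _⊕_ : Expr → Expr → Expr
  _⊖_ : Expr → Expr → Expr

data Test : Set where
  _≺_  : Expr → Expr → Test
  _≐_  : Expr → Expr → Test
  _≺ᶜ_ : Expr → Expr → Test   -- order of the input characters at two positions
  ~_   : Test → Test
  _&_  : Test → Test → Test

data Program : Set where
  skip          : Program
  reg_≔_        : ℕ → Expr → Program
  arr_[_]≔_     : ℕ → Expr → Expr → Program
  emit          : Expr → Program
  _⨾_           : Program → Program → Program
  IF_THEN_ELSE_ : Test → Program → Program → Program
  WHILE_DO_     : Test → Program → Program

infixl 8 _⊕_ _⊖_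
infix  7 _≺_ _≐_ _≺ᶜ_
infix  6 ~_
infixr 5 _&_
infix  4 reg_≔_ arr_[_]≔_
infixr 3 _⨾_
infix  4 IF_THEN_ELSE_ WHILE_DO_

costₑ : Expr → ℕ
costₑ (lit _)   = 1
costₑ (reg _)   = 1
costₑ (arr _ e) = suc (costₑ e)
costₑ (e ⊕ f)   = suc (costₑ e + costₑ f)
costₑ (e ⊖ f)   = suc (costₑ e + costₑ f)

costₜ : Test → ℕ
costₜ (e ≺ f)  = suc (costₑ e + costₑ f)
costₜ (e ≐ f)  = suc (costₑ e + costₑ f)
costₜ (e ≺ᶜ f) = suc (costₑ e + costₑ f)
costₜ (~ t)    = suc (costₜ t)
costₜ (t & u)  = suc (costₜ t + costₜ u)

record State (Char : Set) : Set where
  constructor ⟪_,_,_⟫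
  field
    regs   : ℕ → ℕ
    arrs   : ℕ → ℕ → ℕ
    output : List Char

open State public

_[_↦_] : {X : Set} → (ℕ → X) → ℕ → X → ℕ → X
(f [ i ↦ x ]) j = if does (j ≟ i) then x else f j

⟦_⟧ : {Char : Set} → Expr → State Char → ℕ
⟦ lit v ⟧   s = v
⟦ reg r ⟧   s = regs s r
⟦ arr a e ⟧ s = arrs s a (⟦ e ⟧ s)
⟦ e ⊕ f ⟧   s = ⟦ e ⟧ s + ⟦ f ⟧ s
⟦ e ⊖ f ⟧   s = ⟦ e ⟧ s ∸ ⟦ f ⟧ s

_‼_ : {X : Set} → List X → ℕ → Maybe X
xs ‼ p = head (drop p xs)

-- The alphabet is an arbitrary strictly totally ordered set.  Every stored
-- word must be below W: a run that would store a larger number is stuck, as is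
-- one that refers to an input position past the end.  (Intermediate values
-- inside an expression exceed W by at most a factor depending only on the
-- program, and so occupy O(1) words.)

module Semantics
  {Char : Set} {_<_ : Rel Char 0ℓ} (isSTO : IsStrictTotalOrder _≡_ _<_)
  (input : List Char) (W : ℕ)
  where

  open IsStrictTotalOrder isSTO using () renaming (_<?_ to _<ᶜ?_)

  test : Test → State Char → Maybe Bool
  test (e ≺ f)  s = just (does (⟦ e ⟧ s <? ⟦ f ⟧ s))
  test (e ≐ f)  s = just (does (⟦ e ⟧ s ≟ ⟦ f ⟧ s))
  test (e ≺ᶜ f) s = zipWith (λ x y → does (x <ᶜ? y)) (input ‼ ⟦ e ⟧ s) (input ‼ ⟦ f ⟧ s)
  test (~ t)    s = Maybe.map not (test t s)
  test (t & u)  s = zipWith _∧_ (test t s) (test u s)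

  -- P ⊢ s ⇓[ t ] s′ : started in s, P halts in s′ after t unit-cost operations.
  data _⊢_⇓[_]_ : Program → State Char → ℕ → State Char → Set where

    skip : ∀ {s} → skip ⊢ s ⇓[ 1 ] s

    assign : ∀ {s r e} → ⟦ e ⟧ s ℕ.< W →
      (reg r ≔ e) ⊢ s ⇓[ suc (costₑ e) ]
        ⟪ regs s [ r ↦ ⟦ e ⟧ s ] , arrs s , output s ⟫

    store : ∀ {s a i e} → ⟦ e ⟧ s ℕ.< W →
      (arr a [ i ]≔ e) ⊢ s ⇓[ suc (costₑ i + costₑ e) ]
        ⟪ regs s , arrs s [ a ↦ arrs s a [ ⟦ i ⟧ s ↦ ⟦ e ⟧ s ] ] , output s ⟫

    emit : ∀ {s e x} → input ‼ ⟦ e ⟧ s ≡ just x →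
      emit e ⊢ s ⇓[ suc (costₑ e) ] ⟪ regs s , arrs s , output s ∷ʳ x ⟫

    seq : ∀ {P Q s s′ s″ t u} →
      P ⊢ s ⇓[ t ] s′ → Q ⊢ s′ ⇓[ u ] s″ →
      (P ⨾ Q) ⊢ s ⇓[ t + u ] s″

    if-true : ∀ {b P Q s s′ t} → test b s ≡ just true →
      P ⊢ s ⇓[ t ] s′ →
      (IF b THEN P ELSE Q) ⊢ s ⇓[ suc (costₜ b + t) ] s′

    if-false : ∀ {b P Q s s′ t} → test b s ≡ just false →
      Q ⊢ s ⇓[ t ] s′ →
      (IF b THEN P ELSE Q) ⊢ s ⇓[ suc (costₜ b + t) ] s′

    while-false : ∀ {b P s} → test b s ≡ just false →
      (WHILE b DO P) ⊢ s ⇓[ suc (costₜ b) ] s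

    while-true : ∀ {b P s s′ s″ t u} → test b s ≡ just true →
      P ⊢ s ⇓[ t ] s′ → (WHILE b DO P) ⊢ s′ ⇓[ u ] s″ →
      (WHILE b DO P) ⊢ s ⇓[ suc (costₜ b + t + u) ] s″

-- The input strings are laid out consecutively on the character tape
-- concat (toList A).  Initially register 0 holds k, array 0 holds the lengths of
-- the strings, and every other word is 0.

initial : {Char : Set} {k : ℕ} → Vec (List Char) k → State Char
initial {k = k} A = ⟪ (λ _ → 0) [ 0 ↦ k ] , (λ _ _ → 0) [ 0 ↦ lengths ] , [] ⟫
  where
  lengths : ℕ → ℕ
  lengths i = maybe length 0 (toList A ‼ i)

-- With words of size W, P started on the strings A halts after t operations,
-- having written C.
record Computes {Char : Set} {_<_ : Rel Char 0ℓ} (isSTO : IsStrictTotalOrder _≡_ _<_)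
                (W : ℕ) (P : Program) {k : ℕ} (A : Vec (List Char) k)
                (t : ℕ) (C : List Char) : Set where
  open Semantics isSTO (concat (toList A)) W
  field
    final  : State Char
    run    : P ⊢ initial A ⇓[ t ] final
    result : output final ≡ C

{-# OPTIONS --safe #-}
-- Let T = A₁ ⋯ Aₖ be the input tape.  A sweep reads a common supersequence S from
-- left to right, knowing for every string an embedding F into S.  It maintains the
-- next unmatched character of every string, keeps a position only if F sends one
-- of these characters there, and matches a kept position to all of them that agree
-- with it.  The matching G so obtained is the leftmost embedding into the kept
-- positions, and every kept position is of the form F e = G e.
--
-- Sweep T from the left, with the identity as F, to get G₁; then sweep its mirror
-- image, with the mirror image of G₁ as F, to get G₂.  If H embeds the strings into
-- a subsequence of the positions kept by the second sweep, then G₁ ≤ H because G₁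
-- is leftmost and H ≤ G₂ because G₂ is rightmost.  At a kept position G₁ and G₂
-- agree, so H uses it: no position can be dropped.
--
-- The waiting characters are kept in linked lists, one for each letter, so a sweep
-- takes linear time: every character is taken from a list once.  Whether F
-- sends a character of a list to the current position is decided by the least
-- target in the list.  Letters are numbered by merge sort, which accounts for the
-- logarithm.

module Submission where

open import Defs
open import Data.Bool using (Bool; true; false; if_then_else_; not; _∧_)
open import Data.Empty using (⊥; ⊥-elim)
open import Data.Fin using (Fin; zero; suc; toℕ)
open import Data.Fin.Properties using (toℕ<n)
open import Data.List using (List; []; _∷_; _++_; length; head; drop; concat)
open import Data.List.Membership.Propositional using (_∈_; _∉_)
open import Data.List.Properties using (++-assoc; ++-identityʳ; length-++)
open import Data.List.Relation.Binary.Pointwise as Pointwise using (Pointwise; []; _∷_)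
open import Data.List.Relation.Binary.Sublist.Propositional as Sublist using (_⊆_; []; _∷_; _∷ʳ_; minimum)
open import Data.List.Relation.Binary.Sublist.Propositional.Properties using (All-resp-⊆)
open import Data.List.Relation.Unary.All as All using (All; []; _∷_)
open import Data.List.Relation.Unary.AllPairs using (AllPairs; []; _∷_)
open import Data.List.Relation.Unary.Any using (here; there)
open import Data.Maybe using (Maybe; just; maybe; zipWith)
open import Data.Maybe.Properties using (just-injective)
open import Data.Nat using (ℕ; zero; suc; pred; _+_; _∸_; _*_; _^_; _⊔_; _≤_; _<_; _≟_; _<?_; _≤?_; z≤n; s≤s; >-nonZero; ⌊_/2⌋; ⌈_/2⌉)
open import Data.Nat.Induction using (<-rec)
open import Data.Nat.Logarithm using (⌈log₂_⌉; ⌈log₂⌉-mono-≤; ⌈log₂⌈n/2⌉⌉≡⌈log₂n⌉∸1)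
open import Data.Nat.Properties
open import Data.Nat.Solver using (module +-*-Solver)
open import Data.Product using (∃; ∃-syntax; Σ; Σ-syntax; _×_; _,_; proj₁; proj₂)
open import Data.Sum using (_⊎_; inj₁; inj₂)
open import Data.Unit using (⊤; tt)
open import Data.Vec using (Vec; []; _∷_; lookup; toList)
open import Level using (0ℓ)
open import Relation.Binary using (Rel; IsStrictTotalOrder; tri<; tri≈; tri>)
open import Relation.Binary.PropositionalEquality using (_≡_; _≢_; refl; sym; trans; cong; cong₂; subst; subst₂)
open import Relation.Nullary using (¬_; does; yes; no; Dec)
open import Relation.Nullary.Decidable using (dec-true; dec-false)

-- Programs with a bound on their running time

-- No string gets stuck in a sweep, because `j ≤ F e` for every waiting `e`. A match at `j` gives
-- `j ≤ F e < F (suc e)`, so the target of the successor is still to come; and when position `F e`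
-- is reached with `e` still waiting, it is kept on account of `e`. One sweep alone does not give
-- minimality: agreement with G then involves an F that need not be extreme. The second sweep takes
-- the opposite extreme as F. Its kept positions are among those of the first, so G₁, leftmost among
-- the latter, still bounds every H from below.
--
-- The mirror image occupies [N, 2N) of the same arrays. Thus one program serves both sweeps, the
-- matching of the first stays readable, and the cells of G and `keep` used by the second are still
-- zero. The list heads, indexed by class, are used by both sweeps, and a sweep leaves them empty.
--
-- The semantics relates only finished runs, so termination, time and correctness are proved
-- together: a loop runs on a potential that every test of its guard lowers.

lookup-updated : {X : Set} (f : ℕ → X) (i : ℕ) {x : X} → (f [ i ↦ x ]) i ≡ x
lookup-updated f i rewrite dec-true (i ≟ i) refl = refl

lookup-other : {X : Set} (f : ℕ → X) {i j : ℕ} {x : X} → j ≢ i → (f [ i ↦ x ]) j ≡ f j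
lookup-other f {i} {j} j≢i rewrite dec-false (j ≟ i) j≢i = refl

-- Syntactic, so that for a concrete program and a literal index it computes and the frame
-- conditions below are proved by `refl`.
writesArr : ℕ → Program → Bool
writesArr a skip                   = false
writesArr a (reg _ ≔ _)            = false
writesArr a (arr b [ _ ]≔ _)       = does (a ≟ b)
writesArr a (emit _)               = false
writesArr a (P ⨾ Q)                = if writesArr a P then true else writesArr a Q
writesArr a (IF _ THEN P ELSE Q)   = if writesArr a P then true else writesArr a Q
writesArr a (WHILE _ DO P)         = writesArr a P

writesReg : ℕ → Program → Bool
writesReg r skip                   = false
writesReg r (reg q ≔ _)            = does (r ≟ q)
writesReg r (arr _ [ _ ]≔ _)       = false
writesReg r (emit _)               = false
writesReg r (P ⨾ Q)                = if writesReg r P then true else writesReg r Q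
writesReg r (IF _ THEN P ELSE Q)   = if writesReg r P then true else writesReg r Q
writesReg r (WHILE _ DO P)         = writesReg r P

emits : Program → Bool
emits (emit _)               = true
emits (P ⨾ Q)                = if emits P then true else emits Q
emits (IF _ THEN P ELSE Q)   = if emits P then true else emits Q
emits (WHILE _ DO P)         = emits P
emits _                      = false

either-false : ∀ {x y} → (if x then true else y) ≡ false → x ≡ false × y ≡ false
either-false {false} eq = refl , eq

test-< : ∀ {m n} → m < n → just (does (m <? n)) ≡ just true
test-< {m} {n} lt = cong just (dec-true (m <? n) lt)

test-≮ : ∀ {m n} → ¬ (m < n) → just (does (m <? n)) ≡ just false
test-≮ {m} {n} ge = cong just (dec-false (m <? n) ge)

test-≡ : ∀ {m n} → m ≡ n → just (does (m ≟ n)) ≡ just true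
test-≡ {m} {n} eq = cong just (dec-true (m ≟ n) eq)

test-≢ : ∀ {m n} → m ≢ n → just (does (m ≟ n)) ≡ just false
test-≢ {m} {n} ne = cong just (dec-false (m ≟ n) ne)

test-~≡ : ∀ {m n} → m ≡ n → just (not (does (m ≟ n))) ≡ just false
test-~≡ {m} {n} eq = cong (λ b → just (not b)) (dec-true (m ≟ n) eq)

test-~≢ : ∀ {m n} → m ≢ n → just (not (does (m ≟ n))) ≡ just true
test-~≢ {m} {n} ne = cong (λ b → just (not b)) (dec-false (m ≟ n) ne)

test-∧ : ∀ {x y a b} → just x ≡ just a → just y ≡ just b → just (x ∧ y) ≡ just (a ∧ b)
test-∧ refl refl = refl

test-∧ˡ : ∀ {x y} → just x ≡ just false → just (x ∧ y) ≡ just false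
test-∧ˡ refl = refl

module Execution
  {Char : Set} {_≺′_ : Rel Char 0ℓ} (isSTO : IsStrictTotalOrder _≡_ _≺′_)
  (input : List Char) (W : ℕ)
  where

  open Semantics isSTO input W public

  unwritten-arr : ∀ {P s s′ t} → P ⊢ s ⇓[ t ] s′ → ∀ a → writesArr a P ≡ false → arrs s′ a ≡ arrs s a
  unwritten-arr skip a _ = refl
  unwritten-arr (assign _) a _ = refl
  unwritten-arr (store {a = b} _) a eq rewrite eq = refl
  unwritten-arr (emit _) a _ = refl
  unwritten-arr (seq {P} {Q} p q) a eq with either-false {writesArr a P} {writesArr a Q} eq
  ... | eP , eQ = trans (unwritten-arr q a eQ) (unwritten-arr p a eP)
  unwritten-arr (if-true {P = P} {Q} _ p) a eq = unwritten-arr p a (proj₁ (either-false {writesArr a P} {writesArr a Q} eq))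
  unwritten-arr (if-false {P = P} {Q} _ q) a eq = unwritten-arr q a (proj₂ (either-false {writesArr a P} {writesArr a Q} eq))
  unwritten-arr (while-false _) a _ = refl
  unwritten-arr (while-true _ p q) a eq = trans (unwritten-arr q a eq) (unwritten-arr p a eq)

  unwritten-reg : ∀ {P s s′ t} → P ⊢ s ⇓[ t ] s′ → ∀ r → writesReg r P ≡ false → regs s′ r ≡ regs s r
  unwritten-reg skip r _ = refl
  unwritten-reg (assign _) r eq rewrite eq = refl
  unwritten-reg (store _) r _ = refl
  unwritten-reg (emit _) r _ = refl
  unwritten-reg (seq {P} {Q} p q) r eq with either-false {writesReg r P} {writesReg r Q} eq
  ... | eP , eQ = trans (unwritten-reg q r eQ) (unwritten-reg p r eP)
  unwritten-reg (if-true {P = P} {Q} _ p) r eq = unwritten-reg p r (proj₁ (either-false {writesReg r P} {writesReg r Q} eq))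
  unwritten-reg (if-false {P = P} {Q} _ q) r eq = unwritten-reg q r (proj₂ (either-false {writesReg r P} {writesReg r Q} eq))
  unwritten-reg (while-false _) r _ = refl
  unwritten-reg (while-true _ p q) r eq = trans (unwritten-reg q r eq) (unwritten-reg p r eq)

  unchanged-output : ∀ {P s s′ t} → P ⊢ s ⇓[ t ] s′ → emits P ≡ false → output s′ ≡ output s
  unchanged-output skip _ = refl
  unchanged-output (assign _) _ = refl
  unchanged-output (store _) _ = refl
  unchanged-output (seq {P} {Q} p q) eq with either-false {emits P} {emits Q} eq
  ... | eP , eQ = trans (unchanged-output q eQ) (unchanged-output p eP)
  unchanged-output (if-true {P = P} {Q} _ p) eq = unchanged-output p (proj₁ (either-false {emits P} {emits Q} eq))
  unchanged-output (if-false {P = P} {Q} _ q) eq = unchanged-output q (proj₂ (either-false {emits P} {emits Q} eq))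
  unchanged-output (while-false _) _ = refl
  unchanged-output (while-true _ p q) eq = trans (unchanged-output q eq) (unchanged-output p eq)

  -- Exhibiting a run already proves termination. The budget may exceed the time actually taken, so
  -- that branches of different cost share one bound.
  record Exec (P : Program) (s : State Char) (budget : ℕ) (Post : State Char → Set) : Set where
    constructor exec
    field
      {end}  : State Char
      {time} : ℕ
      run    : P ⊢ s ⇓[ time ] end
      cost   : time ≤ budget
      post   : Post end

  infixr 3 _⨾ₑ_
  _⨾ₑ_ : ∀ {P Q s b c} {Mid Post : State Char → Set} →
         Exec P s b Mid → (∀ {s′} → Mid s′ → Exec Q s′ c Post) → Exec (P ⨾ Q) s (b + c) Post
  exec p cp m ⨾ₑ k with k m
  ... | exec q cq r = exec (seq p q) (+-mono-≤ cp cq) r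

  assign⨾ : ∀ {r e Q s c} {Post : State Char → Set} → ⟦ e ⟧ s < W →
            Exec Q ⟪ regs s [ r ↦ ⟦ e ⟧ s ] , arrs s , output s ⟫ c Post →
            Exec ((reg r ≔ e) ⨾ Q) s (suc (costₑ e) + c) Post
  assign⨾ {e = e} lt (exec r c p) = exec (seq (assign lt) r) (+-monoʳ-≤ (suc (costₑ e)) c) p

  store⨾ : ∀ {a i e Q s c} {Post : State Char → Set} → ⟦ e ⟧ s < W →
           Exec Q ⟪ regs s , arrs s [ a ↦ arrs s a [ ⟦ i ⟧ s ↦ ⟦ e ⟧ s ] ] , output s ⟫ c Post →
           Exec ((arr a [ i ]≔ e) ⨾ Q) s (suc (costₑ i + costₑ e) + c) Post
  store⨾ {i = i} {e} lt (exec r c p) = exec (seq (store lt) r) (+-monoʳ-≤ (suc (costₑ i + costₑ e)) c) p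

  weaken : ∀ {P s b c} {Post Post′ : State Char → Set} →
           b ≤ c → (∀ {s′} → Post s′ → Post′ s′) → Exec P s b Post → Exec P s c Post′
  weaken b≤c f (exec p c q) = exec p (≤-trans c b≤c) (f q)

  if₁ : ∀ {b P Q s x c} {Post : State Char → Set} → test b s ≡ just x →
        (x ≡ true → Exec P s c Post) → (x ≡ false → Exec Q s c Post) →
        Exec (IF b THEN P ELSE Q) s (suc (costₜ b + c)) Post
  if₁ {b} {x = true} eq p q with p refl
  ... | exec r c z = exec (if-true eq r) (s≤s (+-monoʳ-≤ (costₜ b) c)) z
  if₁ {b} {x = false} eq p q with q refl
  ... | exec r c z = exec (if-false eq r) (s≤s (+-monoʳ-≤ (costₜ b) c)) z

  -- Amort P s φ Post: the time of the run and the potential left over at its end are together at most φ.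
  record Amort (P : Program) (s : State Char) (φ : ℕ) (Post : ℕ → State Char → Set) : Set where
    constructor amort
    field
      {end}  : State Char
      {time} : ℕ
      {left} : ℕ
      run    : P ⊢ s ⇓[ time ] end
      cost   : time + left ≤ φ
      post   : Post left end

  ⌊_⌋ₐ : ∀ {P s φ} {Post : State Char → Set} → Amort P s φ (λ _ → Post) → Exec P s φ Post
  ⌊ amort {time = t} {l} r c p ⌋ₐ = exec r (≤-trans (m≤m+n t l) c) p

  saving : ∀ {P s b} l {Post : ℕ → State Char → Set} → Exec P s b (Post l) → Amort P s (b + l) Post
  saving l (exec r c p) = amort r (+-monoˡ-≤ l c) p

  assign⨾ₐ : ∀ {r e Q s φ} {Post : ℕ → State Char → Set} → ⟦ e ⟧ s < W →
             Amort Q ⟪ regs s [ r ↦ ⟦ e ⟧ s ] , arrs s , output s ⟫ φ Post →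
             Amort ((reg r ≔ e) ⨾ Q) s (suc (costₑ e) + φ) Post
  assign⨾ₐ {e = e} lt (amort {time = t} {l} r c p) =
    amort (seq (assign lt) r) (≤-trans (≤-reflexive (+-assoc (suc (costₑ e)) t l)) (+-monoʳ-≤ (suc (costₑ e)) c)) p

  store⨾ₐ : ∀ {a i e Q s φ} {Post : ℕ → State Char → Set} → ⟦ e ⟧ s < W →
            Amort Q ⟪ regs s , arrs s [ a ↦ arrs s a [ ⟦ i ⟧ s ↦ ⟦ e ⟧ s ] ] , output s ⟫ φ Post →
            Amort ((arr a [ i ]≔ e) ⨾ Q) s (suc (costₑ i + costₑ e) + φ) Post
  store⨾ₐ {i = i} {e} lt (amort {time = t} {l} r c p) =
    amort (seq (store lt) r) (≤-trans (≤-reflexive (+-assoc d t l)) (+-monoʳ-≤ d c)) p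
    where d = suc (costₑ i + costₑ e)

  then-exec : ∀ {P Q s c φ} {Mid Post : ℕ → State Char → Set} → Amort P s φ Mid →
              (∀ {l s′} → Mid l s′ → Exec Q s′ c (Post l)) → Amort (P ⨾ Q) s (c + φ) Post
  then-exec {c = c} {φ} (amort {time = t} {l} r cr m) k with k m
  ... | exec {time = u} r′ c′ p = amort (seq r r′) bound p
    where
    open ≤-Reasoning
    bound = begin
      t + u + l    ≡⟨ cong (_+ l) (+-comm t u) ⟩
      u + t + l    ≡⟨ +-assoc u t l ⟩
      u + (t + l)  ≤⟨ +-mono-≤ c′ cr ⟩
      c + φ        ∎

  weakenₐ : ∀ {P s φ φ′} {Post : ℕ → State Char → Set} → φ ≤ φ′ → Amort P s φ Post → Amort P s φ′ Post
  weakenₐ le (amort r c p) = amort r (≤-trans c le) p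

  if-trueₐ : ∀ {b P Q s φ} {Post : ℕ → State Char → Set} → test b s ≡ just true →
             Amort P s φ Post → Amort (IF b THEN P ELSE Q) s (suc (costₜ b) + φ) Post
  if-trueₐ {b} eq (amort {time = t} {l} r c p) =
    amort (if-true eq r) (≤-trans (≤-reflexive (+-assoc (suc (costₜ b)) t l)) (+-monoʳ-≤ (suc (costₜ b)) c)) p

  mapₐ : ∀ {P s φ} {Post Post′ : ℕ → State Char → Set} → (∀ {l s′} → Post l s′ → Post′ l s′) →
         Amort P s φ Post → Amort P s φ Post′
  mapₐ f (amort r c p) = amort r c (f p)

  data Iteration (b : Test) (P : Program) (Inv Post : ℕ → State Char → Set)
                 (φ : ℕ) (s : State Char) : Set where
    stop     : test b s ≡ just false → Post φ s → Iteration b P Inv Post φ s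
    continue : test b s ≡ just true → ∀ {φ′} → Amort P s φ′ Inv → suc (costₜ b) + φ′ ≤ φ →
               Iteration b P Inv Post φ s

  -- Inv φ s: the invariant holds in s, and the potential φ pays for the iterations to come.
  while : ∀ {b P} (Inv : ℕ → State Char → Set) {Post : ℕ → State Char → Set} →
          (∀ {φ s} → Inv φ s → Iteration b P Inv Post φ s) →
          ∀ {φ s} → Inv φ s → Amort (WHILE b DO P) s (suc (costₜ b) + φ) Post
  while {b} {P} Inv {Post} step {φ} {s} i = go φ ≤-refl i
    where
    -- The potential itself is the fuel: the guard costs at least one, so what is left after an
    -- iteration is strictly smaller.
    go : ∀ fuel {φ s} → φ ≤ fuel → Inv φ s → Amort (WHILE b DO P) s (suc (costₜ b) + φ) Post
    go fuel {φ} φ≤ i with step i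
    ... | stop eq p = amort (while-false eq) ≤-refl p
    go zero {φ} φ≤ i | continue eq a le with ≤-trans le φ≤
    ... | ()
    go (suc fuel) {φ} φ≤ i | continue eq {φ′} (amort {time = t} {l} r cr i′) le
      with go fuel {l} (≤-pred (≤-trans (s≤s (≤-trans (m≤n+m l t) (≤-trans cr (m≤n+m φ′ (costₜ b)))))
                                         (≤-trans le φ≤))) i′
    ... | amort {time = u} {l′} r′ cr′ p = amort (while-true eq r r′) bound p
      where
      open ≤-Reasoning
      bound = begin
        suc (costₜ b + t + u + l′)                ≡⟨ cong suc (+-assoc (costₜ b + t) u l′) ⟩
        suc (costₜ b + t + (u + l′))              ≤⟨ s≤s (+-monoʳ-≤ (costₜ b + t) cr′) ⟩
        suc (costₜ b + t + (suc (costₜ b) + l))   ≡⟨ cong (λ x → suc (costₜ b + t + x)) (+-comm (suc (costₜ b)) l) ⟩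
        suc (costₜ b + t + (l + suc (costₜ b)))   ≡⟨ cong suc (sym (+-assoc (costₜ b + t) l _)) ⟩
        suc (costₜ b + t + l + suc (costₜ b))     ≡⟨ cong (λ x → suc (x + suc (costₜ b))) (+-assoc (costₜ b) t l) ⟩
        suc (costₜ b + (t + l) + suc (costₜ b))   ≤⟨ s≤s (+-monoˡ-≤ (suc (costₜ b)) (+-monoʳ-≤ (costₜ b) cr)) ⟩
        suc (costₜ b + φ′ + suc (costₜ b))        ≤⟨ +-monoˡ-≤ (suc (costₜ b)) le ⟩
        φ + suc (costₜ b)                         ≡⟨ +-comm φ _ ⟩
        suc (costₜ b) + φ                         ∎

  -- The special case of `while` whose potential is the number of remaining iterations times their
  -- common cost.
  for : ∀ {b P} hi c (Inv : ℕ → State Char → Set) →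
        (∀ {i s} → i < hi → Inv i s → test b s ≡ just true × Exec P s c (Inv (suc i))) →
        (∀ {s} → Inv hi s → test b s ≡ just false) →
        ∀ {i s} → i ≤ hi → Inv i s →
        Exec (WHILE b DO P) s (suc (costₜ b) + (hi ∸ i) * suc (costₜ b + c)) (Inv hi)
  for {b} {P} hi c Inv step last {i} i≤hi inv = ⌊ while Inv′ step′ (i , i≤hi , refl , inv) ⌋ₐ
    where
    K = suc (costₜ b + c)
    Inv′ : ℕ → State _ → Set
    Inv′ φ s = ∃[ i ] i ≤ hi × (hi ∸ i) * K ≡ φ × Inv i s
    step′ : ∀ {φ s} → Inv′ φ s → Iteration b P Inv′ (λ _ → Inv hi) φ s
    step′ {φ} (i , i≤hi , refl , inv) with m≤n⇒m<n∨m≡n i≤hi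
    ... | inj₂ refl = stop (last inv) inv
    ... | inj₁ i<hi with step i<hi inv
    ...   | eq , e = continue eq
                       (saving ((hi ∸ suc i) * K) (weaken ≤-refl (λ q → suc i , i<hi , refl , q) e))
                       (≤-reflexive (trans (sym (+-assoc (suc (costₜ b)) c ((hi ∸ suc i) * K)))
                                           (cong (_* K) (sym (+-∸-assoc 1 i<hi)))))

  -- Postconditions mention only what changes. The rest travels in this record, from which each
  -- phase rewrites with just the equations it needs.
  record Frame (P : Program) (s s′ : State Char) : Set where
    constructor frame
    field
      arrs≡   : ∀ a → writesArr a P ≡ false → arrs s′ a ≡ arrs s a
      regs≡   : ∀ r → writesReg r P ≡ false → regs s′ r ≡ regs s r
      output≡ : emits P ≡ false → output s′ ≡ output s

  framed : ∀ {P s b} {Post : State Char → Set} → Exec P s b Post → Exec P s b (λ s′ → Post s′ × Frame P s s′)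
  framed (exec r c p) = exec r c (p , frame (unwritten-arr r) (unwritten-reg r) (unchanged-output r))

-- The invariant of a sweep

suc≢0 : ∀ {m n} → m ≡ suc n → m ≢ 0
suc≢0 refl ()

-- Pointers are shifted by one to make room for null. Since a list does not repeat an element, one
-- that has been popped does not come up again.
data Chain (next : ℕ → ℕ) : ℕ → List ℕ → Set where
  []  : Chain next 0 []
  _∷_ : ∀ {e es} → e ∉ es → Chain next (next e) es → Chain next (suc e) (e ∷ es)

Chain-empty : ∀ {next h es} → Chain next h es → h ≡ 0 → es ≡ []
Chain-empty [] _ = refl

Chain-nonempty : ∀ {next h es} → Chain next h es → h ≢ 0 → ∃[ e ] e ∈ es
Chain-nonempty []      h≢0 = ⊥-elim (h≢0 refl)
Chain-nonempty (_ ∷ _) _   = _ , here refl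

-- A head pointer is copied from word to word, and a run that stores a number of at least W is
-- stuck.
Chain-bound : ∀ {next h es W} → Chain next h es → 0 < W → (∀ {x} → x ∈ es → suc x < W) → h < W
Chain-bound []      0<W es<W = 0<W
Chain-bound (_ ∷ _) 0<W es<W = es<W (here refl)

Chain-uncons : ∀ {next h es} → Chain next h es → h ≢ 0 →
               ∃[ es′ ] es ≡ (h ∸ 1) ∷ es′ × (h ∸ 1) ∉ es′ × Chain next (next (h ∸ 1)) es′
Chain-uncons []        h≢0 = ⊥-elim (h≢0 refl)
Chain-uncons (e∉ ∷ ch) _   = _ , refl , e∉ , ch

Chain-update : ∀ {next h es x v} → x ∉ es → Chain next h es → Chain (next [ x ↦ v ]) h es
Chain-update x∉ [] = []
Chain-update {next} {x = x} x∉ (_∷_ {e} {es} e∉ ch) =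
  e∉ ∷ subst (λ h → Chain (next [ x ↦ _ ]) h es)
         (sym (lookup-other next λ e≡x → x∉ (here (sym e≡x))))
         (Chain-update (λ x∈ → x∉ (there x∈)) ch)

-- head and next represent, for every class c, the linked list Q c (0 is the null
-- pointer, suc e points to e); tgt c is the least target in it, and arbitrary if Q c is empty.
record Queue (cls F : ℕ → ℕ) (Q : ℕ → List ℕ) (head next tgt : ℕ → ℕ) : Set where
  field
    chain   : ∀ c → Chain next (head c) (Q c)
    classed : ∀ {c e} → e ∈ Q c → cls e ≡ c
    least   : ∀ {c e} → e ∈ Q c → tgt c ≤ F e
    reached : ∀ {c e} → e ∈ Q c → ∃[ x ] x ∈ Q c × F x ≡ tgt c

open Queue

∈-updated : ∀ (Q : ℕ → List ℕ) c {es} c′ {x} → x ∈ (Q [ c ↦ es ]) c′ →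
            (c′ ≡ c × x ∈ es) ⊎ (c′ ≢ c × x ∈ Q c′)
∈-updated Q c c′ x∈ with c′ ≟ c
... | yes refl = inj₁ (refl , subst (_ ∈_) (lookup-updated Q c) x∈)
... | no c′≢c  = inj₂ (c′≢c , subst (_ ∈_) (lookup-other Q c′≢c) x∈)

∈-updated⁺ : ∀ (Q : ℕ → List ℕ) c {es x} → x ∈ es → x ∈ (Q [ c ↦ es ]) c
∈-updated⁺ Q c x∈ = subst (_ ∈_) (sym (lookup-updated Q c)) x∈

∈-other : ∀ (Q : ℕ → List ℕ) {c es c′ x} → c′ ≢ c → x ∈ Q c′ → x ∈ (Q [ c ↦ es ]) c′
∈-other Q c′≢c x∈ = subst (_ ∈_) (sym (lookup-other Q c′≢c)) x∈

_◂_ : (ℕ → List ℕ) → ℕ × ℕ → ℕ → List ℕ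
Q ◂ (c , e) = Q [ c ↦ e ∷ Q c ]

∈-◂⁻ : ∀ Q c e c′ {x} → x ∈ (Q ◂ (c , e)) c′ → (c′ ≡ c × x ≡ e) ⊎ x ∈ Q c′
∈-◂⁻ Q c e c′ x∈ with ∈-updated Q c c′ x∈
... | inj₁ (refl , here x≡e)   = inj₁ (refl , x≡e)
... | inj₁ (refl , there x∈Q)  = inj₂ x∈Q
... | inj₂ (_ , x∈Q)           = inj₂ x∈Q

∈-◂⁺ : ∀ Q c e {c′ x} → x ∈ Q c′ → x ∈ (Q ◂ (c , e)) c′
∈-◂⁺ Q c e {c′} x∈ with c′ ≟ c
... | yes refl = ∈-updated⁺ Q c (there x∈)
... | no c′≢c  = ∈-other Q c′≢c x∈

module _ {cls F : ℕ → ℕ} {Q : ℕ → List ℕ} {head next tgt : ℕ → ℕ} where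

  push-chain : Queue cls F Q head next tgt → ∀ e → (∀ {c} → e ∉ Q c) → ∀ c →
    Chain (next [ e ↦ head (cls e) ]) ((head [ cls e ↦ suc e ]) c) ((Q ◂ (cls e , e)) c)
  push-chain q e e∉ c with c ≟ cls e
  ... | yes refl rewrite lookup-updated head (cls e) {suc e} | lookup-updated Q (cls e) {e ∷ Q (cls e)} =
    e∉ ∷ subst (λ h → Chain (next [ e ↦ head (cls e) ]) h (Q (cls e))) (sym (lookup-updated next e))
           (Chain-update e∉ (chain q (cls e)))
  ... | no c≢ rewrite lookup-other head {x = suc e} c≢ | lookup-other Q {x = e ∷ Q (cls e)} c≢ =
    Chain-update e∉ (chain q c)

  push-classed : Queue cls F Q head next tgt → ∀ e {c x} → x ∈ (Q ◂ (cls e , e)) c → cls x ≡ c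
  push-classed q e {c} x∈ with ∈-◂⁻ Q (cls e) e c x∈
  ... | inj₁ (refl , refl) = refl
  ... | inj₂ x∈Q = classed q x∈Q

  -- Covers two situations: the list is empty and its recorded target stale, or the new target is a
  -- minimum.
  push-lower : Queue cls F Q head next tgt → ∀ e → (∀ {c} → e ∉ Q c) →
    head (cls e) ≡ 0 ⊎ F e ≤ tgt (cls e) →
    Queue cls F (Q ◂ (cls e , e)) (head [ cls e ↦ suc e ]) (next [ e ↦ head (cls e) ]) (tgt [ cls e ↦ F e ])
  push-lower q e e∉ low = record
    { chain = push-chain q e e∉
    ; classed = push-classed q e
    ; least = λ {c} → least′ c
    ; reached = λ {c} → reached′ c
    }
    where
    least′ : ∀ c {x} → x ∈ (Q ◂ (cls e , e)) c → (tgt [ cls e ↦ F e ]) c ≤ F x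
    least′ c x∈ with ∈-updated Q (cls e) c x∈
    ... | inj₁ (refl , here refl) rewrite lookup-updated tgt (cls e) {F e} = ≤-refl
    ... | inj₂ (c≢ , x∈Q) rewrite lookup-other tgt {x = F e} c≢ = least q x∈Q
    ... | inj₁ (refl , there x∈Q) rewrite lookup-updated tgt (cls e) {F e} = below low
      where
      below : head (cls e) ≡ 0 ⊎ F e ≤ tgt (cls e) → F e ≤ F _
      below (inj₂ F≤) = ≤-trans F≤ (least q x∈Q)
      below (inj₁ h≡0) with subst (_ ∈_) (Chain-empty (chain q (cls e)) h≡0) x∈Q
      ... | ()
    reached′ : ∀ c {x} → x ∈ (Q ◂ (cls e , e)) c →
               ∃[ y ] y ∈ (Q ◂ (cls e , e)) c × F y ≡ (tgt [ cls e ↦ F e ]) c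
    reached′ c x∈ with ∈-updated Q (cls e) c x∈
    ... | inj₁ (refl , _) = e , ∈-updated⁺ Q (cls e) (here refl) , sym (lookup-updated tgt (cls e))
    ... | inj₂ (c≢ , x∈Q) with reached q x∈Q
    ...   | y , y∈ , Fy = y , ∈-other Q c≢ y∈ , trans Fy (sym (lookup-other tgt c≢))

  push-keep : Queue cls F Q head next tgt → ∀ e → (∀ {c} → e ∉ Q c) →
    head (cls e) ≢ 0 → tgt (cls e) ≤ F e →
    Queue cls F (Q ◂ (cls e , e)) (head [ cls e ↦ suc e ]) (next [ e ↦ head (cls e) ]) tgt
  push-keep q e e∉ h≢0 tgt≤ = record
    { chain = push-chain q e e∉
    ; classed = push-classed q e
    ; least = λ {c} → least′ c
    ; reached = λ {c} → reached′ c
    }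
    where
    least′ : ∀ c {x} → x ∈ (Q ◂ (cls e , e)) c → tgt c ≤ F x
    least′ c x∈ with ∈-◂⁻ Q (cls e) e c x∈
    ... | inj₁ (refl , refl) = tgt≤
    ... | inj₂ x∈Q = least q x∈Q
    reached′ : ∀ c {x} → x ∈ (Q ◂ (cls e , e)) c → ∃[ y ] y ∈ (Q ◂ (cls e , e)) c × F y ≡ tgt c
    reached′ c x∈ with ∈-◂⁻ Q (cls e) e c x∈
    ... | inj₂ x∈Q with reached q x∈Q
    ...   | y , y∈ , Fy = y , ∈-◂⁺ Q (cls e) e y∈ , Fy
    reached′ c x∈ | inj₁ (refl , refl) with reached q (proj₂ (Chain-nonempty (chain q (cls e)) h≢0))
    ...   | y , y∈ , Fy = y , ∈-◂⁺ Q (cls e) e y∈ , Fy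

  -- One write empties a list of any length: links and target may stay as they are, because `Queue`
  -- constrains them only through members.
  take-queue : Queue cls F Q head next tgt → ∀ c → Queue cls F (Q [ c ↦ [] ]) (head [ c ↦ 0 ]) next tgt
  take-queue q c = record
    { chain = chain′
    ; classed = λ {c′} x∈ → classed q (old c′ x∈)
    ; least = λ {c′} x∈ → least q (old c′ x∈)
    ; reached = λ {c′} x∈ → reached′ c′ x∈
    }
    where
    old : ∀ c′ {x} → x ∈ (Q [ c ↦ [] ]) c′ → x ∈ Q c′
    old c′ x∈ with ∈-updated Q c c′ x∈
    ... | inj₂ (_ , x∈Q) = x∈Q
    chain′ : ∀ c′ → Chain next ((head [ c ↦ 0 ]) c′) ((Q [ c ↦ [] ]) c′)
    chain′ c′ with c′ ≟ c
    ... | yes refl rewrite lookup-updated head c {0} | lookup-updated Q c {[]} = []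
    ... | no c′≢c rewrite lookup-other head {x = 0} c′≢c | lookup-other Q {x = []} c′≢c = chain q c′
    reached′ : ∀ c′ {x} → x ∈ (Q [ c ↦ [] ]) c′ → ∃[ y ] y ∈ (Q [ c ↦ [] ]) c′ × F y ≡ tgt c′
    reached′ c′ x∈ with ∈-updated Q c c′ x∈
    ... | inj₂ (c′≢c , x∈Q) with reached q x∈Q
    ...   | y , y∈ , Fy = y , ∈-other Q c′≢c y∈ , Fy

-- The data of a sweep over the positions [lo, hi): B marks the boundaries of the
-- strings, and F embeds every string into the tape.
record Targets (lo hi : ℕ) (cls B F : ℕ → ℕ) : Set where
  field
    lo-boundary : B lo ≢ 0
    hi-boundary : B hi ≢ 0
    F-lower     : ∀ {e} → lo ≤ e → e < hi → lo ≤ F e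
    F-upper     : ∀ {e} → lo ≤ e → e < hi → F e < hi
    F-class     : ∀ {e} → lo ≤ e → e < hi → cls (F e) ≡ cls e
    F-mono      : ∀ {e} → lo ≤ e → suc e < hi → B (suc e) ≡ 0 → F e < F (suc e)

-- G e = 0 if e is not matched yet, and G e = suc g if e is matched to position g.
module _ (B G : ℕ → ℕ) where

  -- By the shift in G, `G (pred e) ≤ j` puts the match of the predecessor strictly below `j`. An
  -- unmatched predecessor counts as lying before every position. Hence `After` can only shrink as G
  -- is extended, and the `fresh` fields survive every match.
  After : ℕ → ℕ → Set
  After e j = B e ≢ 0 ⊎ G (pred e) ≤ j

  -- Here the predecessor must really be matched: this is what entitles `e` to wait.
  Settled : ℕ → ℕ → Set
  Settled j e = B e ≢ 0 ⊎ (G (pred e) ≢ 0 × G (pred e) ≤ j)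

module _ (lo hi : ℕ) (cls B F : ℕ → ℕ) where

  -- `ahead` says that the target has not been missed, `fresh` that no earlier kept position could
  -- have served `e`.
  record Waiting (G keep : ℕ → ℕ) (j e : ℕ) : Set where
    field
      lower   : lo ≤ e
      upper   : e < hi
      undone  : G e ≡ 0
      ahead   : j ≤ F e
      settled : Settled B G j e
      fresh   : ∀ {i} → After B G e i → lo ≤ i → i < j → keep i ≢ 0 → cls i ≢ cls e

  -- `fresh` records the greedy choice: `g` is the first kept position of its class behind the match
  -- of the predecessor. Leftmostness of G rests on this field.
  record Matched (G keep : ℕ → ℕ) (j e g : ℕ) : Set where
    field
      lower   : lo ≤ g
      upper   : g < j
      kept    : keep g ≢ 0
      class   : cls g ≡ cls e
      behind  : g ≤ F e
      settled : Settled B G g e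
      fresh   : ∀ {i} → After B G e i → lo ≤ i → i < g → keep i ≢ 0 → cls i ≢ cls e

  -- The positions below j have been processed; if rest is nonempty, then
  -- position pred j is still being matched to the elements of rest.
  record Inv (j : ℕ) (rest : List ℕ) (Late : ℕ → Set) (Q : ℕ → List ℕ) (G keep head next tgt : ℕ → ℕ) : Set where
    field
      queue    : Queue cls F Q head next tgt
      queued   : ∀ {c e} → e ∈ Q c → Waiting G keep j e
      resting  : ∀ {e} → e ∈ rest → Waiting G keep (pred j) e
      resting′ : ∀ {e} → e ∈ rest → cls e ≡ cls (pred j)
      apart    : ∀ {e c} → e ∈ rest → e ∉ Q c
      covered  : ∀ {e} → lo ≤ e → e < hi → G e ≡ 0 →
                 e ∈ Q (cls e) ⊎ e ∈ rest ⊎ (B e ≡ 0 × G (pred e) ≡ 0) ⊎ Late e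
      finished : ∀ {e g} → lo ≤ e → e < hi → G e ≡ suc g → Matched G keep j e g
      kept     : ∀ {i} → lo ≤ i → keep i ≢ 0 →
                 (∃[ e ] lo ≤ e × e < hi × G e ≡ suc i × F e ≡ i) ⊎
                 (suc i ≡ j × ∃[ e ] e ∈ rest × F e ≡ i)
      keep≢0   : ∀ {i} → lo ≤ i → keep i ≢ 0 → i < j
      G-above  : ∀ {e} → hi ≤ e → G e ≡ 0

  open Inv

  -- The parameter `Late` of `Inv` excuses the one element whose predecessor has just been matched
  -- and which is not yet in a list. At all other moments nothing is excused.
  None : ℕ → Set
  None _ = ⊥

  module _ (tg : Targets lo hi cls B F) where
    open Targets tg

    start : ∀ {Q G keep head next tgt} → Queue cls F Q head next tgt →
            (∀ {c e} → e ∈ Q c → lo ≤ e × e < hi × B e ≢ 0) →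
            (∀ {e} → lo ≤ e → e < hi → B e ≢ 0 → e ∈ Q (cls e)) →
            (∀ {e} → lo ≤ e → G e ≡ 0) → (∀ {e} → lo ≤ e → keep e ≡ 0) → lo ≤ hi →
            Inv lo [] None Q G keep head next tgt
    start {Q} {G} q sound complete G≡0 keep≡0 lo≤hi = record
      { queue = q
      ; queued = λ e∈ → let l , u , b = sound e∈ in record
          { lower = l ; upper = u ; undone = G≡0 l ; ahead = F-lower l u ; settled = inj₁ b
          ; fresh = λ _ l′ u′ _ → ⊥-elim (<⇒≱ u′ l′) }
      ; resting = λ ()
      ; resting′ = λ ()
      ; apart = λ ()
      ; covered = λ {e} l u _ → cov l u
      ; finished = λ l u eq → ⊥-elim (suc≢0 eq (G≡0 l))
      ; kept = λ l k → ⊥-elim (k (keep≡0 l))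
      ; keep≢0 = λ l k → ⊥-elim (k (keep≡0 l))
      ; G-above = λ h → G≡0 (≤-trans lo≤hi h)
      }
      where
      cov : ∀ {e} → lo ≤ e → e < hi → e ∈ Q (cls e) ⊎ e ∈ [] ⊎ (B e ≡ 0 × G (pred e) ≡ 0) ⊎ ⊥
      cov {e} l u with B e ≟ 0
      ... | no b = inj₁ (complete l u b)
      cov {zero} z≤n u | yes b = ⊥-elim (lo-boundary b)
      cov {suc e} l u | yes b with m≤n⇒m<n∨m≡n l
      ... | inj₁ (s≤s l′) = inj₂ (inj₂ (inj₁ (b , G≡0 l′)))
      ... | inj₂ refl = ⊥-elim (lo-boundary b)

    module _ {j Q G keep head next tgt} (inv : Inv j [] None Q G keep head next tgt) where

      keep-zero : lo ≤ j → keep j ≡ 0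
      keep-zero lo≤j with keep j ≟ 0
      ... | yes eq = eq
      ... | no k = ⊥-elim (n≮n j (keep≢0 inv lo≤j k))

      -- An element with target `j` would have the class of `j`, as F preserves classes, so it would
      -- be in that list. All targets there are at least `j`, so `j` would be the least one, which
      -- the gate excludes. Hence every target lies beyond `j`.
      skip-position : lo ≤ j → j < hi → head (cls j) ≡ 0 ⊎ tgt (cls j) ≢ j → Inv (suc j) [] None Q G keep head next tgt
      skip-position lo≤j j<hi gate = record
        { queue = queue inv
        ; queued = λ {c} {e} e∈ → let w = queued inv e∈ in record
            { lower = Waiting.lower w ; upper = Waiting.upper w ; undone = Waiting.undone w
            ; ahead = ≤∧≢⇒< (Waiting.ahead w) (not-now e∈ w)
            ; settled = later (Waiting.settled w)
            ; fresh = λ a l u k → fresh′ w a l u k }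
        ; resting = λ ()
        ; resting′ = λ ()
        ; apart = λ ()
        ; covered = covered inv
        ; finished = λ l u eq → let m = finished inv l u eq in record
            { lower = Matched.lower m ; upper = m≤n⇒m≤1+n (Matched.upper m) ; kept = Matched.kept m
            ; class = Matched.class m ; behind = Matched.behind m ; settled = Matched.settled m
            ; fresh = Matched.fresh m }
        ; kept = λ l k → keep′ l k
        ; keep≢0 = λ l k → m≤n⇒m≤1+n (keep≢0 inv l k)
        ; G-above = G-above inv
        }
        where
        later : ∀ {e} → Settled B G j e → Settled B G (suc j) e
        later (inj₁ b) = inj₁ b
        later (inj₂ (n , le)) = inj₂ (n , m≤n⇒m≤1+n le)
        not-now : ∀ {c e} → e ∈ Q c → Waiting G keep j e → j ≢ F e
        not-now {c} {e} e∈ w j≡F with trans (cong cls j≡F) (trans (F-class (Waiting.lower w) (Waiting.upper w)) (classed (queue inv) e∈))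
        ... | refl = closed gate
          where
          closed : ¬ (head (cls j) ≡ 0 ⊎ tgt (cls j) ≢ j)
          closed (inj₁ h≡0) with subst (_ ∈_) (Chain-empty (chain (queue inv) c) h≡0) e∈
          ... | ()
          closed (inj₂ t≢) with reached (queue inv) e∈
          ... | x , x∈ , Fx = t≢ (≤-antisym (≤-trans (least (queue inv) e∈) (≤-reflexive (sym j≡F)))
                                             (≤-trans (Waiting.ahead (queued inv x∈)) (≤-reflexive Fx)))
        fresh′ : ∀ {e i} → Waiting G keep j e → After B G e i → lo ≤ i → i < suc j → keep i ≢ 0 → cls i ≢ cls e
        fresh′ w a l (s≤s u) k with m≤n⇒m<n∨m≡n u
        ... | inj₁ u′ = Waiting.fresh w a l u′ k
        ... | inj₂ refl = ⊥-elim (k (keep-zero l))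
        keep′ : ∀ {i} → lo ≤ i → keep i ≢ 0 → _
        keep′ l k with kept inv l k
        ... | inj₁ w = inj₁ w

      -- The whole list of the class goes to `rest`. Elements of other classes cannot have target
      -- `j`, so they stay ahead. The member attaining the least target is the witness that
      -- justifies keeping `j`.
      take-position : lo ≤ j → j < hi → head (cls j) ≢ 0 → tgt (cls j) ≡ j →
        Inv (suc j) (Q (cls j)) None (Q [ cls j ↦ [] ]) G (keep [ j ↦ 1 ]) (head [ cls j ↦ 0 ]) next tgt
      take-position lo≤j j<hi h≢0 t≡j = record
        { queue = take-queue (queue inv) (cls j)
        ; queued = λ {c} e∈ → queued′ (∈-updated Q (cls j) c e∈)
        ; resting = λ e∈ → let w = queued inv e∈ in record
            { lower = Waiting.lower w ; upper = Waiting.upper w ; undone = Waiting.undone w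
            ; ahead = Waiting.ahead w ; settled = Waiting.settled w
            ; fresh = λ a l u k → Waiting.fresh w a l u (old u k) }
        ; resting′ = classed (queue inv)
        ; apart = λ {e} {c} e∈ e∈′ → apart′ e∈ (∈-updated Q (cls j) c e∈′)
        ; covered = covered′
        ; finished = λ l u eq → let m = finished inv l u eq in record
            { lower = Matched.lower m ; upper = m≤n⇒m≤1+n (Matched.upper m)
            ; kept = new (Matched.upper m) (Matched.kept m)
            ; class = Matched.class m ; behind = Matched.behind m ; settled = Matched.settled m
            ; fresh = λ a l u k → Matched.fresh m a l u (old (<-trans u (Matched.upper m)) k) }
        ; kept = kept′
        ; keep≢0 = keep≢0′
        ; G-above = G-above inv
        }
        where
        old : ∀ {i} → i < j → (keep [ j ↦ 1 ]) i ≢ 0 → keep i ≢ 0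
        old i<j k eq = k (trans (lookup-other keep (<⇒≢ i<j)) eq)
        new : ∀ {i} → i < j → keep i ≢ 0 → (keep [ j ↦ 1 ]) i ≢ 0
        new i<j k eq = k (trans (sym (lookup-other keep (<⇒≢ i<j))) eq)
        later : ∀ {e} → Settled B G j e → Settled B G (suc j) e
        later (inj₁ b) = inj₁ b
        later (inj₂ (n , le)) = inj₂ (n , m≤n⇒m≤1+n le)
        queued′ : ∀ {c e} → (c ≡ cls j × e ∈ []) ⊎ (c ≢ cls j × e ∈ Q c) → Waiting G (keep [ j ↦ 1 ]) (suc j) e
        queued′ {c} {e} (inj₂ (c≢ , e∈)) = record
          { lower = Waiting.lower w ; upper = Waiting.upper w ; undone = Waiting.undone w
          ; ahead = ≤∧≢⇒< (Waiting.ahead w)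
              (λ j≡F → c≢ (sym (trans (cong cls j≡F) (trans (F-class (Waiting.lower w) (Waiting.upper w)) (classed (queue inv) e∈)))))
          ; settled = later (Waiting.settled w)
          ; fresh = fresh′ }
          where
          w = queued inv e∈
          fresh′ : ∀ {i} → After B G e i → lo ≤ i → i < suc j → (keep [ j ↦ 1 ]) i ≢ 0 → cls i ≢ cls e
          fresh′ a l (s≤s u) k with m≤n⇒m<n∨m≡n u
          ... | inj₁ u′ = Waiting.fresh w a l u′ (old u′ k)
          ... | inj₂ refl = λ eq → c≢ (sym (trans eq (classed (queue inv) e∈)))
        apart′ : ∀ {c e} → e ∈ Q (cls j) → ¬ ((c ≡ cls j × e ∈ []) ⊎ (c ≢ cls j × e ∈ Q c))
        apart′ e∈ (inj₂ (c≢ , e∈′)) = c≢ (trans (sym (classed (queue inv) e∈′)) (classed (queue inv) e∈))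
        covered′ : ∀ {e} → lo ≤ e → e < hi → G e ≡ 0 →
                   e ∈ (Q [ cls j ↦ [] ]) (cls e) ⊎ e ∈ Q (cls j) ⊎ (B e ≡ 0 × G (pred e) ≡ 0) ⊎ ⊥
        covered′ {e} l u z with covered inv l u z
        ... | inj₂ (inj₂ p) = inj₂ (inj₂ p)
        ... | inj₁ e∈ with cls e ≟ cls j
        ...   | yes eq = inj₂ (inj₁ (subst (λ c → e ∈ Q c) eq e∈))
        ...   | no ne = inj₁ (∈-other Q ne e∈)
        kept′ : ∀ {i} → lo ≤ i → (keep [ j ↦ 1 ]) i ≢ 0 →
                (∃[ e ] lo ≤ e × e < hi × G e ≡ suc i × F e ≡ i) ⊎ (suc i ≡ suc j × ∃[ e ] e ∈ Q (cls j) × F e ≡ i)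
        kept′ {i} l k with i ≟ j
        ... | yes refl with reached (queue inv) (proj₂ (Chain-nonempty (chain (queue inv) (cls j)) h≢0))
        ...   | x , x∈ , Fx = inj₂ (refl , x , x∈ , trans Fx t≡j)
        kept′ {i} l k | no i≢j with kept inv l (λ eq → k (trans (lookup-other keep i≢j) eq))
        ... | inj₁ w = inj₁ w
        keep≢0′ : ∀ {i} → lo ≤ i → (keep [ j ↦ 1 ]) i ≢ 0 → i < suc j
        keep≢0′ {i} l k with i ≟ j
        ... | yes refl = ≤-refl
        ... | no i≢j = m≤n⇒m≤1+n (keep≢0 inv l (λ eq → k (trans (lookup-other keep i≢j) eq)))

    module _ {j e rest Q G keep head next tgt}
             (inv : Inv (suc j) (e ∷ rest) None Q G keep head next tgt)
             (e∉ : e ∉ rest) (lo≤j : lo ≤ j) (kj : keep j ≢ 0) where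

      private
        we : Waiting G keep j e
        we = resting inv (here refl)

        Ge : G e ≡ 0
        Ge = Waiting.undone we

        G′ : ℕ → ℕ
        G′ = G [ e ↦ suc j ]

        nonzero : ∀ {x} → G x ≢ 0 → G′ x ≡ G x
        nonzero n = lookup-other G λ { refl → n Ge }

        done : ∀ {x v} → G x ≡ suc v → G′ x ≡ suc v
        done {x} eq = trans (nonzero (suc≢0 eq)) eq

        settled′ : ∀ {i x} → Settled B G i x → Settled B G′ i x
        settled′ (inj₁ b) = inj₁ b
        settled′ (inj₂ (n , le)) = inj₂ ((λ eq → n (trans (sym (nonzero n)) eq)) , ≤-trans (≤-reflexive (nonzero n)) le)

        after′ : ∀ {i x} → After B G′ x i → After B G x i
        after′ (inj₁ b) = inj₁ b
        after′ {i} {x} (inj₂ le) with G (pred x) ≟ 0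
        ... | yes eq = inj₂ (≤-trans (≤-reflexive eq) z≤n)
        ... | no n = inj₂ (≤-trans (≤-reflexive (sym (nonzero n))) le)

        waiting′ : ∀ {i x} → x ≢ e → Waiting G keep i x → Waiting G′ keep i x
        waiting′ x≢e w = record
          { lower = Waiting.lower w ; upper = Waiting.upper w
          ; undone = trans (lookup-other G x≢e) (Waiting.undone w)
          ; ahead = Waiting.ahead w ; settled = settled′ (Waiting.settled w)
          ; fresh = λ {i} a → Waiting.fresh w (after′ {i} a) }

        -- As `e` is still unmatched, its successor in the same string cannot be in a list, in
        -- `rest` or matched; each of these requires `Settled`.
        unsettled : B (suc e) ≡ 0 → ∀ {i} → ¬ Settled B G i (suc e)
        unsettled b (inj₁ n) = n b
        unsettled b (inj₂ (n , _)) = n Ge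

      successor-unqueued : B (suc e) ≡ 0 → ∀ {c} → suc e ∉ Q c
      successor-unqueued b x∈ = unsettled b (Waiting.settled (queued inv x∈))

      successor-unrested : B (suc e) ≡ 0 → suc e ∉ rest
      successor-unrested b x∈ = unsettled b (Waiting.settled (resting inv (there x∈)))

      -- Its target is beyond `F e`, hence beyond `j`. Freshness is vacuous: a position after the
      -- match of `e` is at least `suc j`.
      successor-waiting : B (suc e) ≡ 0 → Waiting G′ keep (suc j) (suc e)
      successor-waiting b = record
        { lower = m≤n⇒m≤1+n (Waiting.lower we)
        ; upper = upper′
        ; undone = trans (lookup-other G 1+n≢n) undone′
        ; ahead = ≤-trans (s≤s (Waiting.ahead we)) (F-mono (Waiting.lower we) upper′ b)
        ; settled = inj₂ (suc≢0 G′e , ≤-reflexive G′e)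
        ; fresh = λ { (inj₁ n) → ⊥-elim (n b)
                    ; (inj₂ le) _ u → ⊥-elim (<⇒≱ u (≤-trans (≤-reflexive (sym G′e)) le)) }
        }
        where
        G′e : G′ e ≡ suc j
        G′e = lookup-updated G e
        upper′ : suc e < hi
        upper′ with m≤n⇒m<n∨m≡n (Waiting.upper we)
        ... | inj₁ u = u
        ... | inj₂ refl = ⊥-elim (hi-boundary b)
        undone′ : G (suc e) ≡ 0
        undone′ with G (suc e) in eq
        ... | zero = refl
        ... | suc g = ⊥-elim (unsettled b (Matched.settled (finished inv (m≤n⇒m≤1+n (Waiting.lower we)) upper′ eq)))

      match : Inv (suc j) rest (λ x → x ≡ suc e × B x ≡ 0) Q G′ keep head next tgt
      match = record
        { queue = queue inv
        ; queued = λ {c} {x} x∈ → waiting′ (λ { refl → apart inv (here refl) x∈ }) (queued inv x∈)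
        ; resting = λ {x} x∈ → waiting′ (λ { refl → e∉ x∈ }) (resting inv (there x∈))
        ; resting′ = λ x∈ → resting′ inv (there x∈)
        ; apart = λ x∈ → apart inv (there x∈)
        ; covered = covered′
        ; finished = finished′
        ; kept = kept′
        ; keep≢0 = keep≢0 inv
        ; G-above = λ {x} h → trans (lookup-other G λ { refl → <⇒≱ (Waiting.upper we) h }) (G-above inv h)
        }
        where
        covered′ : ∀ {x} → lo ≤ x → x < hi → G′ x ≡ 0 →
                   x ∈ Q (cls x) ⊎ x ∈ rest ⊎ (B x ≡ 0 × G′ (pred x) ≡ 0) ⊎ (x ≡ suc e × B x ≡ 0)
        covered′ {x} l u z with x ≟ e
        ... | yes refl = ⊥-elim (suc≢0 (lookup-updated G e) z)
        ... | no x≢e with covered inv l u (trans (sym (lookup-other G x≢e)) z)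
        ...   | inj₁ x∈ = inj₁ x∈
        ...   | inj₂ (inj₁ (here x≡e)) = ⊥-elim (x≢e x≡e)
        ...   | inj₂ (inj₁ (there x∈)) = inj₂ (inj₁ x∈)
        covered′ {zero} l u z | no x≢e | inj₂ (inj₂ (inj₁ (b , _))) = inj₂ (inj₂ (inj₁ (b , z)))
        covered′ {suc x} l u z | no x≢e | inj₂ (inj₂ (inj₁ (b , z′))) with x ≟ e
        -- The excuse of having an unmatched predecessor is lost only by the successor of `e`, which
        -- thereby becomes late.
        ... | yes refl = inj₂ (inj₂ (inj₂ (refl , b)))
        ... | no x≢e′ = inj₂ (inj₂ (inj₁ (b , trans (lookup-other G x≢e′) z′)))
        finished′ : ∀ {x g} → lo ≤ x → x < hi → G′ x ≡ suc g → Matched G′ keep (suc j) x g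
        finished′ {x} l u eq with x ≟ e
        ... | no x≢e = let m = finished inv l u (trans (sym (lookup-other G x≢e)) eq) in record
            { lower = Matched.lower m ; upper = Matched.upper m ; kept = Matched.kept m
            ; class = Matched.class m ; behind = Matched.behind m ; settled = settled′ (Matched.settled m)
            ; fresh = λ {i} a → Matched.fresh m (after′ {i} a) }
        ... | yes refl with trans (sym eq) (lookup-updated G e)
        ...   | refl = record
            { lower = lo≤j ; upper = ≤-refl ; kept = kj ; class = sym (resting′ inv (here refl))
            ; behind = Waiting.ahead we ; settled = settled′ (Waiting.settled we)
            ; fresh = λ {i} a → Waiting.fresh we (after′ {i} a) }
        kept′ : ∀ {i} → lo ≤ i → keep i ≢ 0 →
                (∃[ x ] lo ≤ x × x < hi × G′ x ≡ suc i × F x ≡ i) ⊎ (suc i ≡ suc j × ∃[ x ] x ∈ rest × F x ≡ i)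
        kept′ l k with kept inv l k
        ... | inj₁ (x , l′ , u , eq , Fx) = inj₁ (x , l′ , u , done eq , Fx)
        ... | inj₂ (eq , x , there x∈ , Fx) = inj₂ (eq , x , x∈ , Fx)
        ... | inj₂ (refl , x , here refl , Fx) =
          inj₁ (e , Waiting.lower we , Waiting.upper we , lookup-updated G e , Fx)

    -- At a boundary the string of `e` is finished, and being late, which demands a non-boundary, is
    -- impossible.
    dismiss : ∀ {j e rest Q G keep head next tgt} → B (suc e) ≢ 0 →
              Inv j rest (λ x → x ≡ suc e × B x ≡ 0) Q G keep head next tgt →
              Inv j rest None Q G keep head next tgt
    dismiss {e = e} {rest} {Q} {G} b inv = record
      { queue = queue inv ; queued = queued inv ; resting = resting inv ; resting′ = resting′ inv ; apart = apart inv
      ; covered = covered′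
      ; finished = finished inv ; kept = kept inv ; keep≢0 = keep≢0 inv ; G-above = G-above inv }
      where
      covered′ : ∀ {x} → lo ≤ x → x < hi → G x ≡ 0 → x ∈ Q (cls x) ⊎ x ∈ rest ⊎ (B x ≡ 0 × G (pred x) ≡ 0) ⊎ ⊥
      covered′ l u z with covered inv l u z
      ... | inj₁ p = inj₁ p
      ... | inj₂ (inj₁ p) = inj₂ (inj₁ p)
      ... | inj₂ (inj₂ (inj₁ p)) = inj₂ (inj₂ (inj₁ p))
      ... | inj₂ (inj₂ (inj₂ (refl , b′))) = ⊥-elim (b b′)

    -- The new arrays are arbitrary up to `Queue`, so the ways of updating the least target need not
    -- be distinguished here.
    enqueue : ∀ {j e rest Q G keep head next tgt head′ next′ tgt′} →
              Waiting G keep j (suc e) → suc e ∉ rest →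
              Inv j rest (λ x → x ≡ suc e × B x ≡ 0) Q G keep head next tgt →
              Queue cls F (Q ◂ (cls (suc e) , suc e)) head′ next′ tgt′ →
              Inv j rest None (Q ◂ (cls (suc e) , suc e)) G keep head′ next′ tgt′
    enqueue {j} {e} {rest} {Q} {G} {keep} w ∉rest inv q = record
      { queue = q
      ; queued = λ {c} x∈ → queued′ (∈-◂⁻ Q (cls (suc e)) (suc e) c x∈)
      ; resting = resting inv ; resting′ = resting′ inv
      ; apart = λ {x} {c} x∈ x∈′ → apart′ x∈ (∈-◂⁻ Q (cls (suc e)) (suc e) c x∈′)
      ; covered = covered′
      ; finished = finished inv ; kept = kept inv ; keep≢0 = keep≢0 inv ; G-above = G-above inv }
      where
      queued′ : ∀ {c x} → (c ≡ cls (suc e) × x ≡ suc e) ⊎ x ∈ Q c → Waiting G keep j x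
      queued′ (inj₁ (_ , refl)) = w
      queued′ (inj₂ x∈) = queued inv x∈
      apart′ : ∀ {c x} → x ∈ rest → ¬ ((c ≡ cls (suc e) × x ≡ suc e) ⊎ x ∈ Q c)
      apart′ x∈ (inj₁ (_ , refl)) = ∉rest x∈
      apart′ x∈ (inj₂ x∈′) = apart inv x∈ x∈′
      covered′ : ∀ {x} → lo ≤ x → x < hi → G x ≡ 0 →
                 x ∈ (Q ◂ (cls (suc e) , suc e)) (cls x) ⊎ x ∈ rest ⊎ (B x ≡ 0 × G (pred x) ≡ 0) ⊎ ⊥
      covered′ l u z with covered inv l u z
      ... | inj₁ p = inj₁ (∈-◂⁺ Q (cls (suc e)) (suc e) p)
      ... | inj₂ (inj₁ p) = inj₂ (inj₁ p)
      ... | inj₂ (inj₂ (inj₁ p)) = inj₂ (inj₂ (inj₁ p))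
      ... | inj₂ (inj₂ (inj₂ (refl , _))) = inj₁ (∈-updated⁺ Q (cls (suc e)) (here refl))

    module _ {Q G keep head next tgt} (inv : Inv hi [] None Q G keep head next tgt) where

      private
        -- A waiting element would have a target of at least `hi`, but all targets are below `hi`.
        unqueued : ∀ {c e} → e ∉ Q c
        unqueued e∈ = let w = queued inv e∈ in <⇒≱ (F-upper (Waiting.lower w) (Waiting.upper w)) (Waiting.ahead w)

      heads-empty : ∀ c → head c ≡ 0
      heads-empty c with head c ≟ 0
      ... | yes eq = eq
      ... | no n = ⊥-elim (unqueued (proj₂ (Chain-nonempty (chain (queue inv) c) n)))

      -- With nothing queued, an unmatched element is a non-boundary with an unmatched predecessor.
      -- The descent along predecessors ends at `lo`, which is a boundary.
      all-done : ∀ e → lo ≤ e → e < hi → G e ≢ 0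
      all-done e l u z with covered inv l u z
      ... | inj₁ e∈ = unqueued e∈
      all-done zero l u z | inj₂ (inj₂ (inj₁ (b , _))) with n≤0⇒n≡0 l
      ... | refl = lo-boundary b
      all-done (suc e) l u z | inj₂ (inj₂ (inj₁ (b , z′))) with m≤n⇒m<n∨m≡n l
      ... | inj₁ (s≤s l′) = all-done e l′ (<-trans (n<1+n e) u) z′
      ... | inj₂ refl = lo-boundary b

-- The potential of the inner loop. A single visit may drain a long list, but each pop matches an
-- element for good.
zeros : (ℕ → ℕ) → ℕ → ℕ
zeros G zero = 0
zeros G (suc n) with G n
... | zero  = suc (zeros G n)
... | suc _ = zeros G n

zeros-≤ : ∀ G n → zeros G n ≤ n
zeros-≤ G zero = z≤n
zeros-≤ G (suc n) with G n
... | zero  = s≤s (zeros-≤ G n)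
... | suc _ = m≤n⇒m≤1+n (zeros-≤ G n)

zeros-cong : ∀ {G G′} n → (∀ {x} → x < n → G x ≡ G′ x) → zeros G n ≡ zeros G′ n
zeros-cong zero eq = refl
zeros-cong {G} {G′} (suc n) eq with G n | G′ n | eq {n} ≤-refl
... | zero  | _ | refl = cong suc (zeros-cong n λ u → eq (m≤n⇒m≤1+n u))
... | suc _ | _ | refl = zeros-cong n λ u → eq (m≤n⇒m≤1+n u)

zeros-update : ∀ {G} n {e v} → e < n → G e ≡ 0 → suc (zeros (G [ e ↦ suc v ]) n) ≡ zeros G n
zeros-update {G} (suc n) {e} {v} (s≤s e≤n) z with m≤n⇒m<n∨m≡n e≤n
... | inj₂ refl rewrite lookup-updated G e {suc v} | z =
  cong suc (zeros-cong n λ u → lookup-other G (<⇒≢ u))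
... | inj₁ e<n rewrite lookup-other G {x = suc v} (λ n≡e → <⇒≢ e<n (sym n≡e)) with G n
...   | zero  = cong suc (zeros-update n e<n z)
...   | suc _ = zeros-update n e<n z

-- The sweep program

-- Registers 10 and 11 hold lo and hi.  Arrays: 1 the boundaries, 4 the classes,
-- 5 the targets F, 6 the matching G, 7 the kept positions, 8 and 9 the heads and
-- links of the lists of waiting elements, 10 the least target in each list.

lower push enlist drain visit sweep : Program

lower = arr 10 [ reg 6 ]≔ arr 5 (reg 5)

push = (reg 6 ≔ arr 4 (reg 5)) ⨾
       (IF arr 8 (reg 6) ≐ lit 0 THEN lower ELSE
         (IF arr 5 (reg 5) ≺ arr 10 (reg 6) THEN lower ELSE skip)) ⨾
       (arr 9 [ reg 5 ]≔ arr 8 (reg 6)) ⨾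
       (arr 8 [ reg 6 ]≔ lit 1 ⊕ reg 5)

enlist = (IF arr 1 (reg 2) ≐ lit 0 THEN skip ELSE ((reg 5 ≔ reg 2) ⨾ push)) ⨾
         (reg 2 ≔ lit 1 ⊕ reg 2)

drain = (reg 5 ≔ reg 4 ⊖ lit 1) ⨾
        (reg 4 ≔ arr 9 (reg 5)) ⨾
        (arr 6 [ reg 5 ]≔ lit 1 ⊕ reg 2) ⨾
        (reg 5 ≔ lit 1 ⊕ reg 5) ⨾
        (IF arr 1 (reg 5) ≐ lit 0 THEN push ELSE skip)

visit = (reg 3 ≔ arr 4 (reg 2)) ⨾
        (IF ~ (arr 8 (reg 3) ≐ lit 0) & (arr 10 (reg 3) ≐ reg 2)
         THEN ((arr 7 [ reg 2 ]≔ lit 1) ⨾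
               (reg 4 ≔ arr 8 (reg 3)) ⨾
               -- The list is detached before it is drained, so a successor with the same letter
               -- enters the new list and is matched to a later position.
               (arr 8 [ reg 3 ]≔ lit 0) ⨾
               (WHILE ~ (reg 4 ≐ lit 0) DO drain))
         ELSE skip) ⨾
        (reg 2 ≔ lit 1 ⊕ reg 2)

sweep = (reg 2 ≔ reg 10) ⨾ (WHILE reg 2 ≺ reg 11 DO enlist) ⨾
        (reg 2 ≔ reg 10) ⨾ (WHILE reg 2 ≺ reg 11 DO visit)

-- `keep<` and `G-above` show the cells from `hi` on to be blank, as the second sweep requires.
record Swept (lo hi : ℕ) (cls B F G keep : ℕ → ℕ) : Set where
  field
    matched : ∀ {e} → lo ≤ e → e < hi → ∃[ g ] G e ≡ suc g × Matched lo hi cls B F G keep hi e g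
    kept    : ∀ {i} → lo ≤ i → keep i ≢ 0 → ∃[ e ] lo ≤ e × e < hi × G e ≡ suc i × F e ≡ i
    keep<   : ∀ {i} → lo ≤ i → keep i ≢ 0 → i < hi
    G-above : ∀ {e} → hi ≤ e → G e ≡ 0

Inv⇒Swept : ∀ {lo hi cls B F Q G keep head next tgt} → Targets lo hi cls B F →
            Inv lo hi cls B F hi [] (λ _ → ⊥) Q G keep head next tgt → Swept lo hi cls B F G keep
Inv⇒Swept {lo} {hi} {cls} {B} {F} {G = G} {keep} tg inv = record
  { matched = matched ; kept = kept ; keep< = Inv.keep≢0 inv ; G-above = Inv.G-above inv }
  where
  matched : ∀ {e} → lo ≤ e → e < hi → ∃[ g ] G e ≡ suc g × Matched lo hi cls B F G keep hi e g
  matched {e} l u with G e in eq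
  ... | zero  = ⊥-elim (all-done lo hi cls B F tg inv e l u eq)
  ... | suc g = g , refl , Inv.finished inv l u eq
  kept : ∀ {i} → lo ≤ i → keep i ≢ 0 → ∃[ e ] lo ≤ e × e < hi × G e ≡ suc i × F e ≡ i
  kept l k with Inv.kept inv l k
  ... | inj₁ w = w

module Sweeping
  {Char : Set} {_≺′_ : Rel Char 0ℓ} (isSTO : IsStrictTotalOrder _≡_ _≺′_)
  (input : List Char) (W : ℕ)
  where

  open Execution isSTO input W

  Queued : (ℕ → List ℕ) → State Char → Set
  Queued Q s = Queue (arrs s 4) (arrs s 5) Q (arrs s 8) (arrs s 9) (arrs s 10)

  -- The new links are given exactly, because a detached list that is still being drained lives in
  -- the same array.
  push-exec : ∀ {s Q} → let e = regs s 5 ; c = arrs s 4 e in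
    c < W → arrs s 5 e < W → suc e < W → (∀ {c x} → x ∈ Q c → suc x < W) →
    Queued Q s → (∀ {c} → e ∉ Q c) →
    Exec push s 32 (λ s′ → Queue (arrs s 4) (arrs s 5) (Q ◂ (c , e)) (arrs s′ 8) (arrs s′ 9) (arrs s′ 10)
                           × arrs s′ 9 ≡ arrs s 9 [ e ↦ arrs s 8 c ])
  push-exec {s} {Q} c<W F<W e<W Q<W q e∉ = by (h ≟ 0) (arrs s 5 e <? arrs s 10 c)
    where
    e = regs s 5
    c = arrs s 4 e
    h = arrs s 8 c
    h<W : h < W
    h<W = Chain-bound (Queue.chain q c) (<-trans (s≤s z≤n) e<W) Q<W
    by : Dec (h ≡ 0) → Dec (arrs s 5 e < arrs s 10 c) → Exec push s 32
          (λ s′ → Queue (arrs s 4) (arrs s 5) (Q ◂ (c , e)) (arrs s′ 8) (arrs s′ 9) (arrs s′ 10)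
                  × arrs s′ 9 ≡ arrs s 9 [ e ↦ h ])
    by (yes h≡0) _ = exec
      (seq (assign c<W) (seq (if-true (test-≡ h≡0) (store F<W)) (seq (store h<W) (store e<W))))
      (≤ᵇ⇒≤ _ _ tt)
      (push-lower q e e∉ (inj₁ h≡0) , refl)
    by (no h≢0) (yes lt) = exec
      (seq (assign c<W) (seq (if-false (test-≢ h≢0)
                              (if-true (test-< lt) (store F<W)))
                             (seq (store h<W) (store e<W))))
      (≤ᵇ⇒≤ _ _ tt)
      (push-lower q e e∉ (inj₂ (<⇒≤ lt)) , refl)
    by (no h≢0) (no ge) = exec
      (seq (assign c<W) (seq (if-false (test-≢ h≢0)
                              (if-false (test-≮ ge) skip))
                             (seq (store h<W) (store e<W))))
      (≤ᵇ⇒≤ _ _ tt)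
      (push-keep q e e∉ h≢0 (≮⇒≥ ge) , refl)

  record Setup (lo hi : ℕ) (cls B F : ℕ → ℕ) : Set where
    field
      targets : Targets lo hi cls B F
      hi<W    : hi < W
      cls<W   : ∀ {e} → e < hi → cls e < W
    open Targets targets public

  Setupₛ : State Char → Set
  Setupₛ s = Setup (regs s 10) (regs s 11) (arrs s 4) (arrs s 1) (arrs s 5)

  record Enlisted (lo i : ℕ) (cls B F : ℕ → ℕ) (Q : ℕ → List ℕ) (G keep head next tgt : ℕ → ℕ) : Set where
    field
      queue    : Queue cls F Q head next tgt
      sound    : ∀ {c e} → e ∈ Q c → lo ≤ e × e < i × B e ≢ 0
      complete : ∀ {e} → lo ≤ e → e < i → B e ≢ 0 → e ∈ Q (cls e)
      G≡0      : ∀ {e} → lo ≤ e → G e ≡ 0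
      keep≡0   : ∀ {e} → lo ≤ e → keep e ≡ 0

  EnlistInv : ℕ → ℕ → State Char → Set
  EnlistInv hi i s = Setupₛ s × regs s 11 ≡ hi × regs s 2 ≡ i × regs s 10 ≤ i ×
    ∃[ Q ] Enlisted (regs s 10) i (arrs s 4) (arrs s 1) (arrs s 5) Q
                    (arrs s 6) (arrs s 7) (arrs s 8) (arrs s 9) (arrs s 10)

  -- The invariant after the body of the loop, except that the counter is still i.
  EnlistMid : ℕ → ℕ → State Char → Set
  EnlistMid hi i s = Setupₛ s × regs s 11 ≡ hi × regs s 2 ≡ i × regs s 10 ≤ suc i ×
    ∃[ Q ] Enlisted (regs s 10) (suc i) (arrs s 4) (arrs s 1) (arrs s 5) Q
                    (arrs s 6) (arrs s 7) (arrs s 8) (arrs s 9) (arrs s 10)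

  enlist-exec : ∀ {hi i s} → i < hi → EnlistInv hi i s → Exec enlist s 64 (EnlistInv hi (suc i))
  enlist-exec {hi} {i} {s} i<hi (setup , refl , refl , lo≤i , Q , en) =
    weaken (≤ᵇ⇒≤ _ _ tt) (λ p → p) (branch (arrs s 1 i ≟ 0) ⨾ₑ increment)
    where
    open Enlisted en
    open Setup setup
    increment : ∀ {s′} → EnlistMid hi i s′ → Exec (reg 2 ≔ lit 1 ⊕ reg 2) s′ 4 (EnlistInv hi (suc i))
    increment (setup′ , hi≡ , i≡ , lo≤ , Q′ , en′) =
      exec (assign (≤-<-trans (≤-trans (s≤s (≤-reflexive i≡)) i<hi) hi<W)) ≤-refl
        (setup′ , hi≡ , cong suc i≡ , lo≤ , Q′ , en′)
    branch : Dec (arrs s 1 i ≡ 0) →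
             Exec (IF arr 1 (reg 2) ≐ lit 0 THEN skip ELSE ((reg 5 ≔ reg 2) ⨾ push)) s 39 (EnlistMid hi i)
    branch (yes b) = exec (if-true (test-≡ b) skip) (≤ᵇ⇒≤ _ _ tt)
      ( setup , refl , refl , m≤n⇒m≤1+n lo≤i , Q , record
        { queue = queue ; sound = λ e∈ → let l , u , n = sound e∈ in l , m≤n⇒m≤1+n u , n
        ; complete = complete′ ; G≡0 = G≡0 ; keep≡0 = keep≡0 })
      where
      complete′ : ∀ {e} → regs s 10 ≤ e → e < suc i → arrs s 1 e ≢ 0 → e ∈ Q (arrs s 4 e)
      complete′ l (s≤s u) n with m≤n⇒m<n∨m≡n u
      ... | inj₁ u′ = complete l u′ n
      ... | inj₂ refl = ⊥-elim (n b)
    branch (no b) = if₁ (test-≢ b) (λ ())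
      (λ _ → assign⨾ (<-trans i<hi hi<W)
        (weaken ≤-refl (λ { {s₂} ((q , _) , fr) → finish s₂ q fr })
          (framed (push-exec {⟪ regs s [ 5 ↦ i ] , arrs s , output s ⟫} {Q}
            (cls<W i<hi) (<-trans (F-upper lo≤i i<hi) hi<W) (≤-<-trans i<hi hi<W)
            (λ x∈ → ≤-<-trans (≤-trans (proj₁ (proj₂ (sound x∈))) (<⇒≤ i<hi)) hi<W) queue
            (λ x∈ → <-irrefl refl (proj₁ (proj₂ (sound x∈))))))))
      where
      c = arrs s 4 i
      finish : ∀ s₂ → Queue (arrs s 4) (arrs s 5) (Q ◂ (c , i)) (arrs s₂ 8) (arrs s₂ 9) (arrs s₂ 10) →
               Frame push ⟪ regs s [ 5 ↦ i ] , arrs s , output s ⟫ s₂ → EnlistMid hi i s₂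
      finish s₂ q (frame a r _)
        rewrite a 1 refl | a 4 refl | a 5 refl | a 6 refl | a 7 refl | r 2 refl | r 10 refl | r 11 refl =
        setup , refl , refl , m≤n⇒m≤1+n lo≤i , Q ◂ (c , i) , record
          { queue = q ; sound = λ {c′} e∈ → sound′ (∈-◂⁻ Q c i c′ e∈)
          ; complete = complete′ ; G≡0 = G≡0 ; keep≡0 = keep≡0 }
        where
        sound′ : ∀ {c′ e} → (c′ ≡ c × e ≡ i) ⊎ e ∈ Q c′ → regs s 10 ≤ e × e < suc i × arrs s 1 e ≢ 0
        sound′ (inj₁ (_ , refl)) = lo≤i , ≤-refl , b
        sound′ (inj₂ e∈) = let l , u , n = sound e∈ in l , m≤n⇒m≤1+n u , n
        complete′ : ∀ {e} → regs s 10 ≤ e → e < suc i → arrs s 1 e ≢ 0 → e ∈ (Q ◂ (c , i)) (arrs s 4 e)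
        complete′ l (s≤s u) n with m≤n⇒m<n∨m≡n u
        ... | inj₁ u′ = ∈-◂⁺ Q c i (complete l u′ n)
        ... | inj₂ refl = ∈-updated⁺ Q c (here refl)

  Invₛ : ℕ → List ℕ → (ℕ → List ℕ) → State Char → Set
  Invₛ j rest Q s = Inv (regs s 10) (regs s 11) (arrs s 4) (arrs s 1) (arrs s 5) j rest (λ _ → ⊥) Q
                        (arrs s 6) (arrs s 7) (arrs s 8) (arrs s 9) (arrs s 10)

  -- Rounded up: guard and `drain` take at most 5 + 60, guard and the rest of a `visit` at most 4 +
  -- 57.
  pop-cost visit-cost : ℕ
  pop-cost   = 70
  visit-cost = 64

  VisitInv : ℕ → State Char → Set
  VisitInv φ s = Setupₛ s × regs s 10 ≤ regs s 2 × regs s 2 ≤ regs s 11 ×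
    φ ≡ (regs s 11 ∸ regs s 2) * visit-cost + zeros (arrs s 6) (regs s 11) * pop-cost ×
    ∃[ Q ] Invₛ (regs s 2) [] Q s

  -- One position is under way, so that the remaining visits are those above j.
  DrainInv : ℕ → List ℕ → ℕ → State Char → Set
  DrainInv j rest φ s = Setupₛ s × regs s 2 ≡ j × regs s 10 ≤ j × j < regs s 11 ×
    φ ≡ (regs s 11 ∸ suc j) * visit-cost + zeros (arrs s 6) (regs s 11) * pop-cost ×
    ∃[ Q ] arrs s 7 j ≢ 0 × Chain (arrs s 9) (regs s 4) rest × Invₛ (suc j) rest Q s

  drain-exec : ∀ {j e rest φ s} → e ≡ regs s 4 ∸ 1 → e ∉ rest → Chain (arrs s 9) (arrs s 9 e) rest →
    Setupₛ s → regs s 2 ≡ j → regs s 10 ≤ j → j < regs s 11 → ∀ {Q} → arrs s 7 j ≢ 0 → Invₛ (suc j) (e ∷ rest) Q s →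
    φ ≡ (regs s 11 ∸ suc j) * visit-cost + zeros (arrs s 6) (regs s 11) * pop-cost →
    ∃[ φ′ ] Exec drain s 60 (DrainInv j rest φ′) × φ ≡ pop-cost + φ′
  drain-exec {j} {e} {rest} {φ} {s} refl e∉ ch setup refl lo≤j j<hi {Q} kj inv refl =
    φ′ , weaken (≤ᵇ⇒≤ _ _ tt) (λ p → p)
           (assign⨾ e<W (assign⨾ next<W (store⨾ j<W (assign⨾ (≤-<-trans e<hi hi<W) (suffix (B (suc e) ≟ 0))))))
       , φ≡
    where
    open Setup setup
    lo = regs s 10
    hi = regs s 11
    cls = arrs s 4
    B = arrs s 1
    F = arrs s 5
    G = arrs s 6
    G′ = G [ e ↦ suc j ]
    φ′ = (hi ∸ suc j) * visit-cost + zeros G′ hi * pop-cost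
    we = Inv.resting inv (here refl)
    e<hi : e < hi
    e<hi = Waiting.upper we
    e<W = <-trans e<hi hi<W
    j<W = ≤-<-trans j<hi hi<W
    next<W : arrs s 9 e < W
    next<W = Chain-bound ch (≤-<-trans z≤n hi<W) λ x∈ → ≤-<-trans (Waiting.upper (Inv.resting inv (there x∈))) hi<W
    -- Matching `e` lowers `zeros` by one, which releases the `pop-cost` that pays for this
    -- iteration.
    φ≡ : (hi ∸ suc j) * visit-cost + zeros G hi * pop-cost ≡ pop-cost + φ′
    φ≡ rewrite sym (zeros-update {G} hi {e} {j} e<hi (Waiting.undone we)) =
      trans (sym (+-assoc A pop-cost _)) (trans (cong (_+ zeros G′ hi * pop-cost) (+-comm A pop-cost)) (+-assoc pop-cost A _))
      where A = (hi ∸ suc j) * visit-cost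
    s₁ : State Char
    s₁ = ⟪ regs s [ 5 ↦ e ] [ 4 ↦ arrs s 9 e ] [ 5 ↦ suc e ] , arrs s [ 6 ↦ G′ ] , output s ⟫
    matched = match lo hi cls B F targets inv e∉ lo≤j kj
    suffix : Dec (B (suc e) ≡ 0) → Exec (IF arr 1 (reg 5) ≐ lit 0 THEN push ELSE skip) s₁ 37 (DrainInv j rest φ′)
    suffix (no b) = exec (if-false (test-≢ b) skip) (≤ᵇ⇒≤ _ _ tt)
      (setup , refl , lo≤j , j<hi , refl , Q , kj , ch , dismiss lo hi cls B F targets b matched)
    suffix (yes b) = if₁ (test-≡ b)
      (λ _ → weaken ≤-refl (λ { {s₂} ((q , next≡) , fr) → finish s₂ q next≡ fr })
        (framed (push-exec {s₁} {Q} (cls<W e′<hi) (<-trans (F-upper lo≤e′ e′<hi) hi<W) (≤-<-trans e′<hi hi<W)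
           (λ x∈ → ≤-<-trans (Waiting.upper (Inv.queued inv x∈)) hi<W)
           (Inv.queue inv) (successor-unqueued lo hi cls B F targets inv e∉ lo≤j kj b))))
      (λ ())
      where
      w′ = successor-waiting lo hi cls B F targets inv e∉ lo≤j kj b
      e′<hi = Waiting.upper w′
      lo≤e′ = Waiting.lower w′
      e′∉ = successor-unrested lo hi cls B F targets inv e∉ lo≤j kj b
      finish : ∀ s₂ → Queue cls F (Q ◂ (cls (suc e) , suc e)) (arrs s₂ 8) (arrs s₂ 9) (arrs s₂ 10) →
               arrs s₂ 9 ≡ arrs s 9 [ suc e ↦ arrs s 8 (cls (suc e)) ] → Frame push s₁ s₂ → DrainInv j rest φ′ s₂
      finish s₂ q next≡ (frame a r _)
        rewrite a 1 refl | a 4 refl | a 5 refl | a 6 refl | a 7 refl | r 2 refl | r 4 refl | r 10 refl | r 11 refl =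
        setup , refl , lo≤j , j<hi , refl , _ , kj ,
        -- The push overwrites only the link of `suc e`, which is not in `rest`, so the detached
        -- list stays intact.
        subst (λ next → Chain next (arrs s 9 e) rest) (sym next≡) (Chain-update e′∉ ch) ,
        enqueue lo hi cls B F targets w′ e′∉ matched q

  drain-step : ∀ {j φ s} → (∃[ rest ] DrainInv j rest φ s) →
    Iteration (~ (reg 4 ≐ lit 0)) drain (λ φ s → ∃[ rest ] DrainInv j rest φ s) (DrainInv j []) φ s
  drain-step {j} {φ} {s} (rest , setup , refl , lo≤j , j<hi , φ≡ , Q , kj , ch , inv) with regs s 4 ≟ 0
  ... | yes h≡0 with Chain-empty ch h≡0
  ...   | refl = stop (test-~≡ h≡0)
                      (setup , refl , lo≤j , j<hi , φ≡ , Q , kj , ch , inv)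
  drain-step {j} {φ} {s} (rest , setup , refl , lo≤j , j<hi , φ≡ , Q , kj , ch , inv) | no h≢0
    with Chain-uncons ch h≢0
  ... | rest′ , refl , e∉ , ch′ with drain-exec refl e∉ ch′ setup refl lo≤j j<hi kj inv φ≡
  ...   | φ′ , e , φ≡′ = continue (test-~≢ h≢0)
                           (saving φ′ (weaken ≤-refl (λ i → rest′ , i) e))
                           (≤-trans (+-monoˡ-≤ φ′ (≤ᵇ⇒≤ 65 pop-cost tt)) (≤-reflexive (sym φ≡′)))

  visit-gate : Test
  visit-gate = ~ (arr 8 (reg 3) ≐ lit 0) & (arr 10 (reg 3) ≐ reg 2)

  VisitMid : ℕ → ℕ → State Char → Set
  VisitMid j φ s = Setupₛ s × regs s 2 ≡ j × regs s 10 ≤ j × j < regs s 11 ×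
    φ ≡ (regs s 11 ∸ suc j) * visit-cost + zeros (arrs s 6) (regs s 11) * pop-cost ×
    ∃[ Q ] Invₛ (suc j) [] Q s

  increment-exec : ∀ {j φ s} → VisitMid j φ s → Exec (reg 2 ≔ lit 1 ⊕ reg 2) s 4 (VisitInv φ)
  increment-exec (setup , refl , lo≤j , j<hi , φ≡ , Q , inv) =
    exec (assign (≤-<-trans j<hi (Setup.hi<W setup))) ≤-refl (setup , m≤n⇒m≤1+n lo≤j , j<hi , φ≡ , Q , inv)

  visit-exec : ∀ {φ s} → VisitInv φ s → regs s 2 < regs s 11 →
    ∃[ φ′ ] Amort visit s φ′ VisitInv × 4 + φ′ ≤ φ
  visit-exec {φ} {s} (setup , lo≤j , j≤hi , refl , Q , inv) j<hi =
    -- 57 = 3 + 4 + 50: fetching the class, advancing the counter, and the conditional without the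
    -- pops.
    57 + rest-φ
      , assign⨾ₐ (cls<W j<hi) (then-exec (branch (arrs s 8 c ≟ 0) (arrs s 10 c ≟ j)) increment-exec)
      , ≤-trans (+-monoˡ-≤ rest-φ (≤ᵇ⇒≤ 61 visit-cost tt)) (≤-reflexive (sym pay))
    where
    open Setup setup
    lo = regs s 10
    hi = regs s 11
    j = regs s 2
    c = arrs s 4 j
    rest-φ = (hi ∸ suc j) * visit-cost + zeros (arrs s 6) hi * pop-cost
    s₁ : State Char
    s₁ = ⟪ regs s [ 3 ↦ c ] , arrs s , output s ⟫
    branch-program : Program
    branch-program = IF visit-gate
      THEN ((arr 7 [ reg 2 ]≔ lit 1) ⨾ (reg 4 ≔ arr 8 (reg 3)) ⨾ (arr 8 [ reg 3 ]≔ lit 0) ⨾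
            (WHILE ~ (reg 4 ≐ lit 0) DO drain))
      ELSE skip
    pay : (hi ∸ j) * visit-cost + zeros (arrs s 6) hi * pop-cost ≡ visit-cost + rest-φ
    pay = trans (cong (λ d → d * visit-cost + zeros (arrs s 6) hi * pop-cost) (+-∸-assoc 1 j<hi))
                (+-assoc visit-cost ((hi ∸ suc j) * visit-cost) _)
    skipped : arrs s 8 c ≡ 0 ⊎ arrs s 10 c ≢ j → VisitMid j rest-φ s₁
    skipped gate = setup , refl , lo≤j , j<hi , refl , Q , skip-position lo hi _ _ _ targets inv lo≤j j<hi gate
    branch : Dec (arrs s 8 c ≡ 0) → Dec (arrs s 10 c ≡ j) → Amort branch-program s₁ (50 + rest-φ) (VisitMid j)
    branch (yes h≡0) _ =
      weakenₐ (+-monoˡ-≤ rest-φ (≤ᵇ⇒≤ 12 50 tt))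
        (saving {b = 12} rest-φ (exec (if-false (test-∧ˡ (test-~≡ h≡0)) skip) ≤-refl (skipped (inj₁ h≡0))))
    branch (no h≢0) (no t≢) =
      weakenₐ (+-monoˡ-≤ rest-φ (≤ᵇ⇒≤ 12 50 tt))
        (saving {b = 12} rest-φ (exec (if-false (test-∧ (test-~≢ h≢0) (test-≢ t≢)) skip) ≤-refl (skipped (inj₂ t≢))))
    branch (no h≢0) (yes t≡) =
      weakenₐ (+-monoˡ-≤ rest-φ (≤ᵇ⇒≤ 25 50 tt))
        (if-trueₐ (test-∧ (test-~≢ h≢0) (test-≡ t≡))
          (store⨾ₐ (≤-<-trans (≤-trans (s≤s z≤n) j<hi) hi<W)
            (assign⨾ₐ h<W (store⨾ₐ (≤-<-trans z≤n hi<W)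
              (mapₐ (λ (setup , j≡ , lo≤ , <hi , φ≡ , Q , _ , _ , inv) → setup , j≡ , lo≤ , <hi , φ≡ , Q , inv)
               (while (λ φ s → ∃[ rest ] DrainInv j rest φ s) drain-step
                ( Q c , setup , refl , lo≤j , j<hi , refl , _
                , (λ eq → suc≢0 (lookup-updated (arrs s 7) j) eq)
                , Queue.chain (Inv.queue inv) c
                , take-position lo hi _ _ _ targets inv lo≤j j<hi h≢0 t≡)))))))
      where
      h<W : arrs s 8 c < W
      h<W = Chain-bound (Queue.chain (Inv.queue inv) c) (≤-<-trans z≤n hi<W)
              λ x∈ → ≤-<-trans (Waiting.upper (Inv.queued inv x∈)) hi<W

  -- Charged by `hi` rather than by `hi ∸ lo`, which for the second sweep loses a factor of two. The
  -- 68 is 4 for the guard and 64 for `enlist`.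
  sweep-cost : ℕ → ℕ
  sweep-cost hi = 12 + (hi * 68 + (hi * visit-cost + hi * pop-cost))

  sweep-exec : ∀ {s} → Setupₛ s → regs s 10 ≤ regs s 11 → (∀ c → arrs s 8 c ≡ 0) →
    (∀ {e} → regs s 10 ≤ e → arrs s 6 e ≡ 0) → (∀ {e} → regs s 10 ≤ e → arrs s 7 e ≡ 0) →
    Exec sweep s (sweep-cost (regs s 11)) (λ s′ →
      Swept (regs s 10) (regs s 11) (arrs s 4) (arrs s 1) (arrs s 5) (arrs s′ 6) (arrs s′ 7) ×
      (∀ c → arrs s′ 8 c ≡ 0))
  sweep-exec {s} setup lo≤hi heads≡0 G₀ keep₀ =
    weaken bound (λ { {s′} (p , fr) → finish s′ p fr })
      (framed (assign⨾ (≤-<-trans lo≤hi hi<W) (enlisting ⨾ₑ visiting)))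
    where
    open Setup setup
    lo = regs s 10
    hi = regs s 11
    Done : State Char → Set
    Done s = Setupₛ s × ∃[ Q ] Invₛ (regs s 11) [] Q s
    finish : ∀ s′ → Done s′ → Frame sweep s s′ →
      Swept lo hi (arrs s 4) (arrs s 1) (arrs s 5) (arrs s′ 6) (arrs s′ 7) × (∀ c → arrs s′ 8 c ≡ 0)
    finish s′ p (frame a r _)
      with regs s′ 10 | regs s′ 11 | arrs s′ 1 | arrs s′ 4 | arrs s′ 5
         | r 10 refl | r 11 refl | a 1 refl | a 4 refl | a 5 refl | p
    ... | _ | _ | _ | _ | _ | refl | refl | refl | refl | refl | setup′ , Q , inv =
      Inv⇒Swept targets inv , heads-empty lo hi _ _ _ targets inv
    bound : 2 + ((4 + (hi ∸ lo) * 68) + (2 + (4 + (hi * visit-cost + hi * pop-cost)))) ≤ sweep-cost hi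
    bound = begin
      6 + (hi ∸ lo) * 68 + (6 + R)    ≡⟨ +-comm (6 + (hi ∸ lo) * 68) (6 + R) ⟩
      6 + R + (6 + (hi ∸ lo) * 68)    ≤⟨ +-monoʳ-≤ (6 + R) (+-monoʳ-≤ 6 (*-monoˡ-≤ 68 (m∸n≤m hi lo))) ⟩
      6 + R + (6 + hi * 68)           ≡⟨ +-comm (6 + R) (6 + hi * 68) ⟩
      6 + (hi * 68 + (6 + R))         ≡⟨ cong (6 +_) (sym (+-assoc (hi * 68) 6 R)) ⟩
      6 + (hi * 68 + 6 + R)           ≡⟨ cong (λ x → 6 + (x + R)) (+-comm (hi * 68) 6) ⟩
      12 + (hi * 68 + R)              ∎
      where
      open ≤-Reasoning
      R = hi * visit-cost + hi * pop-cost
    enlisting : Exec (WHILE reg 2 ≺ reg 11 DO enlist) ⟪ regs s [ 2 ↦ lo ] , arrs s , output s ⟫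
                  (4 + (hi ∸ lo) * 68) (EnlistInv hi hi)
    enlisting = for hi 64 (EnlistInv hi)
      (λ i<hi inv → test-< (subst₂ _<_ (sym (proj₁ (proj₂ (proj₂ inv)))) (sym (proj₁ (proj₂ inv))) i<hi) , enlist-exec i<hi inv)
      (λ inv → test-≮ (λ lt → <-irrefl (trans (proj₁ (proj₂ (proj₂ inv))) (sym (proj₁ (proj₂ inv)))) lt))
      lo≤hi
      ( setup , refl , refl , ≤-refl , (λ _ → []) , record
        { queue = record { chain = λ c → subst (λ h → Chain (arrs s 9) h []) (sym (heads≡0 c)) []
                         ; classed = λ () ; least = λ () ; reached = λ () }
        ; sound = λ () ; complete = λ l u _ → ⊥-elim (<⇒≱ u l) ; G≡0 = G₀ ; keep≡0 = keep₀ })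
    visiting : ∀ {hi s} → EnlistInv hi hi s →
      Exec ((reg 2 ≔ reg 10) ⨾ (WHILE reg 2 ≺ reg 11 DO visit)) s (2 + (4 + (hi * visit-cost + hi * pop-cost))) Done
    visiting {_} {s} (setup , refl , _ , lo≤hi , Q , en) =
      assign⨾ (≤-<-trans lo≤hi (Setup.hi<W setup))
        (weaken (+-monoʳ-≤ 4 (+-mono-≤ (*-monoˡ-≤ visit-cost (m∸n≤m (regs s 11) (regs s 10)))
                                       (*-monoˡ-≤ pop-cost (zeros-≤ (arrs s 6) (regs s 11))))) (λ p → p)
          ⌊ while VisitInv visit-step (setup , ≤-refl , lo≤hi , refl , Q ,
              start _ _ _ _ _ (Setup.targets setup) queue sound complete G≡0 keep≡0 lo≤hi) ⌋ₐ)
      where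
      open Enlisted en
      visit-step : ∀ {φ s} → VisitInv φ s → Iteration (reg 2 ≺ reg 11) visit VisitInv (λ _ → Done) φ s
      visit-step {φ} {s} v@(setup , lo≤j , j≤hi , _ , Q , inv) with m≤n⇒m<n∨m≡n j≤hi
      ... | inj₁ j<hi with visit-exec v j<hi
      ...   | φ′ , a , le = continue (test-< j<hi) a le
      visit-step {φ} {s} (setup , lo≤j , j≤hi , _ , Q , inv) | inj₂ j≡hi =
        stop (test-≮ (<-irrefl j≡hi)) (setup , Q , subst (λ j → Invₛ j [] Q s) j≡hi inv)

-- Numbering the letters

‼-just : {X : Set} (tape : List X) {p : ℕ} → p < length tape → ∃[ c ] tape ‼ p ≡ just c
‼-just (x ∷ tape) {zero}  _       = x , refl
‼-just (x ∷ tape) {suc p} (s≤s u) = ‼-just tape u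

record Classes {Char : Set} (tape : List Char) (cls : ℕ → ℕ) : Set where
  field
    sound    : ∀ {p q} → p < length tape → q < length tape → cls p ≡ cls q → tape ‼ p ≡ tape ‼ q
    complete : ∀ {p q} → p < length tape → q < length tape → tape ‼ p ≡ tape ‼ q → cls p ≡ cls q

-- Registers: 1 the length of the tape, 2 the output position, 3 the width of the
-- sorted blocks, 4 and 7 the read positions in the two blocks to be merged, and 5
-- and 6 the ends of these blocks.  Arrays 2 and 3 hold the permutation and the
-- result of the merge.

-- With truncated subtraction, `v ∸ (v ∸ n)` is the minimum of `v` and `n`; expressions have no
-- conditional.
min-length : Expr → Expr
min-length e = e ⊖ (e ⊖ reg 1)

next-blocks take-left take-right choose merge copy level sort-positions : Program

next-blocks = (reg 4 ≔ reg 6) ⨾ (reg 5 ≔ min-length (reg 6 ⊕ reg 3)) ⨾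
              (reg 7 ≔ reg 5) ⨾ (reg 6 ≔ min-length (reg 5 ⊕ reg 3))

take-left  = (arr 3 [ reg 2 ]≔ arr 2 (reg 4)) ⨾ (reg 4 ≔ lit 1 ⊕ reg 4)
take-right = (arr 3 [ reg 2 ]≔ arr 2 (reg 7)) ⨾ (reg 7 ≔ lit 1 ⊕ reg 7)

choose = IF reg 4 ≺ reg 5
         THEN (IF reg 7 ≺ reg 6
               THEN (IF arr 2 (reg 7) ≺ᶜ arr 2 (reg 4) THEN take-right ELSE take-left)
               ELSE take-left)
         ELSE take-right

-- Every iteration writes one entry and loads the next pair of blocks when one is exhausted. A whole
-- level is thus a single counted loop.
merge = (IF reg 2 ≐ reg 6 THEN next-blocks ELSE skip) ⨾ choose ⨾ (reg 2 ≔ lit 1 ⊕ reg 2)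

copy = (arr 2 [ reg 2 ]≔ arr 3 (reg 2)) ⨾ (reg 2 ≔ lit 1 ⊕ reg 2)

level = (reg 2 ≔ lit 0) ⨾ (reg 6 ≔ lit 0) ⨾ (WHILE reg 2 ≺ reg 1 DO merge) ⨾
        (reg 2 ≔ lit 0) ⨾ (WHILE reg 2 ≺ reg 1 DO copy) ⨾
        (reg 3 ≔ reg 3 ⊕ reg 3)

sort-positions = (reg 3 ≔ lit 1) ⨾ (WHILE reg 3 ≺ reg 1 DO level)

-- Equal characters are consecutive in the sorted order, so they get the same number.

number classify : Program

number = (IF lit 0 ≺ reg 2
          THEN (IF arr 2 (reg 2 ⊖ lit 1) ≺ᶜ arr 2 (reg 2) THEN (reg 3 ≔ lit 1 ⊕ reg 3) ELSE skip)
          ELSE skip) ⨾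
         (arr 4 [ arr 2 (reg 2) ]≔ reg 3) ⨾
         (reg 2 ≔ lit 1 ⊕ reg 2)

classify = (reg 2 ≔ lit 0) ⨾ (reg 3 ≔ lit 0) ⨾ (WHILE reg 2 ≺ reg 1 DO number)

module Sorting
  {Char : Set} {_≺′_ : Rel Char 0ℓ} (isSTO : IsStrictTotalOrder _≡_ _≺′_)
  (input : List Char) (W : ℕ)
  where

  open Execution isSTO input W
  open IsStrictTotalOrder isSTO using (compare; irrefl) renaming (_<?_ to _<ᶜ?_; trans to <ᶜ-trans)

  N : ℕ
  N = length input

  T : ℕ → Maybe Char
  T p = input ‼ p

  -- A record, so that `p` and `q` can be inferred. The relation is vacuous off the tape, which is
  -- why transitivity asks for the middle position to be on it.
  record _≼_ (p q : ℕ) : Set where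
    constructor not-above
    field
      apply : ∀ {x y} → T p ≡ just x → T q ≡ just y → ¬ (y ≺′ x)

  same⇒≼ : ∀ {p q} → T p ≡ T q → p ≼ q
  same⇒≼ eq = not-above λ px qy → irrefl (sym (just-injective (trans (sym px) (trans eq qy))))

  ≼-refl : ∀ {p} → p ≼ p
  ≼-refl = same⇒≼ refl

  ≼-trans : ∀ {p q r} → q < N → p ≼ q → q ≼ r → p ≼ r
  ≼-trans {p} {q} {r} q<N (not-above p≼q) (not-above q≼r) = not-above λ {x} {z} px rz z<x → impossible px rz z<x (‼-just input q<N)
    where
    impossible : ∀ {x z} → T p ≡ just x → T r ≡ just z → z ≺′ x → ∃[ y ] T q ≡ just y → ⊥
    impossible {x} px rz z<x (y , qy) with compare x y
    ... | tri< x<y _ _  = q≼r qy rz (<ᶜ-trans z<x x<y)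
    ... | tri≈ _ refl _ = q≼r qy rz z<x
    ... | tri> _ _ y<x  = p≼q px qy y<x

  -- On the tape the comparison cannot get stuck. Both outcomes are put in terms of `≼` for the
  -- merge; the strict one also says that the letters differ, for the numbering.
  test-≺ᶜ : ∀ {p q} → p < N → q < N →
    (zipWith (λ x y → does (x <ᶜ? y)) (T p) (T q) ≡ just true × p ≼ q × T p ≢ T q) ⊎
    (zipWith (λ x y → does (x <ᶜ? y)) (T p) (T q) ≡ just false × q ≼ p)
  test-≺ᶜ {p} {q} p<N q<N with ‼-just input p<N | ‼-just input q<N
  ... | x , px | y , qy = by (x <ᶜ? y)
    where
    result : ∀ {b} → does (x <ᶜ? y) ≡ b → zipWith (λ x y → does (x <ᶜ? y)) (T p) (T q) ≡ just b
    result eq rewrite px | qy = cong just eq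
    by : Dec (x ≺′ y) → _
    by (yes x<y) = inj₁ ( result (dec-true (x <ᶜ? y) x<y)
                        , not-above (λ px′ qy′ y<x → irrefl refl (<ᶜ-trans x<y
                            (subst₂ _≺′_ (just-injective (trans (sym qy′) qy)) (just-injective (trans (sym px′) px)) y<x)))
                        , λ eq → irrefl (just-injective (trans (sym px) (trans eq qy))) x<y )
    by (no x≮y)  = inj₂ ( result (dec-false (x <ᶜ? y) x≮y)
                        , not-above λ qy′ px′ x<y → x≮y
                            (subst₂ _≺′_ (just-injective (trans (sym px′) px)) (just-injective (trans (sym qy′) qy)) x<y) )

  ≼-antisym : ∀ {p q} → p < N → q < N → p ≼ q → q ≼ p → T p ≡ T q
  ≼-antisym p<N q<N (not-above p≼q) (not-above q≼p) with ‼-just input p<N | ‼-just input q<N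
  ... | x , px | y , qy with compare x y
  ...   | tri< x<y _ _  = ⊥-elim (q≼p qy px x<y)
  ...   | tri≈ _ refl _ = trans px (sym qy)
  ...   | tri> _ _ y<x  = ⊥-elim (p≼q px qy y<x)

  -- Merging sorted blocks

  Blocks : ℕ → ℕ → (ℕ → ℕ) → Set
  Blocks n w a = ∀ m {p q} → m * w ≤ p → p ≤ q → q < suc m * w → q < n → a p ≼ a q

  -- A map of [0, N) into itself that is onto is a bijection.
  record Permutation (a : ℕ → ℕ) : Set where
    field
      bounded : ∀ {p} → p < N → a p < N
      onto    : ∀ {x} → x < N → ∃[ p ] p < N × a p ≡ x

  -- Pair number `m` begins at `s`; the left block is read at `x` up to `mid`, the right one at `y`
  -- up to `end`. The field `count` is `o ∸ s = (x ∸ s) + (y ∸ mid)` with the subtractions cleared.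
  record Merging (w m : ℕ) (a b : ℕ → ℕ) (o x mid end y : ℕ) : Set where
    s : ℕ
    s = m * (w + w)
    field
      s≤x         : s ≤ x
      x≤mid       : x ≤ mid
      mid≤y       : mid ≤ y
      y≤end       : y ≤ end
      end≤N       : end ≤ N
      end≡        : end ≡ N ⊎ end ≡ suc m * (w + w)
      count       : o + mid ≡ x + y
      left        : ∀ {p q} → s ≤ p → p ≤ q → q < mid → a p ≼ a q
      right       : ∀ {p q} → mid ≤ p → p ≤ q → q < end → a p ≼ a q
      sorted      : Blocks o (w + w) b
      below-left  : ∀ {p} → s ≤ p → p < o → x < mid → b p ≼ a x
      below-right : ∀ {p} → s ≤ p → p < o → y < end → b p ≼ a y
      bounded     : ∀ {p} → p < o → b p < N
      covered     : ∀ {p} → p < x ⊎ (mid ≤ p × p < y) → ∃[ q ] q < o × b q ≡ a p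

    s≤o : s ≤ o
    s≤o = +-cancelʳ-≤ mid s o (≤-trans (+-mono-≤ s≤x mid≤y) (≤-reflexive (sym count)))

    o≤end : o ≤ end
    o≤end = +-cancelʳ-≤ mid o end (≤-trans (≤-reflexive count)
              (≤-trans (+-mono-≤ x≤mid y≤end) (≤-reflexive (+-comm mid end))))

  module _ {w m a b o x mid end y} (mg : Merging w m a b o x mid end y) (perm : Permutation a) where
    open Merging mg
    private
      module Perm = Permutation perm

      old : ∀ {v p} → p < o → (b [ o ↦ v ]) p ≡ b p
      old p<o = lookup-other b (<⇒≢ p<o)

      new : ∀ {v} → (b [ o ↦ v ]) o ≡ v
      new = lookup-updated b o

      append-sorted : ∀ {v} → (∀ {p} → s ≤ p → p < o → b p ≼ v) → Blocks (suc o) (w + w) (b [ o ↦ v ])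
      append-sorted {v} below m′ {p} {q} l p≤q u (s≤s q≤o) with m≤n⇒m<n∨m≡n q≤o
      ... | inj₁ q<o = subst₂ _≼_ (sym (old (≤-<-trans p≤q q<o))) (sym (old q<o)) (sorted m′ l p≤q u q<o)
      ... | inj₂ refl with m≤n⇒m<n∨m≡n p≤q
      ...   | inj₂ refl = ≼-refl
      ...   | inj₁ p<o = subst₂ _≼_ (sym (old p<o)) (sym new) (below (≤-trans s≤ l) p<o)
        where
        -- A block of width `w + w` that contains `o` cannot come before pair `m`, whose start is at
        -- most `o`.
        s≤ : s ≤ m′ * (w + w)
        s≤ = *-monoˡ-≤ (w + w) (≤-pred (*-cancelʳ-< (w + w) m (suc m′) (≤-<-trans s≤o u)))

      append-covered : ∀ {v p} → ∃[ q ] q < o × b q ≡ a p → ∃[ q ] q < suc o × (b [ o ↦ v ]) q ≡ a p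
      append-covered (q , q<o , eq) = q , m≤n⇒m≤1+n q<o , trans (old q<o) eq

      append-bounded : ∀ {v} → v < N → ∀ {p} → p < suc o → (b [ o ↦ v ]) p < N
      append-bounded v<N (s≤s p≤o) with m≤n⇒m<n∨m≡n p≤o
      ... | inj₁ p<o = subst (_< N) (sym (old p<o)) (bounded p<o)
      ... | inj₂ refl = subst (_< N) (sym new) v<N

      append-below : ∀ {v r} → v ≼ r → (∀ {p} → s ≤ p → p < o → b p ≼ r) →
                     ∀ {p} → s ≤ p → p < suc o → (b [ o ↦ v ]) p ≼ r
      append-below v≼r below s≤p (s≤s p≤o) with m≤n⇒m<n∨m≡n p≤o
      ... | inj₁ p<o = subst (_≼ _) (sym (old p<o)) (below s≤p p<o)
      ... | inj₂ refl = subst (_≼ _) (sym new) v≼r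

    merge-left : x < mid → (y < end → a x ≼ a y) → Merging w m a (b [ o ↦ a x ]) (suc o) (suc x) mid end y
    merge-left x<mid x≼y = record
      { s≤x = m≤n⇒m≤1+n s≤x ; x≤mid = x<mid ; mid≤y = mid≤y ; y≤end = y≤end ; end≤N = end≤N ; end≡ = end≡
      ; count = cong suc count ; left = left ; right = right
      ; sorted = append-sorted (λ s≤p p<o → below-left s≤p p<o x<mid)
      ; below-left = λ s≤p p<o 1+x<mid → append-below (left s≤x (n≤1+n x) 1+x<mid)
          (λ s≤p p<o → ≼-trans ax<N (below-left s≤p p<o x<mid) (left s≤x (n≤1+n x) 1+x<mid)) s≤p p<o
      ; below-right = λ s≤p p<o y<end → append-below (x≼y y<end) (λ s≤p p<o → below-right s≤p p<o y<end) s≤p p<o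
      ; bounded = append-bounded ax<N
      ; covered = covered′
      }
      where
      ax<N : a x < N
      ax<N = Perm.bounded (≤-trans x<mid (≤-trans mid≤y (≤-trans y≤end end≤N)))
      covered′ : ∀ {p} → p < suc x ⊎ (mid ≤ p × p < y) → ∃[ q ] q < suc o × (b [ o ↦ a x ]) q ≡ a p
      covered′ (inj₂ r) = append-covered (covered (inj₂ r))
      covered′ (inj₁ (s≤s p≤x)) with m≤n⇒m<n∨m≡n p≤x
      ... | inj₁ p<x = append-covered (covered (inj₁ p<x))
      ... | inj₂ refl = o , ≤-refl , new

    merge-right : y < end → (x < mid → a y ≼ a x) → Merging w m a (b [ o ↦ a y ]) (suc o) x mid end (suc y)
    merge-right y<end y≼x = record
      { s≤x = s≤x ; x≤mid = x≤mid ; mid≤y = m≤n⇒m≤1+n mid≤y ; y≤end = y<end ; end≤N = end≤N ; end≡ = end≡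
      ; count = trans (cong suc count) (sym (+-suc x y)) ; left = left ; right = right
      ; sorted = append-sorted (λ s≤p p<o → below-right s≤p p<o y<end)
      ; below-left = λ s≤p p<o x<mid → append-below (y≼x x<mid) (λ s≤p p<o → below-left s≤p p<o x<mid) s≤p p<o
      ; below-right = λ s≤p p<o 1+y<end → append-below (right mid≤y (n≤1+n y) 1+y<end)
          (λ s≤p p<o → ≼-trans ay<N (below-right s≤p p<o y<end) (right mid≤y (n≤1+n y) 1+y<end)) s≤p p<o
      ; bounded = append-bounded ay<N
      ; covered = covered′
      }
      where
      ay<N : a y < N
      ay<N = Perm.bounded (≤-trans y<end end≤N)
      covered′ : ∀ {p} → p < x ⊎ (mid ≤ p × p < suc y) → ∃[ q ] q < suc o × (b [ o ↦ a y ]) q ≡ a p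
      covered′ (inj₁ p<x) = append-covered (covered (inj₁ p<x))
      covered′ (inj₂ (mid≤p , s≤s p≤y)) with m≤n⇒m<n∨m≡n p≤y
      ... | inj₁ p<y = append-covered (covered (inj₂ (mid≤p , p<y)))
      ... | inj₂ refl = o , ≤-refl , new

  -- The state between two pairs, where the read positions carry no information.
  record Merged (w : ℕ) (a b : ℕ → ℕ) (o : ℕ) : Set where
    field
      sorted  : Blocks o (w + w) b
      bounded : ∀ {p} → p < o → b p < N
      covered : ∀ {p} → p < o → ∃[ q ] q < o × b q ≡ a p
      aligned : o < N → ∃[ m ] o ≡ m * (w + w)

  -- When the output reaches `end`, `count` forces both read positions to the ends of their blocks.
  finish-blocks : ∀ {w m a b o x mid end y} → Merging w m a b o x mid end y → o ≡ end → Merged w a b o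
  finish-blocks {w} {m} {a} {b} {o} {x} {mid} {end} {y} mg refl = record
    { sorted = sorted ; bounded = bounded ; covered = covered′ ; aligned = aligned }
    where
    open Merging mg
    x≡mid : mid ≤ x
    x≡mid = +-cancelʳ-≤ end mid x (≤-trans (≤-reflexive (trans (+-comm mid end) count)) (+-monoʳ-≤ x y≤end))
    end≤y : end ≤ y
    end≤y = +-cancelʳ-≤ mid end y (≤-trans (≤-reflexive (trans count (+-comm x y))) (+-monoʳ-≤ y x≤mid))
    covered′ : ∀ {p} → p < end → ∃[ q ] q < end × b q ≡ a p
    covered′ {p} p<end with p <? mid
    ... | yes p<mid = covered (inj₁ (≤-trans p<mid x≡mid))
    ... | no p≥mid = covered (inj₂ (≮⇒≥ p≥mid , ≤-trans p<end end≤y))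
    aligned : end < N → ∃[ m ] end ≡ m * (w + w)
    aligned end<N with end≡
    ... | inj₁ refl = ⊥-elim (<-irrefl refl end<N)
    ... | inj₂ eq = suc m , eq

  cap : ℕ → ℕ → ℕ
  cap n v = v ∸ (v ∸ n)

  cap-N : ∀ v → (v ≤ N × cap N v ≡ v) ⊎ (N ≤ v × cap N v ≡ N)
  cap-N v with ≤-total v N
  ... | inj₁ v≤N = inj₁ (v≤N , cong (v ∸_) (m≤n⇒m∸n≡0 v≤N))
  ... | inj₂ N≤v = inj₂ (N≤v , m∸[m∸n]≡n N≤v)

  -- The next pair consists of blocks `m + m` and `suc (m + m)` of width `w`, both cut off at N. If
  -- the cut meets the left block, the right one is empty.
  begin-blocks : ∀ {w a b o} → Merged w a b o → o < N → 0 < w → Blocks N w a →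
    let mid = cap N (o + w) ; end = cap N (mid + w) in
    o < end × ∃[ m ] Merging w m a b o o mid end mid
  begin-blocks {w} {a} {b} {o} md o<N 0<w bl = helper (Merged.aligned md o<N)
    where
    open Merged md
    mid = cap N (o + w)
    end = cap N (mid + w)
    mid≤N : mid ≤ N
    mid≤N with cap-N (o + w)
    ... | inj₁ (le , eq) rewrite eq = le
    ... | inj₂ (_ , eq) rewrite eq = ≤-refl
    end≤N : end ≤ N
    end≤N with cap-N (mid + w)
    ... | inj₁ (le , eq) rewrite eq = le
    ... | inj₂ (_ , eq) rewrite eq = ≤-refl
    mid≤o+w : mid ≤ o + w
    mid≤o+w = m∸n≤m (o + w) (o + w ∸ N)
    end≤mid+w : end ≤ mid + w
    end≤mid+w = m∸n≤m (mid + w) (mid + w ∸ N)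
    o<mid : o < mid
    o<mid with cap-N (o + w)
    ... | inj₁ (_ , eq) rewrite eq = m<m+n o 0<w
    ... | inj₂ (_ , eq) rewrite eq = o<N
    mid≤end : mid ≤ end
    mid≤end with cap-N (mid + w)
    ... | inj₁ (_ , eq) rewrite eq = m≤m+n mid w
    ... | inj₂ (_ , eq) rewrite eq = mid≤N
    helper : ∃[ m ] o ≡ m * (w + w) → o < end × ∃[ m ] Merging w m a b o o mid end mid
    helper (m , o≡) = ≤-trans o<mid mid≤end , m , record
      { s≤x = ≤-reflexive (sym o≡) ; x≤mid = <⇒≤ o<mid ; mid≤y = ≤-refl ; y≤end = mid≤end ; end≤N = end≤N
      ; end≡ = end≡ ; count = refl
      ; left = λ s≤p p≤q q<mid → bl (m + m) (≤-trans (≤-reflexive (trans (sym s≡) (sym o≡))) (≤-trans (≤-reflexive o≡) s≤p)) p≤q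
          (≤-trans q<mid (≤-trans mid≤o+w (≤-reflexive (trans (cong (_+ w) (trans o≡ s≡)) (+-comm _ w))))) (≤-trans q<mid mid≤N)
      ; right = right′
      ; sorted = sorted
      ; below-left = λ s≤p p<o → ⊥-elim (<⇒≱ p<o (≤-trans (≤-reflexive o≡) s≤p))
      ; below-right = λ s≤p p<o → ⊥-elim (<⇒≱ p<o (≤-trans (≤-reflexive o≡) s≤p))
      ; bounded = bounded
      ; covered = λ { (inj₁ p<o) → covered p<o ; (inj₂ (l , u)) → ⊥-elim (<⇒≱ u l) }
      }
      where
      s≡ : m * (w + w) ≡ (m + m) * w
      s≡ = trans (*-distribˡ-+ m w w) (sym (*-distribʳ-+ w m m))
      end≡ : end ≡ N ⊎ end ≡ suc m * (w + w)
      end≡ with cap-N (mid + w) | cap-N (o + w)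
      ... | inj₂ (_ , eq) | _ = inj₁ eq
      ... | inj₁ (_ , eq) | inj₁ (_ , eq′) = inj₂ (trans eq (trans (cong (_+ w) (trans eq′ (cong (_+ w) o≡)))
              (trans (+-assoc (m * (w + w)) w w) (+-comm _ (w + w)))))
      ... | inj₁ (le , eq) | inj₂ (_ , eq′) = inj₁ (≤-antisym end≤N (≤-trans (≤-reflexive (sym eq′)) mid≤end))
      right′ : ∀ {p q} → mid ≤ p → p ≤ q → q < end → a p ≼ a q
      right′ {p} {q} mid≤p p≤q q<end with cap-N (o + w)
      ... | inj₂ (_ , eq) = ⊥-elim (<⇒≱ q<end (≤-trans end≤N (≤-trans (≤-reflexive (sym eq)) (≤-trans mid≤p p≤q))))
      ... | inj₁ (_ , eq) = bl (suc (m + m)) (≤-trans (≤-reflexive (sym mid≡)) mid≤p) p≤q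
            (≤-trans q<end (≤-trans end≤mid+w (≤-reflexive (trans (cong (_+ w) mid≡) (+-comm _ w)))))
            (≤-trans q<end end≤N)
        where
        mid≡ : mid ≡ suc (m + m) * w
        mid≡ = trans eq (trans (cong (_+ w) (trans o≡ s≡)) (+-comm _ w))

  record ClassesUpTo (a : ℕ → ℕ) (i c : ℕ) (cls : ℕ → ℕ) : Set where
    field
      c≤i      : c ≤ i
      below    : ∀ {p} → p < i → cls (a p) ≤ c
      last     : ∀ {j} → i ≡ suc j → cls (a j) ≡ c
      sound    : ∀ {p q} → p < i → q < i → cls (a p) ≡ cls (a q) → T (a p) ≡ T (a q)
      complete : ∀ {p q} → p < i → q < i → T (a p) ≡ T (a q) → cls (a p) ≡ cls (a q)

  number-first : ∀ {a cls} → ClassesUpTo a 0 0 cls → ClassesUpTo a 1 0 (cls [ a 0 ↦ 0 ])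
  number-first {a} {cls} cu = record
    { c≤i = z≤n
    ; below = λ { (s≤s z≤n) → ≤-reflexive (lookup-updated cls (a 0)) }
    ; last = λ { refl → lookup-updated cls (a 0) }
    ; sound = λ { (s≤s z≤n) (s≤s z≤n) _ → refl }
    ; complete = λ { (s≤s z≤n) (s≤s z≤n) _ → refl } }

  module _ {a j c cls} (cu : ClassesUpTo a (suc j) c cls) (perm : Permutation a)
           (sorted : ∀ {p q} → p ≤ q → q < N → a p ≼ a q) (i<N : suc j < N) where
    open ClassesUpTo cu
    private
      i = suc j
      bounded = Permutation.bounded perm
      j<N : j < N
      j<N = <-trans (n<1+n j) i<N

    number-new : T (a j) ≢ T (a i) → ClassesUpTo a (suc i) (suc c) (cls [ a i ↦ suc c ])
    number-new ne = record
      { c≤i = s≤s c≤i ; below = below′ ; last = λ { refl → new } ; sound = sound′ ; complete = complete′ }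
      where
      new : (cls [ a i ↦ suc c ]) (a i) ≡ suc c
      new = lookup-updated cls (a i)
      -- In sorted order an earlier entry with the letter of entry `i` would force that letter on
      -- entry `j` between them.
      differ : ∀ {p} → p < i → T (a p) ≢ T (a i)
      differ {p} (s≤s p≤j) eq = ne (≼-antisym (bounded j<N) (bounded i<N) (sorted (n≤1+n j) i<N)
        (≼-trans (bounded (≤-<-trans p≤j j<N)) (same⇒≼ (sym eq)) (sorted p≤j j<N)))
      old : ∀ {p} → p < i → (cls [ a i ↦ suc c ]) (a p) ≡ cls (a p)
      old p<i = lookup-other cls λ eq → differ p<i (cong T eq)
      below′ : ∀ {p} → p < suc i → (cls [ a i ↦ suc c ]) (a p) ≤ suc c
      below′ (s≤s p≤i) with m≤n⇒m<n∨m≡n p≤i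
      ... | inj₁ p<i = ≤-trans (≤-reflexive (old p<i)) (m≤n⇒m≤1+n (below p<i))
      ... | inj₂ refl = ≤-reflexive new
      fresh : ∀ {p} → p < i → (cls [ a i ↦ suc c ]) (a p) ≢ (cls [ a i ↦ suc c ]) (a i)
      fresh p<i eq = <-irrefl (trans (sym (old p<i)) (trans eq new)) (s≤s (below p<i))
      sound′ : ∀ {p q} → p < suc i → q < suc i →
               (cls [ a i ↦ suc c ]) (a p) ≡ (cls [ a i ↦ suc c ]) (a q) → T (a p) ≡ T (a q)
      sound′ (s≤s p≤i) (s≤s q≤i) eq with m≤n⇒m<n∨m≡n p≤i | m≤n⇒m<n∨m≡n q≤i
      ... | inj₁ p<i  | inj₁ q<i  = sound p<i q<i (trans (sym (old p<i)) (trans eq (old q<i)))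
      ... | inj₁ p<i  | inj₂ refl = ⊥-elim (fresh p<i eq)
      ... | inj₂ refl | inj₁ q<i  = ⊥-elim (fresh q<i (sym eq))
      ... | inj₂ refl | inj₂ refl = refl
      complete′ : ∀ {p q} → p < suc i → q < suc i → T (a p) ≡ T (a q) →
                  (cls [ a i ↦ suc c ]) (a p) ≡ (cls [ a i ↦ suc c ]) (a q)
      complete′ (s≤s p≤i) (s≤s q≤i) eq with m≤n⇒m<n∨m≡n p≤i | m≤n⇒m<n∨m≡n q≤i
      ... | inj₁ p<i  | inj₁ q<i  = trans (old p<i) (trans (complete p<i q<i eq) (sym (old q<i)))
      ... | inj₁ p<i  | inj₂ refl = ⊥-elim (differ p<i eq)
      ... | inj₂ refl | inj₁ q<i  = ⊥-elim (differ q<i (sym eq))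
      ... | inj₂ refl | inj₂ refl = refl

    number-same : T (a j) ≡ T (a i) → ClassesUpTo a (suc i) c (cls [ a i ↦ c ])
    number-same Tj≡Ti = record
      { c≤i = m≤n⇒m≤1+n c≤i ; below = below′ ; last = λ { refl → new } ; sound = sound′ ; complete = complete′ }
      where
      cls′ = cls [ a i ↦ c ]
      new : cls′ (a i) ≡ c
      new = lookup-updated cls (a i)
      -- If `a p` happens to equal `a i`, the write changes nothing: that position already had the
      -- number `c`.
      old : ∀ {p} → p < i → cls′ (a p) ≡ cls (a p)
      old {p} p<i with a p ≟ a i
      ... | no ne = lookup-other cls ne
      ... | yes eq = trans (cong cls′ eq) (trans new (trans (sym (last refl))
                       (complete ≤-refl p<i (trans Tj≡Ti (cong T (sym eq))))))
      -- Position i of the sorted order behaves like position j.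
      proxy : ∀ {p} → p < suc i → ∃[ q ] q < i × cls′ (a p) ≡ cls (a q) × T (a p) ≡ T (a q)
      proxy {p} (s≤s p≤i) with m≤n⇒m<n∨m≡n p≤i
      ... | inj₁ p<i = p , p<i , old p<i , refl
      ... | inj₂ refl = j , ≤-refl , trans new (sym (last refl)) , sym Tj≡Ti
      below′ : ∀ {p} → p < suc i → cls′ (a p) ≤ c
      below′ p< with proxy p<
      ... | q , q<i , eq , _ = ≤-trans (≤-reflexive eq) (below q<i)
      sound′ : ∀ {p q} → p < suc i → q < suc i → cls′ (a p) ≡ cls′ (a q) → T (a p) ≡ T (a q)
      sound′ p< q< eq with proxy p< | proxy q<
      ... | _ , p′< , cp , tp | _ , q′< , cq , tq = trans tp (trans (sound p′< q′< (trans (sym cp) (trans eq cq))) (sym tq))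
      complete′ : ∀ {p q} → p < suc i → q < suc i → T (a p) ≡ T (a q) → cls′ (a p) ≡ cls′ (a q)
      complete′ p< q< eq with proxy p< | proxy q<
      ... | _ , p′< , cp , tp | _ , q′< , cq , tq = trans cp (trans (complete p′< q′< (trans (sym tp) (trans eq tq))) (sym cq))

  -- Running time of sorting and numbering

  module SortRuns (fits : N + N < W) where

    private
      <W : ∀ {v} → v ≤ N → v < W
      <W v≤N = ≤-<-trans (≤-trans v≤N (m≤m+n N N)) fits

    MergeFrame : ℕ → (ℕ → ℕ) → ℕ → State Char → Set
    MergeFrame w a o s = regs s 1 ≡ N × regs s 3 ≡ w × regs s 2 ≡ o × arrs s 2 ≡ a

    MergingAt : ℕ → (ℕ → ℕ) → ℕ → State Char → Set
    MergingAt w a o s = ∃[ m ] Merging w m a (arrs s 3) o (regs s 4) (regs s 5) (regs s 6) (regs s 7)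

    -- The first alternative of `MergeInv` also describes the start of a level, where register 6 is
    -- 0 and the first pair is yet to be loaded.
    MergeInv MergeMid MergeChosen : ℕ → (ℕ → ℕ) → ℕ → State Char → Set
    MergeInv w a o s = MergeFrame w a o s ×
      ((o ≡ regs s 6 × Merged w a (arrs s 3) o) ⊎ (o < regs s 6 × MergingAt w a o s))
    MergeMid w a o s = MergeFrame w a o s × o < regs s 6 × MergingAt w a o s
    MergeChosen w a o s = MergeFrame w a o s × MergingAt w a (suc o) s

    select-exec : ∀ {w a o s} → o < N → 0 < w → Blocks N w a → MergeInv w a o s →
      Exec (IF reg 2 ≐ reg 6 THEN next-blocks ELSE skip) s 28 (MergeMid w a o)
    select-exec {s = s} o<N 0<w bl (fr@(N≡ , refl , refl , refl) , inj₂ (o<end , mg)) =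
      exec (if-false (test-≢ (<⇒≢ o<end)) skip) (≤ᵇ⇒≤ _ _ tt) (fr , o<end , mg)
    select-exec {s = s} o<N 0<w bl (fr@(N≡ , refl , refl , refl) , inj₁ (o≡end , md))
      with subst₂ (λ n e → let mid = cap n (e + regs s 3) ; end = cap n (mid + regs s 3) in
                     regs s 2 < end × ∃[ m ] Merging (regs s 3) m (arrs s 2) (arrs s 3) (regs s 2) e mid end mid)
                  (sym N≡) o≡end (begin-blocks md o<N 0<w bl)
    ... | o<end , m , mg =
      exec (if-true (test-≡ o≡end)
             (seq (assign (<W (≤-trans (≤-reflexive (sym o≡end)) (<⇒≤ o<N))))
               (seq (assign mid<W) (seq (assign mid<W) (assign (<W end≤N))))))
           (≤ᵇ⇒≤ _ _ tt) (fr , o<end , m , mg)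
      where
      open Merging mg
      mid<W = <W (≤-trans (≤-trans mid≤y y≤end) end≤N)

    choose-exec : ∀ {w a o s} → Permutation a → MergeMid w a o s → Exec choose s 22 (MergeChosen w a o)
    choose-exec {o = o} {s} perm (fr@(N≡ , refl , refl , refl) , o<end , m , mg) = by (x <? mid) (y <? end)
      where
      open Merging mg using (x≤mid; mid≤y; end≤N; count)
      a = arrs s 2
      x = regs s 4
      mid = regs s 5
      end = regs s 6
      y = regs s 7
      y≤N : y < end → y < N
      y≤N y<end = ≤-trans y<end end≤N
      x≤N : x < mid → x < N
      x≤N x<mid = ≤-trans x<mid (≤-trans mid≤y (≤-trans (Merging.y≤end mg) end≤N))
      bounded = Permutation.bounded perm
      by : Dec (x < mid) → Dec (y < end) → Exec choose s 22 (MergeChosen _ _ o)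
      by (no x≮mid) _ =
        exec (if-false (test-≮ x≮mid) (seq (store (<W (<⇒≤ (bounded (y≤N y<end))))) (assign (<W (y≤N y<end)))))
             (≤ᵇ⇒≤ _ _ tt) (fr , m , merge-right mg perm y<end (λ x<mid → ⊥-elim (x≮mid x<mid)))
        where
        -- With the left block used up, `count` gives `o ≡ y`.
        y<end : y < end
        y<end = subst (_< end) (+-cancelʳ-≡ mid o y (trans count (trans (cong (_+ y) (≤-antisym x≤mid (≮⇒≥ x≮mid))) (+-comm mid y)))) o<end
      by (yes x<mid) (no y≮end) =
        exec (if-true (test-< x<mid) (if-false (test-≮ y≮end)
               (seq (store (<W (<⇒≤ (bounded (x≤N x<mid))))) (assign (<W (x≤N x<mid))))))
             (≤ᵇ⇒≤ _ _ tt) (fr , m , merge-left mg perm x<mid (λ y<end → ⊥-elim (y≮end y<end)))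
      by (yes x<mid) (yes y<end) with test-≺ᶜ (bounded (y≤N y<end)) (bounded (x≤N x<mid))
      ... | inj₁ (eq , y≼x , _) =
        exec (if-true (test-< x<mid) (if-true (test-< y<end) (if-true eq
               (seq (store (<W (<⇒≤ (bounded (y≤N y<end))))) (assign (<W (y≤N y<end)))))))
             (≤ᵇ⇒≤ _ _ tt) (fr , m , merge-right mg perm y<end (λ _ → y≼x))
      ... | inj₂ (eq , x≼y) =
        exec (if-true (test-< x<mid) (if-true (test-< y<end) (if-false eq
               (seq (store (<W (<⇒≤ (bounded (x≤N x<mid))))) (assign (<W (x≤N x<mid)))))))
             (≤ᵇ⇒≤ _ _ tt) (fr , m , merge-left mg perm x<mid (λ _ → x≼y))

    merge-exec : ∀ {w a o s} → o < N → 0 < w → Blocks N w a → Permutation a → MergeInv w a o s →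
      Exec merge s 54 (MergeInv w a (suc o))
    merge-exec {o = o} o<N 0<w bl perm inv =
      select-exec o<N 0<w bl inv ⨾ₑ λ mid → choose-exec perm mid ⨾ₑ increment
      where
      increment : ∀ {w a s} → MergeChosen w a o s → Exec (reg 2 ≔ lit 1 ⊕ reg 2) s 4 (MergeInv w a (suc o))
      increment ((N≡ , w≡ , refl , a≡) , m , mg) = exec (assign (<W o<N)) ≤-refl ((N≡ , w≡ , refl , a≡) , next)
        where
        next : _
        next with m≤n⇒m<n∨m≡n (Merging.o≤end mg)
        ... | inj₁ lt = inj₂ (lt , m , mg)
        ... | inj₂ eq = inj₁ (eq , finish-blocks mg eq)

    CopyInv : ℕ → (ℕ → ℕ) → ℕ → State Char → Set
    CopyInv w b i s = regs s 1 ≡ N × regs s 3 ≡ w × regs s 2 ≡ i × arrs s 3 ≡ b × (∀ {p} → p < i → arrs s 2 p ≡ b p)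

    copy-exec : ∀ {w b i s} → (∀ {p} → p < N → b p < N) → i < N → CopyInv w b i s → Exec copy s 8 (CopyInv w b (suc i))
    copy-exec {i = i} {s} b<N i<N (N≡ , refl , refl , refl , eq) =
      exec (seq (store (<W (<⇒≤ (b<N i<N)))) (assign (<W i<N))) ≤-refl (N≡ , refl , refl , refl , eq′)
      where
      eq′ : ∀ {p} → p < suc i → (arrs s 2 [ i ↦ arrs s 3 i ]) p ≡ arrs s 3 p
      eq′ (s≤s p≤i) with m≤n⇒m<n∨m≡n p≤i
      ... | inj₁ p<i = trans (lookup-other (arrs s 2) (<⇒≢ p<i)) (eq p<i)
      ... | inj₂ refl = lookup-updated (arrs s 2) i

    Level : ℕ → State Char → Set
    Level w s = regs s 1 ≡ N × regs s 3 ≡ w × Blocks N w (arrs s 2) × Permutation (arrs s 2)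

    level-cost : ℕ
    level-cost = 18 + (N * 58 + N * 12)

    private
      counting : ∀ {n v i} → n ≡ N → v ≡ i → i < N → just (does (v <? n)) ≡ just true
      counting N≡ i≡ i<N = test-< (subst₂ _<_ (sym i≡) (sym N≡) i<N)

      counted : ∀ {n v} → n ≡ N → v ≡ N → just (does (v <? n)) ≡ just false
      counted N≡ i≡ = test-≮ (<-irrefl (trans i≡ (sym N≡)))

    level-exec : ∀ {w s} → 0 < w → w < N → Level w s → Exec level s level-cost (Level (w + w))
    level-exec {w} {s} 0<w w<N (N≡ , w≡ , bl , perm) =
      weaken bound (λ p → p) (assign⨾ 0<W (assign⨾ 0<W (merging ⨾ₑ copying)))
      where
      a = arrs s 2
      0<W = <W {0} z≤n
      merging = for N 54 (MergeInv w a)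
        (λ i<N inv@((N≡ , _ , i≡ , _) , _) → counting N≡ i≡ i<N , merge-exec i<N 0<w bl perm inv)
        (λ ((N≡ , _ , i≡ , _) , _) → counted N≡ i≡)
        {s = ⟪ regs s [ 2 ↦ 0 ] [ 6 ↦ 0 ] , arrs s , output s ⟫}
        z≤n ((N≡ , w≡ , refl , refl) , inj₁ (refl , record
          { sorted = λ _ _ _ _ () ; bounded = λ () ; covered = λ () ; aligned = λ _ → 0 , refl }))
      done : ∀ {s} → MergeInv w a N s → Merged w a (arrs s 3) N
      done (_ , inj₁ (_ , md)) = md
      done (_ , inj₂ (lt , m , mg)) = ⊥-elim (<⇒≱ lt (Merging.end≤N mg))
      copying : ∀ {s} → MergeInv w a N s →
        Exec ((reg 2 ≔ lit 0) ⨾ (WHILE reg 2 ≺ reg 1 DO copy) ⨾ (reg 3 ≔ reg 3 ⊕ reg 3)) s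
             (2 + (4 + N * 12 + 4)) (Level (w + w))
      copying {s} inv@((N≡ , w≡ , _ , _) , _) =
        assign⨾ 0<W (for N 8 (CopyInv w (arrs s 3))
          (λ i<N inv@(N≡ , _ , i≡ , _) → counting N≡ i≡ i<N , copy-exec (Merged.bounded md) i<N inv)
          (λ (N≡ , _ , i≡ , _) → counted N≡ i≡)
          z≤n (N≡ , w≡ , refl , refl , λ ()) ⨾ₑ doubling)
        where
        md : Merged w a (arrs s 3) N
        md = done {s} inv
        doubling : ∀ {s′} → CopyInv w (arrs s 3) N s′ → Exec (reg 3 ≔ reg 3 ⊕ reg 3) s′ 4 (Level (w + w))
        doubling {s′} (N≡ , w≡ , _ , _ , eq) =
          -- A width is doubled only while below N, so the largest one stored is below N + N.
          exec (assign (subst (λ v → v + v < W) (sym w≡) (<-trans (+-mono-< w<N w<N) fits))) ≤-refl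
            ( N≡ , cong (λ v → v + v) w≡
            , (λ m l p≤q u q<N → subst₂ _≼_ (sym (eq (≤-<-trans p≤q q<N))) (sym (eq q<N))
                                   (Merged.sorted md m l p≤q u q<N))
            , record { bounded = λ p<N → subst (_< N) (sym (eq p<N)) (Merged.bounded md p<N)
                     ; onto = onto′ })
          where
          onto′ : ∀ {x} → x < N → ∃[ p ] p < N × arrs s′ 2 p ≡ x
          onto′ x<N with Permutation.onto perm x<N
          ... | p , p<N , refl with Merged.covered md p<N
          ...   | q , q<N , b≡ = q , q<N , trans (eq q<N) b≡
      bound : 2 + (2 + (4 + N * 58 + (2 + (4 + N * 12 + 4)))) ≤ level-cost
      bound = ≤-reflexive (solve 2 (λ p q → con 2 :+ (con 2 :+ (con 4 :+ p :+ (con 2 :+ (con 4 :+ q :+ con 4)))) :=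
                                          con 18 :+ (p :+ q)) refl (N * 58) (N * 12))
        where open +-*-Solver

    sort-cost : ℕ → ℕ
    sort-cost L = 6 + L * (4 + level-cost)

    sort-exec : ∀ {s} L → N ≤ 2 ^ L → regs s 1 ≡ N → (∀ {p} → p < N → arrs s 2 p ≡ p) → 1 < W →
      Exec sort-positions s (sort-cost L) (λ s → (∀ {p q} → p ≤ q → q < N → arrs s 2 p ≼ arrs s 2 q) × Permutation (arrs s 2))
    sort-exec {s} L N≤ N≡ id 1<W =
      assign⨾ 1<W ⌊ while SortInv step (0 , L , refl , refl , N≡ , refl , blocks , perm) ⌋ₐ
      where
      SortInv : ℕ → State Char → Set
      SortInv φ s = ∃[ ℓ ] ∃[ r ] ℓ + r ≡ L × r * (4 + level-cost) ≡ φ × Level (2 ^ ℓ) s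
      blocks : Blocks N 1 (arrs s 2)
      blocks m {p} {q} l p≤q u q<N
        with ≤-antisym p≤q (≤-trans (≤-pred (≤-trans u (≤-reflexive (cong suc (*-identityʳ m))))) (≤-trans (≤-reflexive (sym (*-identityʳ m))) l))
      ... | refl = ≼-refl
      perm : Permutation (arrs s 2)
      perm = record { bounded = λ p<N → subst (_< N) (sym (id p<N)) p<N ; onto = λ {x} x<N → x , x<N , id x<N }
      step : ∀ {φ s} → SortInv φ s → Iteration (reg 3 ≺ reg 1) level SortInv
               (λ _ s → (∀ {p q} → p ≤ q → q < N → arrs s 2 p ≼ arrs s 2 q) × Permutation (arrs s 2)) φ s
      step {φ} {s} (ℓ , r , ℓ+r , refl , lv@(N≡ , w≡ , bl , perm)) with 2 ^ ℓ <? N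
      ... | no ge = stop (test-≮ (λ lt → ge (subst₂ _<_ w≡ N≡ lt)))
                         ( (λ p≤q q<N → bl 0 z≤n p≤q (≤-trans q<N (≤-trans (≮⇒≥ ge) (≤-reflexive (sym (*-identityˡ (2 ^ ℓ)))))) q<N)
                         , perm )
      -- After `L` levels the width is `2 ^ L`, at least N, so the guard has failed by then.
      step {φ} {s} (ℓ , zero , ℓ+r , refl , lv) | yes w<N =
        ⊥-elim (<⇒≱ w<N (≤-trans N≤ (≤-reflexive (cong (2 ^_) (sym (trans (sym (+-identityʳ ℓ)) ℓ+r))))))
      step {φ} {s} (ℓ , suc r , ℓ+r , refl , lv@(N≡ , w≡ , _)) | yes w<N =
        continue (test-< (subst₂ _<_ (sym w≡) (sym N≡) w<N))
          (saving (r * (4 + level-cost)) (weaken ≤-refl (λ {s′} → next {s′}) (level-exec (m^n>0 2 ℓ) w<N lv)))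
          ≤-refl
        where
        next : ∀ {s} → Level (2 ^ ℓ + 2 ^ ℓ) s → SortInv (r * (4 + level-cost)) s
        next {s} lv = suc ℓ , r , trans (sym (+-suc ℓ r)) ℓ+r , refl
                , subst (λ w → Level w s) (cong (2 ^ ℓ +_) (sym (+-identityʳ (2 ^ ℓ)))) lv

    NumberInv : (ℕ → ℕ) → ℕ → State Char → Set
    NumberInv a i s = regs s 1 ≡ N × regs s 2 ≡ i × arrs s 2 ≡ a × ClassesUpTo a i (regs s 3) (arrs s 4)

    classify-cost : ℕ
    classify-cost = 8 + N * 40

    module _ {a} (perm : Permutation a) (sorted : ∀ {p q} → p ≤ q → q < N → a p ≼ a q) where

      private
        bounded = Permutation.bounded perm

        NumberMid : ℕ → State Char → Set
        NumberMid i s = regs s 1 ≡ N × regs s 2 ≡ i × arrs s 2 ≡ a × ClassesUpTo a (suc i) (regs s 3) (arrs s 4 [ a i ↦ regs s 3 ])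

      number-exec : ∀ {i s} → i < N → NumberInv a i s → Exec number s 36 (NumberInv a (suc i))
      number-exec {i} i<N inv = weaken (≤ᵇ⇒≤ _ _ tt) (λ p → p) (choose-number i<N inv ⨾ₑ record-class)
        where
        choose-number : ∀ {i s} → i < N → NumberInv a i s →
          Exec (IF lit 0 ≺ reg 2
                THEN (IF arr 2 (reg 2 ⊖ lit 1) ≺ᶜ arr 2 (reg 2) THEN (reg 3 ≔ lit 1 ⊕ reg 3) ELSE skip)
                ELSE skip) s 20 (NumberMid i)
        choose-number {zero} {s} i<N (N≡ , i≡ , refl , cu) =
          exec (if-false (test-≮ (λ lt → <⇒≢ lt (sym i≡))) skip) (≤ᵇ⇒≤ _ _ tt)
            (N≡ , i≡ , refl , first (n≤0⇒n≡0 (ClassesUpTo.c≤i cu)) cu)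
          where
          first : ∀ {c} → c ≡ 0 → ClassesUpTo a 0 c (arrs s 4) → ClassesUpTo a 1 c (arrs s 4 [ a 0 ↦ c ])
          first refl cu = number-first cu
        choose-number {suc j} {s} i<N (N≡ , i≡ , refl , cu)
          with subst (λ i → let r = zipWith (λ x y → does (x <ᶜ? y)) (T (a (i ∸ 1))) (T (a i)) in
                       (r ≡ just true × a (i ∸ 1) ≼ a i × T (a (i ∸ 1)) ≢ T (a i)) ⊎ (r ≡ just false × a i ≼ a (i ∸ 1)))
                     (sym i≡) (test-≺ᶜ (bounded {j} (<-trans (n<1+n j) i<N)) (bounded i<N))
        ... | inj₁ (eq , _ , ne) =
          exec (if-true (test-< (subst (0 <_) (sym i≡) (s≤s z≤n))) (if-true eq (assign c<W))) (≤ᵇ⇒≤ _ _ tt)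
            (N≡ , i≡ , refl , number-new cu perm sorted i<N (subst (λ i → T (a (i ∸ 1)) ≢ T (a i)) i≡ ne))
          where c<W = <W (≤-trans (s≤s (ClassesUpTo.c≤i cu)) i<N)
        ... | inj₂ (eq , le) =
          exec (if-true (test-< (subst (0 <_) (sym i≡) (s≤s z≤n))) (if-false eq skip)) (≤ᵇ⇒≤ _ _ tt)
            (N≡ , i≡ , refl , number-same cu perm sorted i<N
              (≼-antisym (bounded (<-trans (n<1+n j) i<N)) (bounded i<N) (sorted (n≤1+n j) i<N)
                         (subst (λ i → a i ≼ a (i ∸ 1)) i≡ le)))
        record-class : ∀ {s} → NumberMid i s →
          Exec ((arr 4 [ arr 2 (reg 2) ]≔ reg 3) ⨾ (reg 2 ≔ lit 1 ⊕ reg 2)) s 8 (NumberInv a (suc i))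
        record-class {s} (N≡ , refl , refl , cu) =
          exec (seq (store (<W (≤-trans (ClassesUpTo.c≤i cu) i<N))) (assign (<W i<N))) ≤-refl (N≡ , refl , refl , cu)

    classify-exec : ∀ {s} → regs s 1 ≡ N → (∀ {p q} → p ≤ q → q < N → arrs s 2 p ≼ arrs s 2 q) → Permutation (arrs s 2) →
      Exec classify s classify-cost (λ s → Classes input (arrs s 4) × (∀ {p} → p < N → arrs s 4 p ≤ N))
    classify-exec {s} N≡ sorted perm =
      weaken (≤-reflexive (cong (8 +_) refl)) (λ (_ , _ , _ , cu) → finish cu)
        (assign⨾ (<W z≤n) (assign⨾ (<W z≤n)
          (for N 36 (NumberInv (arrs s 2))
            (λ i<N inv@(N≡ , i≡ , _) → counting N≡ i≡ i<N , number-exec perm sorted i<N inv)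
            (λ (N≡ , i≡ , _) → counted N≡ i≡)
            z≤n (N≡ , refl , refl , record { c≤i = z≤n ; below = λ () ; last = λ () ; sound = λ () ; complete = λ () }))))
      where
      a = arrs s 2
      onto = Permutation.onto perm
      finish : ∀ {c cls} → ClassesUpTo a N c cls → Classes input cls × (∀ {p} → p < N → cls p ≤ N)
      finish {c} {cls} cu = record { sound = sound′ ; complete = complete′ } , bound
        where
        open ClassesUpTo cu
        sound′ : ∀ {p q} → p < N → q < N → cls p ≡ cls q → T p ≡ T q
        sound′ p<N q<N with onto p<N | onto q<N
        ... | _ , p′< , refl | _ , q′< , refl = sound p′< q′<
        complete′ : ∀ {p q} → p < N → q < N → T p ≡ T q → cls p ≡ cls q
        complete′ p<N q<N with onto p<N | onto q<N
        ... | _ , p′< , refl | _ , q′< , refl = complete p′< q′<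
        bound : ∀ {p} → p < N → cls p ≤ N
        bound p<N with onto p<N
        ... | _ , p′< , refl = ≤-trans (below p′<) c≤i

-- Minimality after two sweeps

mono-on : ∀ {a b} (H : ℕ → ℕ) → (∀ {e} → a ≤ e → suc e < b → H e < H (suc e)) →
          ∀ {e f} → a ≤ e → e < f → f < b → H e < H f
mono-on H step {e} {suc f} a≤e (s≤s e≤f) f<b with m≤n⇒m<n∨m≡n e≤f
... | inj₁ e<f = <-trans (mono-on H step a≤e e<f (<-trans (n<1+n f) f<b)) (step (≤-trans a≤e e≤f) f<b)
... | inj₂ refl = step a≤e f<b

-- Induction along the string. The bound at the predecessor and monotonicity of H put `H e` behind
-- the match of the predecessor. Were `H e` before the match of `e`, it would be a kept position of
-- the right class that the greedy choice passed over.
Swept-least : ∀ {lo hi cls B F G K} → Swept lo hi cls B F G K →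
  ∀ {a b} (H : ℕ → ℕ) → lo ≤ a → b ≤ hi → B a ≢ 0 →
  (∀ {e} → a ≤ e → e < b → lo ≤ H e × K (H e) ≢ 0 × cls (H e) ≡ cls e) →
  (∀ {e} → a ≤ e → suc e < b → H e < H (suc e)) →
  ∀ {e} → a ≤ e → e < b → G e ≤ suc (H e)
Swept-least {lo} {hi} {cls} {B} {F} {G} {K} sw {a} {b} H lo≤a b≤hi Ba H-ok H-mono = go _
  where
  open Swept sw
  bounded : ∀ {e} → a ≤ e → e < b → After B G e (H e) → G e ≤ suc (H e)
  bounded {e} a≤e e<b after with matched (≤-trans lo≤a a≤e) (≤-trans e<b b≤hi)
  ... | g , G≡ , m with g ≤? H e
  ...   | yes le = ≤-trans (≤-reflexive G≡) (s≤s le)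
  ...   | no gt = let l , k , c = H-ok a≤e e<b in ⊥-elim (Matched.fresh m after l (≰⇒> gt) k c)
  go : ∀ e → a ≤ e → e < b → G e ≤ suc (H e)
  go zero z≤n e<b = bounded z≤n e<b (inj₁ Ba)
  go (suc e) a≤e e<b with m≤n⇒m<n∨m≡n a≤e
  ... | inj₂ refl = bounded a≤e e<b (inj₁ Ba)
  ... | inj₁ (s≤s a≤e′) =
    bounded a≤e e<b (inj₂ (≤-trans (go e a≤e′ (<-trans (n<1+n e) e<b)) (H-mono a≤e′ e<b)))

-- Reflects positions. Boundaries lie between positions and are reflected by `M ∸ p`, so that a
-- string [a, b) becomes [M ∸ b, M ∸ a).
mirror : ℕ → ℕ → ℕ
mirror M p = M ∸ suc p

mirror< : ∀ {M p} → p < M → mirror M p < M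
mirror< {suc M} {p} _ = s≤s (m∸n≤m M p)

mirror-mirror : ∀ {M p} → p < M → mirror M (mirror M p) ≡ p
mirror-mirror {suc M} {p} (s≤s p≤M) = m∸[m∸n]≡n p≤M

mirror-anti : ∀ {M p q} → q < M → p < q → mirror M q < mirror M p
mirror-anti {suc M} {p} {q} (s≤s q≤M) p<q = ∸-monoʳ-< p<q q≤M

mirror-anti-≤ : ∀ M {p q} → p ≤ q → mirror M q ≤ mirror M p
mirror-anti-≤ M p≤q = ∸-monoʳ-≤ M (s≤s p≤q)

suc-mirror : ∀ {M p} → p < M → suc (mirror M p) ≡ M ∸ p
suc-mirror p<M = sym (+-∸-assoc 1 p<M)

mirror-upper : ∀ {N p} → p < N → N ≤ mirror (N + N) p
mirror-upper {N} {p} p<N = begin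
  N                ≡⟨ sym (m+n∸n≡m N (suc p)) ⟩
  N + suc p ∸ suc p ≤⟨ ∸-monoˡ-≤ (suc p) (+-monoʳ-≤ N p<N) ⟩
  N + N ∸ suc p    ∎
  where open ≤-Reasoning

mirror-lower : ∀ {N p} → N ≤ p → p < N + N → mirror (N + N) p < N
mirror-lower {N} {p} N≤p p<M = subst (_≤ N) (sym (suc-mirror p<M))
  (≤-trans (∸-monoʳ-≤ (N + N) N≤p) (≤-reflexive (m+n∸n≡m N N)))

-- The second sweep runs over the mirror image of the tape; its targets are the
-- mirror images of the positions found by the first sweep.
record TwoSweeps (N : ℕ) (cls B F₁ G₁ K₁ F₂ G₂ K₂ : ℕ → ℕ) : Set where
  M : ℕ
  M = N + N
  field
    first      : Swept 0 N cls B F₁ G₁ K₁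
    second     : Swept N M cls B F₂ G₂ K₂
    cls-mirror : ∀ {p} → p < N → cls (mirror M p) ≡ cls p
    B-mirror   : ∀ {p} → p ≤ N → B (M ∸ p) ≡ B p
    -- `G₁ e` is one more than the match of `e`, so `M ∸ G₁ e` is the mirror image of that match.
    F₂-mirror  : ∀ {e} → e < N → F₂ (mirror M e) ≡ M ∸ G₁ e

  g₁ g₂ kept : ℕ → ℕ
  g₁ e = pred (G₁ e)
  g₂ e = mirror M (pred (G₂ (mirror M e)))
  kept p = K₂ (mirror M p)

  private
    <M : ∀ {p} → p < N → p < M
    <M p<N = ≤-trans p<N (m≤m+n N N)

  -- The second sweep keeps a position only where F₂ and G₂ agree on some element, and F₂ is G₁
  -- mirrored. As G₁ takes only positions kept by the first sweep, `p` was kept by that one too.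
  tight : ∀ {p} → p < N → kept p ≢ 0 → ∃[ e ] e < N × g₁ e ≡ p × g₂ e ≡ p × K₁ p ≢ 0
  tight {p} p<N k with Swept.kept second (mirror-upper p<N) k
  ... | e′ , N≤e′ , e′<M , G₂≡ , F₂≡ with Swept.matched first {mirror M e′} z≤n (mirror-lower N≤e′ e′<M)
  ...   | g , G₁≡ , m = mirror M e′ , e<N , trans (cong pred G₁≡) g≡p
                      , trans (cong (λ x → mirror M (pred (G₂ x))) (mirror-mirror e′<M))
                          (trans (cong (λ x → mirror M (pred x)) G₂≡) (mirror-mirror (<M p<N)))
                      , subst (λ p → K₁ p ≢ 0) g≡p (Matched.kept m)
    where
    e<N = mirror-lower N≤e′ e′<M
    g≡p : g ≡ p
    g≡p = trans (sym (mirror-mirror (<M (Matched.upper m))))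
            (trans (cong (mirror M) (trans (sym (trans (F₂-mirror e<N) (cong (M ∸_) G₁≡)))
                                           (trans (cong F₂ (mirror-mirror e′<M)) F₂≡)))
                   (mirror-mirror (<M p<N)))

  private
    matched₂ : ∀ {e} → e < N → ∃[ g ] G₂ (mirror M e) ≡ suc g × Matched N M cls B F₂ G₂ K₂ M (mirror M e) g
    matched₂ e<N = Swept.matched second (mirror-upper e<N) (mirror< (<M e<N))

  g₂-position : ∀ {e} → e < N → g₂ e < N × kept (g₂ e) ≢ 0 × cls (g₂ e) ≡ cls e
  g₂-position {e} e<N with G₂ (mirror M e) | matched₂ e<N
  ... | _ | g , refl , m =
      <N
    , subst (λ p → K₂ p ≢ 0) (sym (mirror-mirror g<M)) (Matched.kept m)
    , trans (sym (cls-mirror <N)) (trans (cong cls (mirror-mirror g<M)) (trans (Matched.class m) (cls-mirror e<N)))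
    where
    g<M = Matched.upper m
    <N = mirror-lower (Matched.lower m) g<M

  -- In the mirror image `suc e` is the predecessor of `e`, so `Settled` compares their matches
  -- there.
  g₂-mono : ∀ {e} → suc e < N → B (suc e) ≡ 0 → g₂ e < g₂ (suc e)
  g₂-mono {e} e<N b with matched₂ (<-trans (n<1+n e) e<N) | matched₂ e<N
  ... | g , G≡ , m | g′ , G≡′ , m′ with Matched.settled m
  ...   | inj₁ n = ⊥-elim (n (trans (B-mirror (<⇒≤ e<N)) b))
  ...   | inj₂ (_ , le) rewrite G≡ | G≡′ = mirror-anti (Matched.upper m) g′<g
    where
    g′<g : g′ < g
    g′<g = ≤-trans (≤-reflexive (trans (sym G≡′) (cong G₂ (sym (pred[m∸n]≡m∸[1+n] M (suc e)))))) le

  -- By `tight`, the positions kept in the end were kept by the first sweep, so H competes with its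
  -- greedy matching.
  g₁-least : ∀ {a b} (H : ℕ → ℕ) → b ≤ N → B a ≢ 0 →
    (∀ {e} → a ≤ e → e < b → H e < N × kept (H e) ≢ 0 × cls (H e) ≡ cls e) →
    (∀ {e} → a ≤ e → suc e < b → H e < H (suc e)) →
    ∀ {e} → a ≤ e → e < b → g₁ e ≤ H e
  g₁-least H b≤N Ba H-ok H-mono a≤e e<b = pred-mono-≤ (Swept-least first H z≤n b≤N Ba ok H-mono a≤e e<b)
    where
    ok : ∀ {e} → _ ≤ e → e < _ → 0 ≤ H e × K₁ (H e) ≢ 0 × cls (H e) ≡ cls e
    ok a≤e e<b with H-ok a≤e e<b
    ... | u , k , c = z≤n , proj₂ (proj₂ (proj₂ (proj₂ (tight u k)))) , c

  -- Conjugating H by `mirror` gives an increasing map on the mirrored string; leastness of G₂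
  -- against it becomes an upper bound on H.
  g₂-greatest : ∀ {a b} (H : ℕ → ℕ) → b ≤ N → B b ≢ 0 →
    (∀ {e} → a ≤ e → e < b → H e < N × kept (H e) ≢ 0 × cls (H e) ≡ cls e) →
    (∀ {e} → a ≤ e → suc e < b → H e < H (suc e)) →
    ∀ {e} → a ≤ e → e < b → H e ≤ g₂ e
  g₂-greatest {a} {b} H b≤N Bb H-ok H-mono {e} a≤e e<b =
    subst (_≤ g₂ e) (mirror-mirror (<M (proj₁ (H-ok a≤e e<b))))
      (mirror-anti-≤ M (≤-trans (pred-mono-≤ (Swept-least second H′ N≤ M∸a≤M (λ z → Bb (trans (sym (B-mirror b≤N)) z)) ok mono
                                  (∸-monoʳ-≤ M e<b) (subst (_≤ M ∸ a) (sym (suc-mirror (<M (≤-trans e<b b≤N)))) (∸-monoʳ-≤ M a≤e))))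
                                (≤-reflexive (cong (λ x → mirror M (H x)) (mirror-mirror (<M (≤-trans e<b b≤N)))))))
    where
    H′ : ℕ → ℕ
    H′ e′ = mirror M (H (mirror M e′))
    N≤ : N ≤ M ∸ b
    N≤ = ≤-trans (≤-reflexive (sym (m+n∸n≡m N N))) (∸-monoʳ-≤ M b≤N)
    M∸a≤M : M ∸ a ≤ M
    M∸a≤M = m∸n≤m M a
    inside : ∀ {e′} → M ∸ b ≤ e′ → e′ < M ∸ a → a ≤ mirror M e′ × mirror M e′ < b × e′ < M
    inside {e′} l u =
        ≤-trans (≤-reflexive (sym (m∸[m∸n]≡n a≤M))) (∸-monoʳ-≤ M u)
      , ≤-trans (≤-reflexive (suc-mirror e′<M)) (≤-trans (∸-monoʳ-≤ M l) (≤-reflexive (m∸[m∸n]≡n (≤-trans b≤N (m≤m+n N N)))))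
      , e′<M
      where
      e′<M = ≤-trans u M∸a≤M
      a≤M : a ≤ M
      a≤M = <⇒≤ (<-transˡ′ a≤e (<M (≤-trans e<b b≤N)))
        where
        <-transˡ′ : ∀ {x y z} → x ≤ y → y < z → x < z
        <-transˡ′ p q = ≤-<-trans p q
    ok : ∀ {e′} → M ∸ b ≤ e′ → e′ < M ∸ a → N ≤ H′ e′ × K₂ (H′ e′) ≢ 0 × cls (H′ e′) ≡ cls e′
    ok {e′} l u with inside l u
    ... | a≤ , <b , e′<M with H-ok a≤ <b
    ...   | H<N , k , c = mirror-upper H<N , k
                        , trans (cls-mirror H<N) (trans c (trans (sym (cls-mirror (≤-trans <b b≤N))) (cong cls (mirror-mirror e′<M))))
    mono : ∀ {e′} → M ∸ b ≤ e′ → suc e′ < M ∸ a → H′ e′ < H′ (suc e′)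
    mono {e′} l u with inside l (<-trans (n<1+n e′) u) | inside (m≤n⇒m≤1+n l) u
    ... | _ , <b , _ | a≤ , _ , 1+e′<M =
      mirror-anti (<M (proj₁ (H-ok (≤-trans a≤ (mirror-anti-≤ M (n≤1+n e′))) <b)))
        (subst (λ x → H (mirror M (suc e′)) < H x) (suc-mirror 1+e′<M)
          (H-mono a≤ (subst (_< b) (sym (suc-mirror 1+e′<M)) <b)))

-- From positions to strings and back

keptFrom : (ℕ → ℕ) → ℕ → ℕ → List ℕ
keptFrom K j zero = []
keptFrom K j (suc l) with K j ≟ 0
... | yes _ = keptFrom K (suc j) l
... | no _  = j ∷ keptFrom K (suc j) l

∈-keptFrom : ∀ K j l {p} → p ∈ keptFrom K j l → j ≤ p × p < j + l × K p ≢ 0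
∈-keptFrom K j (suc l) p∈ rewrite +-suc j l with K j ≟ 0
... | yes _ with ∈-keptFrom K (suc j) l p∈
...   | j<p , u , k = <⇒≤ j<p , u , k
∈-keptFrom K j (suc l) (here refl) | no k = ≤-refl , s≤s (m≤m+n j l) , k
∈-keptFrom K j (suc l) (there p∈) | no _ with ∈-keptFrom K (suc j) l p∈
... | j<p , u , k = <⇒≤ j<p , u , k

keptFrom-sorted : ∀ K j l → AllPairs _<_ (keptFrom K j l)
keptFrom-sorted K j zero = []
keptFrom-sorted K j (suc l) with K j ≟ 0
... | yes _ = keptFrom-sorted K (suc j) l
... | no _  = All.tabulate (λ p∈ → proj₁ (∈-keptFrom K (suc j) l p∈)) ∷ keptFrom-sorted K (suc j) l

module Strings {Char : Set} (T : ℕ → Maybe Char) where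

  Reads : ℕ → List Char → Set
  Reads a []       = ⊤
  Reads a (x ∷ xs) = T a ≡ just x × Reads (suc a) xs

  AtPosition : Char → ℕ → Set
  AtPosition c p = T p ≡ just c

  same-char : ∀ {x y : Char} {m} → m ≡ just x → m ≡ just y → x ≡ y
  same-char refl refl = refl

  -- The recursion follows the positions `j`, not the characters: if `j` is kept, either `g a` is
  -- `j` and a character is consumed, or all values of `g` lie beyond `j`.
  ⊆-kept : ∀ K j l {xs a C} (g : ℕ → ℕ) → Reads a xs → Pointwise AtPosition C (keptFrom K j l) →
    (∀ {e} → a ≤ e → e < a + length xs → j ≤ g e × g e < j + l × K (g e) ≢ 0 × T (g e) ≡ T e) →
    (∀ {e f} → a ≤ e → e < f → f < a + length xs → g e < g f) → xs ⊆ C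
  ⊆-kept K j l {[]} g rd pw ok mono = minimum _
  ⊆-kept K j zero {x ∷ xs} {a} g rd pw ok mono with ok {a} ≤-refl (m<m+n a (s≤s z≤n))
  ... | l , u , _ = ⊥-elim (<⇒≱ u (≤-trans (≤-reflexive (+-identityʳ j)) l))
  ⊆-kept K j (suc l) {x ∷ xs} {a} g (ra , rd) pw ok mono
    rewrite +-suc j l | +-suc a (length xs) with K j ≟ 0
  ... | yes z = ⊆-kept K (suc j) l {x ∷ xs} {a} g (ra , rd) pw
          (λ a≤e e< → let e<′ = ≤-trans e< (≤-reflexive (+-suc a _))
                          j≤ , u , k , t = ok a≤e e<′ in
             ≤∧≢⇒< j≤ (λ { refl → k z }) , u , k , t)
          (λ a≤e e<f f< → mono a≤e e<f (≤-trans f< (≤-reflexive (+-suc a _))))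
  ⊆-kept K j (suc l) {x ∷ xs} {a} {c ∷ C} g (ra , rd) (Tj ∷ pw) ok mono | no _ with g a ≟ j
  ... | yes refl = same-char ra (trans (sym (proj₂ (proj₂ (proj₂ (ok {a} ≤-refl (s≤s (m≤m+n a _))))))) Tj)
                   ∷ ⊆-kept K (suc j) l g rd pw
                       (λ a<e e< → let _ , u , k , t = ok (<⇒≤ a<e) e< in mono ≤-refl a<e e< , u , k , t)
                       (λ a<e → mono (<⇒≤ a<e))
  ... | no ga≢j = c ∷ʳ ⊆-kept K (suc j) l {x ∷ xs} {a} g (ra , rd) pw
          (λ a≤e e< → let e<′ = ≤-trans e< (≤-reflexive (+-suc a _))
                          j≤ , u , k , t = ok a≤e e<′ in above a≤e e<′ , u , k , t)
          (λ a≤e e<f f< → mono a≤e e<f (≤-trans f< (≤-reflexive (+-suc a _))))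
    where
    above : ∀ {e} → a ≤ e → e < suc (a + length xs) → suc j ≤ g e
    above a≤e e< with m≤n⇒m<n∨m≡n a≤e
    ... | inj₂ refl = ≤∧≢⇒< (proj₁ (ok ≤-refl e<)) λ j≡ → ga≢j (sym j≡)
    ... | inj₁ a<e = ≤-<-trans (proj₁ (ok ≤-refl (<-trans a<e e<))) (mono ≤-refl a<e e<)

  -- H is indexed by tape positions rather than by places in `xs`, so that it can be compared with
  -- `g₁` and `g₂`. Outside the string its values are arbitrary.
  occurrence : ∀ {xs D K a} → xs ⊆ D → Reads a xs → Pointwise AtPosition D K → AllPairs _<_ K →
    Σ (ℕ → ℕ) λ H →
      (∀ {e} → a ≤ e → e < a + length xs → H e ∈ K × T (H e) ≡ T e) ×
      (∀ {e} → a ≤ e → suc e < a + length xs → H e < H (suc e))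
  occurrence {a = a} [] rd [] _ = (λ _ → 0) , (λ l u → ⊥-elim (<⇒≱ u (≤-trans (≤-reflexive (+-identityʳ a)) l)))
                               , (λ l u → ⊥-elim (<⇒≱ (<-trans (n<1+n _) u) (≤-trans (≤-reflexive (+-identityʳ a)) l)))
  occurrence (y ∷ʳ s) rd (_ ∷ pw) (_ ∷ ap) with occurrence s rd pw ap
  ... | H , ok , mono = H , (λ l u → let m , t = ok l u in there m , t) , mono
  occurrence {x ∷ xs} {K = k ∷ K} {a} (refl ∷ s) (ra , rd) (Tk ∷ pw) (k< ∷ ap) with occurrence s rd pw ap
  ... | H₀ , ok₀ , mono₀ rewrite +-suc a (length xs) = H , ok , mono
    where
    H : ℕ → ℕ
    H = H₀ [ a ↦ k ]
    H-tail : ∀ {e} → a < e → H e ≡ H₀ e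
    H-tail a<e = lookup-other H₀ λ { refl → <-irrefl refl a<e }
    ok : ∀ {e} → a ≤ e → e < suc (a + length xs) → H e ∈ k ∷ K × T (H e) ≡ T e
    ok {e} a≤e u with m≤n⇒m<n∨m≡n a≤e
    ... | inj₂ refl rewrite lookup-updated H₀ e {k} = here refl , trans Tk (sym ra)
    ... | inj₁ a<e rewrite H-tail a<e = let m , t = ok₀ a<e u in there m , t
    mono : ∀ {e} → a ≤ e → suc e < suc (a + length xs) → H e < H (suc e)
    mono {e} a≤e u rewrite H-tail (s≤s a≤e) with m≤n⇒m<n∨m≡n a≤e
    ... | inj₂ refl rewrite lookup-updated H₀ e {k} = All.lookup k< (proj₁ (ok₀ ≤-refl u))
    ... | inj₁ a<e rewrite H-tail a<e = mono₀ a<e u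

  ⊆-positions : ∀ {D C K} → D ⊆ C → Pointwise AtPosition C K → ∃[ K′ ] K′ ⊆ K × Pointwise AtPosition D K′
  ⊆-positions [] [] = [] , [] , []
  ⊆-positions (y ∷ʳ s) (_ ∷ pw) with ⊆-positions s pw
  ... | K′ , s′ , pw′ = K′ , _ ∷ʳ s′ , pw′
  ⊆-positions (refl ∷ s) (t ∷ pw) with ⊆-positions s pw
  ... | K′ , s′ , pw′ = _ ∷ K′ , refl ∷ s′ , t ∷ pw′

  same-positions : ∀ {D C K} → Pointwise AtPosition D K → Pointwise AtPosition C K → D ≡ C
  same-positions [] [] = refl
  same-positions (p ∷ ps) (q ∷ qs) = cong₂ _∷_ (same-char p q) (same-positions ps qs)

⊆-sorted : ∀ {xs ys} → xs ⊆ ys → AllPairs _<_ ys → AllPairs _<_ xs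
⊆-sorted [] [] = []
⊆-sorted (y ∷ʳ s) (_ ∷ ps) = ⊆-sorted s ps
⊆-sorted (refl ∷ s) (p ∷ ps) = All-resp-⊆ s p ∷ ⊆-sorted s ps

-- An element that the sublist skips cannot reappear in it, since all later ones are larger.
⊆-full : ∀ {xs ys} → xs ⊆ ys → AllPairs _<_ ys → (∀ {p} → p ∈ ys → p ∈ xs) → xs ≡ ys
⊆-full [] [] _ = refl
⊆-full {xs} (y ∷ʳ s) (y< ∷ _) full = ⊥-elim (<-irrefl refl (All.lookup (All-resp-⊆ s y<) (full (here refl))))
⊆-full {x ∷ xs} (refl ∷ s) (x< ∷ ps) full = cong (x ∷_) (⊆-full s ps full′)
  where
  full′ : ∀ {p} → p ∈ _ → p ∈ xs
  full′ p∈ with full (there p∈)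
  ... | here refl = ⊥-elim (<-irrefl refl (All.lookup x< p∈))
  ... | there q = q

-- Layout of the strings on the tape

module _ {Char : Set} where

  offset : List (List Char) → ℕ → ℕ
  offset _        zero    = 0
  offset []       (suc i) = 0
  offset (l ∷ ls) (suc i) = length l + offset ls i

  lengthAt : List (List Char) → ℕ → ℕ
  lengthAt ls i = maybe length 0 (ls ‼ i)

  offset-suc : ∀ ls i → offset ls (suc i) ≡ offset ls i + lengthAt ls i
  offset-suc []       zero    = refl
  offset-suc []       (suc i) = refl
  offset-suc (l ∷ ls) zero    = +-comm (length l) 0
  offset-suc (l ∷ ls) (suc i) = trans (cong (length l +_) (offset-suc ls i)) (sym (+-assoc (length l) _ _))

  lengthAt-lookup : ∀ {k} (A : Vec (List Char) k) (i : Fin k) → lengthAt (toList A) (toℕ i) ≡ length (lookup A i)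
  lengthAt-lookup (l ∷ A) zero    = refl
  lengthAt-lookup (l ∷ A) (suc i) = lengthAt-lookup A i

  offset-mono : ∀ ls {i j} → i ≤ j → offset ls i ≤ offset ls j
  offset-mono ls       z≤n       = z≤n
  offset-mono []       (s≤s i≤j) = z≤n
  offset-mono (l ∷ ls) (s≤s i≤j) = +-monoʳ-≤ (length l) (offset-mono ls i≤j)

  offset-all : ∀ {k} (A : Vec (List Char) k) → offset (toList A) k ≡ length (concat (toList A))
  offset-all []      = refl
  offset-all (l ∷ A) = trans (cong (length l +_) (offset-all A)) (sym (length-++ l))

  offset-end : ∀ {k} (A : Vec (List Char) k) i →
    offset (toList A) (suc (toℕ i)) ≡ offset (toList A) (toℕ i) + length (lookup A i)
  offset-end A i = trans (offset-suc (toList A) (toℕ i)) (cong (offset (toList A) (toℕ i) +_) (lengthAt-lookup A i))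

  offset-≤ : ∀ {k} (A : Vec (List Char) k) {i} → i ≤ k → offset (toList A) i ≤ length (concat (toList A))
  offset-≤ A i≤k = ≤-trans (offset-mono (toList A) i≤k) (≤-reflexive (offset-all A))

  locate : ∀ {k} (A : Vec (List Char) k) {e} → e < length (concat (toList A)) →
    Σ[ i ∈ Fin k ] offset (toList A) (toℕ i) ≤ e × e < offset (toList A) (suc (toℕ i))
  locate (l ∷ A) {e} e< with e <? length l
  ... | yes lt = zero , z≤n , ≤-trans lt (m≤m+n (length l) 0)
  ... | no ge with locate A {e ∸ length l} (+-cancelˡ-< (length l) _ _
                     (subst₂ _<_ (sym (m+[n∸m]≡n (≮⇒≥ ge))) (length-++ l) e<))
  ...   | i , lo , hi = suc i , subst (length l + offset (toList A) (toℕ i) ≤_) e≡ (+-monoʳ-≤ (length l) lo)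
                      , subst (_< length l + offset (toList A) (suc (toℕ i))) e≡ (+-monoʳ-< (length l) hi)
    where e≡ = m+[n∸m]≡n (≮⇒≥ ge)

  drop-suc : ∀ (tape : List Char) a {x zs} → drop a tape ≡ x ∷ zs → drop (suc a) tape ≡ zs
  drop-suc (_ ∷ _)  zero    refl = refl
  drop-suc (_ ∷ ys) (suc a) eq   = drop-suc ys a eq

  reads-drop : ∀ (tape : List Char) a xs {ys} → drop a tape ≡ xs ++ ys → Strings.Reads (tape ‼_) a xs
  reads-drop tape a []       eq = tt
  reads-drop tape a (x ∷ xs) eq = cong head eq , reads-drop tape (suc a) xs (drop-suc tape a eq)

  drop-+ : ∀ (xs ys : List Char) n → drop (length xs + n) (xs ++ ys) ≡ drop n ys
  drop-+ []       ys n = refl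
  drop-+ (x ∷ xs) ys n = drop-+ xs ys n

  drop-offset : ∀ {k} (A : Vec (List Char) k) i →
    ∃[ ys ] drop (offset (toList A) (toℕ i)) (concat (toList A)) ≡ lookup A i ++ ys
  drop-offset (l ∷ A) zero = concat (toList A) , refl
  drop-offset (l ∷ A) (suc i) with drop-offset A i
  ... | ys , eq = ys , trans (drop-+ l (concat (toList A)) _) eq

module _ {Char : Set} {k : ℕ} (A : Vec (List Char) k) where
  private
    tape = concat (toList A)
    N = length tape
    off = offset (toList A)

  open Strings (tape ‼_)

  -- Index `k` is included, so the end of the tape is a boundary. The restriction `p ≤ N` lets the
  -- record survive the marks that `reflect` adds above N.
  record Boundaries (B : ℕ → ℕ) : Set where
    field
      at-offset   : ∀ {i} → i ≤ k → B (off i) ≢ 0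
      only-offset : ∀ {p} → p ≤ N → B p ≢ 0 → ∃[ i ] i ≤ k × p ≡ off i

  module _ {cls B F₁ G₁ K₁ F₂ G₂ K₂} (sweeps : TwoSweeps N cls B F₁ G₁ K₁ F₂ G₂ K₂)
           (boundaries : Boundaries B) (classes : Classes tape cls)
           {C : List Char} (C-positions : Pointwise AtPosition C (keptFrom (TwoSweeps.kept sweeps) 0 N)) where

    open TwoSweeps sweeps
    open Boundaries boundaries
    open Classes classes

    private
      K : List ℕ
      K = keptFrom kept 0 N

      end-≤ : ∀ i → off (toℕ i) + length (lookup A i) ≤ N
      end-≤ i = ≤-trans (≤-reflexive (sym (offset-end A i))) (offset-≤ A (toℕ<n i))

      reads : ∀ i → Reads (off (toℕ i)) (lookup A i)
      reads i = reads-drop tape _ (lookup A i) (proj₂ (drop-offset A i))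

      interior : ∀ i {p} → off (toℕ i) < p → p < off (suc (toℕ i)) → B p ≡ 0
      interior i {p} l u with B p ≟ 0
      ... | yes z = z
      ... | no n with only-offset (≤-trans (<⇒≤ u) (offset-≤ A (toℕ<n i))) n
      ...   | j , _ , refl with j ≤? toℕ i
      ...     | yes j≤i = ⊥-elim (<⇒≱ l (offset-mono (toList A) j≤i))
      ...     | no j≰i  = ⊥-elim (<⇒≱ u (offset-mono (toList A) (≰⇒> j≰i)))

    common : CommonSupersequence A C
    common i = ⊆-kept kept 0 N g₂ (reads i) C-positions ok
      (mono-on g₂ λ l u → g₂-mono (≤-trans u (end-≤ i))
        (interior i (s≤s l) (≤-trans u (≤-reflexive (sym (offset-end A i))))))
      where
      ok : ∀ {e} → off (toℕ i) ≤ e → e < off (toℕ i) + length (lookup A i) →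
           0 ≤ g₂ e × g₂ e < N × kept (g₂ e) ≢ 0 × tape ‼ g₂ e ≡ tape ‼ e
      ok l u with ≤-trans u (end-≤ i)
      ... | e<N with g₂-position e<N
      ...   | g<N , kg , c = z≤n , g<N , kg , sound g<N e<N c

    module _ {D : List Char} (D⊆C : D ⊆ C) (D-common : CommonSupersequence A D) where

      private
        K′ : List ℕ
        K′ = proj₁ (⊆-positions D⊆C C-positions)
        K′⊆K : K′ ⊆ K
        K′⊆K = proj₁ (proj₂ (⊆-positions D⊆C C-positions))
        D-positions : Pointwise AtPosition D K′
        D-positions = proj₂ (proj₂ (⊆-positions D⊆C C-positions))

        needed : ∀ {p} → p ∈ K → p ∈ K′
        needed {p} p∈ with ∈-keptFrom kept 0 N p∈
        ... | _ , p<N , kp with tight p<N kp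
        ...   | e , e<N , g₁≡p , g₂≡p , _ with locate A e<N
        ...     | i , l , u with occurrence (D-common i) (reads i) D-positions (⊆-sorted K′⊆K (keptFrom-sorted kept 0 N))
        ...       | H , H-ok , H-mono = subst (_∈ K′) H≡p (proj₁ (H-ok l u′))
          where
          a = off (toℕ i)
          b = a + length (lookup A i)
          u′ : e < b
          u′ = ≤-trans u (≤-reflexive (offset-end A i))
          ok : ∀ {e} → a ≤ e → e < b → H e < N × kept (H e) ≢ 0 × cls (H e) ≡ cls e
          ok l u with H-ok l u
          ... | H∈ , T≡ with ∈-keptFrom kept 0 N (Sublist.lookup K′⊆K H∈)
          ...   | _ , H<N , kH = H<N , kH , complete H<N (≤-trans u (end-≤ i)) T≡
          H≡p : H e ≡ p
          H≡p = ≤-antisym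
            (≤-trans (g₂-greatest H (end-≤ i) (λ z → at-offset (toℕ<n i) (trans (cong B (offset-end A i)) z))
                        ok H-mono l u′) (≤-reflexive g₂≡p))
            (≤-trans (≤-reflexive (sym g₁≡p))
              (g₁-least H (end-≤ i) (at-offset (<⇒≤ (toℕ<n i))) ok H-mono l u′))

      no-proper : D ≡ C
      no-proper = same-positions (subst (Pointwise AtPosition D) (⊆-full K′⊆K (keptFrom-sorted kept 0 N) needed) D-positions)
                                 C-positions

    two-sweeps-minimal : MinimalCommonSupersequence A C
    two-sweeps-minimal = common , λ D D⊆C D≢C D-common → D≢C (no-proper D⊆C D-common)

-- The algorithm

-- Halving: `n` is at most twice `⌈ n /2⌉`, whose logarithm is smaller by one.
n≤2^⌈log₂n⌉ : ∀ n → n ≤ 2 ^ ⌈log₂ n ⌉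
n≤2^⌈log₂n⌉ = <-rec _ step
  where
  step : ∀ n → (∀ {m} → m < n → m ≤ 2 ^ ⌈log₂ m ⌉) → n ≤ 2 ^ ⌈log₂ n ⌉
  step zero          rec = z≤n
  step (suc zero)    rec = s≤s z≤n
  step n@(suc (suc m)) rec = begin
    n                            ≡⟨ sym (⌊n/2⌋+⌈n/2⌉≡n n) ⟩
    ⌊ n /2⌋ + ⌈ n /2⌉            ≤⟨ +-monoˡ-≤ ⌈ n /2⌉ (⌊n/2⌋≤⌈n/2⌉ n) ⟩
    ⌈ n /2⌉ + ⌈ n /2⌉            ≤⟨ +-mono-≤ half half ⟩
    2 ^ l + 2 ^ l                ≡⟨ cong (2 ^ l +_) (sym (+-identityʳ (2 ^ l))) ⟩
    2 ^ suc l                    ≡⟨ cong (2 ^_) (suc-pred-log (⌈log₂⌉-mono-≤ {2} {n} (s≤s (s≤s z≤n)))) ⟩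
    2 ^ ⌈log₂ n ⌉                ∎
    where
    open ≤-Reasoning
    l = ⌈log₂ n ⌉ ∸ 1
    half : ⌈ n /2⌉ ≤ 2 ^ l
    half = subst (λ l → ⌈ n /2⌉ ≤ 2 ^ l) (⌈log₂⌈n/2⌉⌉≡⌈log₂n⌉∸1 n) (rec (⌈n/2⌉<n m))
    suc-pred-log : ∀ {x} → 1 ≤ x → suc (x ∸ 1) ≡ x
    suc-pred-log (s≤s _) = refl

measure-step measure identity-step identity reflect-step reflect : Program
first-sweep retarget-step retarget second-sweep write-step write : Program

measure-step = (reg 1 ≔ reg 1 ⊕ arr 0 (reg 2)) ⨾ (arr 1 [ reg 1 ]≔ lit 1) ⨾ (reg 2 ≔ lit 1 ⊕ reg 2)
measure = (arr 1 [ lit 0 ]≔ lit 1) ⨾ (WHILE reg 2 ≺ reg 0 DO measure-step)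

-- The identity serves twice: as the order to be sorted and as the targets of the first sweep.
identity-step = (arr 2 [ reg 2 ]≔ reg 2) ⨾ (arr 5 [ reg 2 ]≔ reg 2) ⨾ (reg 2 ≔ lit 1 ⊕ reg 2)
identity = (reg 2 ≔ lit 0) ⨾ (WHILE reg 2 ≺ reg 1 DO identity-step)

reflect-step = (arr 4 [ reg 8 ⊖ (lit 1 ⊕ reg 2) ]≔ arr 4 (reg 2)) ⨾
               (arr 1 [ reg 8 ⊖ reg 2 ]≔ arr 1 (reg 2)) ⨾
               (reg 2 ≔ lit 1 ⊕ reg 2)
reflect = (reg 8 ≔ reg 1 ⊕ reg 1) ⨾ (reg 2 ≔ lit 0) ⨾ (WHILE reg 2 ≺ reg 1 DO reflect-step)

first-sweep = (reg 10 ≔ lit 0) ⨾ (reg 11 ≔ reg 1) ⨾ sweep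

retarget-step = (arr 5 [ reg 8 ⊖ (lit 1 ⊕ reg 2) ]≔ reg 8 ⊖ arr 6 (reg 2)) ⨾ (reg 2 ≔ lit 1 ⊕ reg 2)
retarget = (reg 2 ≔ lit 0) ⨾ (WHILE reg 2 ≺ reg 1 DO retarget-step)

second-sweep = (reg 10 ≔ reg 1) ⨾ (reg 11 ≔ reg 8) ⨾ sweep

-- The final marks are stored mirrored; reading them through the reflection restores the original
-- direction.
write-step = (IF arr 7 (reg 8 ⊖ (lit 1 ⊕ reg 2)) ≐ lit 0 THEN skip ELSE emit (reg 2)) ⨾
             (reg 2 ≔ lit 1 ⊕ reg 2)
write = (reg 2 ≔ lit 0) ⨾ (WHILE reg 2 ≺ reg 1 DO write-step)

minimal-supersequence : Program
minimal-supersequence =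
  measure ⨾ identity ⨾ sort-positions ⨾ classify ⨾ reflect ⨾ first-sweep ⨾ retarget ⨾ second-sweep ⨾ write

-- The first matching is class-preserving and, by `Settled`, strictly increasing along each string.
-- Reflecting both sides preserves this.
mirrored-targets : ∀ {N cls B F₁ G₁ K₁ F₂} → let M = N + N in
  Swept 0 N cls B F₁ G₁ K₁ →
  (∀ {p} → p < N → cls (mirror M p) ≡ cls p) → (∀ {p} → p ≤ N → B (M ∸ p) ≡ B p) →
  (∀ {e} → e < N → F₂ (mirror M e) ≡ M ∸ G₁ e) → B 0 ≢ 0 → B N ≢ 0 →
  Targets N M cls B F₂
mirrored-targets {N} {cls} {B} {F₁} {G₁} {K₁} {F₂} sw cls-mirror B-mirror F₂-mirror B0 BN = record
  { lo-boundary = BN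
  ; hi-boundary = λ z → B0 (trans (sym (B-mirror z≤n)) z)
  ; F-lower = λ l u → let g , g<N , F≡ , _ = target l u in subst (N ≤_) (sym F≡) (mirror-upper g<N)
  ; F-upper = λ l u → let g , g<N , F≡ , _ = target l u in subst (_< M) (sym F≡) (mirror< (<M g<N))
  ; F-class = λ {e} l u → let g , g<N , F≡ , c = target l u in
      trans (cong cls F≡) (trans (cls-mirror g<N) (trans c (trans (sym (cls-mirror (mirror-lower l u))) (cong cls (mirror-mirror u)))))
  ; F-mono = F-mono
  }
  where
  M = N + N
  <M : ∀ {p} → p < N → p < M
  <M p<N = ≤-trans p<N (m≤m+n N N)
  F₂≡ : ∀ {e} → N ≤ e → e < M → F₂ e ≡ M ∸ G₁ (mirror M e)
  F₂≡ l u = trans (cong F₂ (sym (mirror-mirror u))) (F₂-mirror (mirror-lower l u))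
  target : ∀ {e} → N ≤ e → e < M → ∃[ g ] g < N × F₂ e ≡ mirror M g × cls g ≡ cls (mirror M e)
  target l u with Swept.matched sw z≤n (mirror-lower l u)
  ... | g , G≡ , m = g , Matched.upper m , trans (F₂≡ l u) (cong (M ∸_) G≡) , Matched.class m
  F-mono : ∀ {e} → N ≤ e → suc e < M → B (suc e) ≡ 0 → F₂ e < F₂ (suc e)
  F-mono {e} l u b with Swept.matched sw z≤n (mirror-lower l (<-trans (n<1+n e) u))
  ... | g , G≡ , m with Matched.settled m
  ...   | inj₁ n = ⊥-elim (n (trans (sym (B-mirror (<⇒≤ (mirror-lower l e<M)))) (trans (cong B M∸) b)))
    where
    e<M = <-trans (n<1+n e) u
    M∸ : M ∸ mirror M e ≡ suc e
    M∸ = trans (sym (suc-mirror (mirror< e<M))) (cong suc (mirror-mirror e<M))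
  ...   | inj₂ (_ , le) = subst₂ _<_ (sym (F₂≡ l e<M)) (sym (F₂≡ (m≤n⇒m≤1+n l) u))
                            (∸-monoʳ-< lt (≤-trans (≤-reflexive G≡) (<M (Matched.upper m))))
    where
    e<M = <-trans (n<1+n e) u
    lt : G₁ (mirror M (suc e)) < G₁ (mirror M e)
    -- The predecessor of `mirror M e` is `mirror M (suc e)`, which is where `Settled` looks.
    lt = ≤-trans (s≤s (≤-trans (≤-reflexive (cong G₁ (sym (pred[m∸n]≡m∸[1+n] M (suc e))))) le)) (≤-reflexive (sym G≡))

-- The phases of the algorithm

module Phases
  {Char : Set} {_≺′_ : Rel Char 0ℓ} (isSTO : IsStrictTotalOrder _≡_ _≺′_)
  {k : ℕ} (A : Vec (List Char) k) (W : ℕ)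
  where

  tape : List Char
  tape = concat (toList A)

  N M : ℕ
  N = length tape
  M = N + N

  open Execution isSTO tape W
  open Sweeping isSTO tape W
  open Strings (tape ‼_)

  module Runs (M<W : M < W) (k<W : k < W) (1<W : 1 < W) where

    private
      <W : ∀ {v} → v ≤ N → v < W
      <W v≤N = ≤-<-trans (≤-trans v≤N (m≤m+n N N)) M<W
      ≤M⇒<W : ∀ {v} → v ≤ M → v < W
      ≤M⇒<W v≤M = ≤-<-trans v≤M M<W

      counting : ∀ {n v i m} → n ≡ m → v ≡ i → i < m → just (does (v <? n)) ≡ just true
      counting n≡ i≡ i<m = test-< (subst₂ _<_ (sym i≡) (sym n≡) i<m)

      counted : ∀ {n v m} → n ≡ m → v ≡ m → just (does (v <? n)) ≡ just false
      counted n≡ i≡ = test-≮ (<-irrefl (trans i≡ (sym n≡)))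

    off : ℕ → ℕ
    off = offset (toList A)

    -- Marks are at most 1 so that `reflect` can store copies of them within the word size.
    MeasureInv : ℕ → State Char → Set
    MeasureInv i s = regs s 0 ≡ k × regs s 2 ≡ i × regs s 1 ≡ off i × (∀ j → arrs s 0 j ≡ lengthAt (toList A) j) ×
      (∀ {j} → j ≤ i → arrs s 1 (off j) ≢ 0) × (∀ {p} → arrs s 1 p ≢ 0 → ∃[ j ] j ≤ i × p ≡ off j) × (∀ p → arrs s 1 p ≤ 1)

    measure-step-exec : ∀ {i s} → i < k → MeasureInv i s → Exec measure-step s 13 (MeasureInv (suc i))
    measure-step-exec {i} {s} i<k (k≡ , refl , off≡ , len≡ , marked , marks , ≤1) =
      exec (seq (assign (subst (_< W) (sym off′) (<W (offset-≤ A i<k)))) (seq (store 1<W) (assign (≤-<-trans i<k k<W))))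
           (≤ᵇ⇒≤ _ _ tt) (k≡ , refl , off′ , len≡ , marked′ , marks′ , ≤1′)
      where
      new = regs s 1 + arrs s 0 i
      off′ : new ≡ off (suc i)
      off′ = trans (cong₂ _+_ off≡ (len≡ i)) (sym (offset-suc (toList A) i))
      ≤1′ : ∀ p → (arrs s 1 [ new ↦ 1 ]) p ≤ 1
      ≤1′ p with p ≟ new
      ... | yes refl = ≤-reflexive (lookup-updated (arrs s 1) new)
      ... | no ne = ≤-trans (≤-reflexive (lookup-other (arrs s 1) ne)) (≤1 p)
      marked′ : ∀ {j} → j ≤ suc i → (arrs s 1 [ new ↦ 1 ]) (off j) ≢ 0
      marked′ {j} j≤ z with off j ≟ new
      ... | yes eq = suc≢0 (trans (cong (arrs s 1 [ new ↦ 1 ]) eq) (lookup-updated (arrs s 1) new)) z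
      ... | no ne with m≤n⇒m<n∨m≡n j≤
      ...   | inj₁ (s≤s j≤i) = marked j≤i (trans (sym (lookup-other (arrs s 1) ne)) z)
      ...   | inj₂ refl = ne (sym off′)
      marks′ : ∀ {p} → (arrs s 1 [ new ↦ 1 ]) p ≢ 0 → ∃[ j ] j ≤ suc i × p ≡ off j
      marks′ {p} nz with p ≟ new
      ... | yes eq = suc i , ≤-refl , trans eq off′
      ... | no ne with marks (λ z → nz (trans (lookup-other (arrs s 1) ne) z))
      ...   | j , j≤i , p≡ = j , m≤n⇒m≤1+n j≤i , p≡

    measure-exec : Exec measure (initial A) (7 + k * 17)
      (λ s → regs s 1 ≡ N × Boundaries A (arrs s 1) × (∀ p → arrs s 1 p ≤ 1))
    measure-exec = weaken ≤-refl (λ (_ , _ , N≡ , _ , marked , marks , ≤1) → trans N≡ (offset-all A) ,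
                       record { at-offset = marked ; only-offset = λ _ → marks } , ≤1)
      (store⨾ 1<W (for k 13 MeasureInv
        (λ i<k inv@(k≡ , i≡ , _) → counting k≡ i≡ i<k , measure-step-exec i<k inv)
        (λ (k≡ , i≡ , _) → counted k≡ i≡)
        z≤n (refl , refl , refl , (λ _ → refl) , marked , marks , ≤1)))
      where
      ≤1 : ∀ p → ((λ _ → 0) [ 0 ↦ 1 ]) p ≤ 1
      ≤1 zero    = ≤-refl
      ≤1 (suc p) = z≤n
      marked : ∀ {j} → j ≤ 0 → ((λ _ → 0) [ 0 ↦ 1 ]) (off j) ≢ 0
      marked z≤n ()
      marks : ∀ {p} → ((λ _ → 0) [ 0 ↦ 1 ]) p ≢ 0 → ∃[ j ] j ≤ 0 × p ≡ off j
      marks {zero}  _ = 0 , z≤n , refl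
      marks {suc p} n = ⊥-elim (n refl)

    IdentityInv : ℕ → State Char → Set
    IdentityInv i s = regs s 1 ≡ N × regs s 2 ≡ i × (∀ {p} → p < i → arrs s 2 p ≡ p) × (∀ {p} → p < i → arrs s 5 p ≡ p)

    identity-exec : ∀ {s} → regs s 1 ≡ N → Exec identity s (6 + N * 14)
      (λ s → (∀ {p} → p < N → arrs s 2 p ≡ p) × (∀ {p} → p < N → arrs s 5 p ≡ p))
    identity-exec N≡ = weaken ≤-refl (λ (_ , _ , a , f) → a , f)
      (assign⨾ (<W z≤n) (for N 10 IdentityInv
        (λ i<N inv@(N≡ , i≡ , _) → counting N≡ i≡ i<N , step i<N inv)
        (λ (N≡ , i≡ , _) → counted N≡ i≡)
        z≤n (N≡ , refl , (λ ()) , (λ ()))))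
      where
      extend : ∀ {i f} → (∀ {p} → p < i → f p ≡ p) → ∀ {p} → p < suc i → (f [ i ↦ i ]) p ≡ p
      extend {i} {f} id (s≤s p≤i) with m≤n⇒m<n∨m≡n p≤i
      ... | inj₁ p<i = trans (lookup-other f (<⇒≢ p<i)) (id p<i)
      ... | inj₂ refl = lookup-updated f i
      step : ∀ {i s} → i < N → IdentityInv i s →
        Exec identity-step s 10 (IdentityInv (suc i))
      step i<N (N≡ , refl , a , f) =
        exec (seq (store (<W (<⇒≤ i<N))) (seq (store (<W (<⇒≤ i<N))) (assign (<W i<N)))) (≤ᵇ⇒≤ _ _ tt)
             (N≡ , refl , extend a , extend f)

    ReflectInv : (ℕ → ℕ) → (ℕ → ℕ) → ℕ → State Char → Set
    ReflectInv cls B i s = regs s 1 ≡ N × regs s 8 ≡ M × regs s 2 ≡ i ×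
      (∀ {p} → p < N → arrs s 4 p ≡ cls p) × (∀ {p} → p ≤ N → arrs s 1 p ≡ B p) ×
      (∀ {p} → p < i → arrs s 4 (mirror M p) ≡ cls p) × (∀ {p} → p < i → arrs s 1 (M ∸ p) ≡ B p)

    reflect-exec : ∀ {s} → regs s 1 ≡ N → (∀ {p} → p < N → arrs s 4 p ≤ N) → (∀ p → arrs s 1 p ≤ 1) →
      Exec reflect s (10 + N * 23) (λ s′ → regs s′ 8 ≡ M × 
        (∀ {p} → p < N → arrs s′ 4 p ≡ arrs s 4 p) × (∀ {p} → p ≤ N → arrs s′ 1 p ≡ arrs s 1 p) ×
        (∀ {p} → p < N → arrs s′ 4 (mirror M p) ≡ arrs s′ 4 p) × (∀ {p} → p ≤ N → arrs s′ 1 (M ∸ p) ≡ arrs s′ 1 p))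
    reflect-exec {s} N≡ cls≤ B≤ =
      weaken ≤-refl (λ {s′} (_ , M≡ , _ , c , b , c′ , b′) → M≡ , c , b ,
                       (λ p<N → trans (c′ p<N) (sym (c p<N))) , λ {p} → B-mirror s′ b b′ {p})
        (assign⨾ (subst (λ n → n + n < W) (sym N≡) M<W) (assign⨾ (<W z≤n)
          (for N 19 (ReflectInv cls B)
            (λ i<N inv@(N≡ , _ , i≡ , _) → counting N≡ i≡ i<N , step i<N inv)
            (λ (N≡ , _ , i≡ , _) → counted N≡ i≡)
            z≤n (N≡ , cong (λ n → n + n) N≡ , refl , (λ _ → refl) , (λ _ → refl) , (λ ()) , (λ ())))))
      where
      cls = arrs s 4
      B = arrs s 1
      B-mirror : ∀ s′ → (∀ {p} → p ≤ N → arrs s′ 1 p ≡ B p) → (∀ {p} → p < N → arrs s′ 1 (M ∸ p) ≡ B p) →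
                 ∀ {p} → p ≤ N → arrs s′ 1 (M ∸ p) ≡ arrs s′ 1 p
      B-mirror s′ b b′ p≤N with m≤n⇒m<n∨m≡n p≤N
      ... | inj₁ p<N = trans (b′ p<N) (sym (b p≤N))
      -- The boundary N is its own mirror image, which is why the loop may stop short of it.
      ... | inj₂ refl = cong (arrs s′ 1) (m+n∸n≡m N N)
      step : ∀ {i s} → i < N → ReflectInv cls B i s →
        Exec reflect-step s 19 (ReflectInv cls B (suc i))
      step {i} {s} i<N (N≡ , M≡ , refl , c , b , c′ , b′) =
        exec (seq (store (subst (_< W) (sym (c i<N)) (<W (cls≤ i<N))))
               (seq (store (subst (_< W) (sym (b (<⇒≤ i<N))) (≤-<-trans (B≤ i) 1<W))) (assign (<W i<N))))
             (≤ᵇ⇒≤ _ _ tt) (N≡ , M≡ , refl , c₁ , b₁ , c₂ , b₂)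
        where
        i<M = ≤-trans i<N (m≤m+n N N)
        at-c : regs s 8 ∸ suc i ≡ mirror M i
        at-c = cong (_∸ suc i) M≡
        at-b : regs s 8 ∸ i ≡ M ∸ i
        at-b = cong (_∸ i) M≡
        -- Boundary marks are written strictly above N, so the originals up to N survive.
        N<M∸i : N < M ∸ i
        N<M∸i = subst (N <_) (suc-mirror i<M) (s≤s (mirror-upper i<N))
        c₁ : ∀ {p} → p < N → (arrs s 4 [ regs s 8 ∸ suc i ↦ arrs s 4 i ]) p ≡ cls p
        c₁ {p} p<N = trans (lookup-other (arrs s 4) λ { refl → <⇒≱ p<N (≤-trans (mirror-upper i<N) (≤-reflexive (sym at-c))) }) (c p<N)
        b₁ : ∀ {p} → p ≤ N → (arrs s 1 [ regs s 8 ∸ i ↦ arrs s 1 i ]) p ≡ B p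
        b₁ {p} p≤N = trans (lookup-other (arrs s 1) λ { refl → <⇒≱ N<M∸i (≤-trans (≤-reflexive (sym at-b)) p≤N) }) (b p≤N)
        c₂ : ∀ {p} → p < suc i → (arrs s 4 [ regs s 8 ∸ suc i ↦ arrs s 4 i ]) (mirror M p) ≡ cls p
        c₂ {p} (s≤s p≤i) with m≤n⇒m<n∨m≡n p≤i
        ... | inj₁ p<i = trans (lookup-other (arrs s 4) λ eq → <⇒≢ (mirror-anti i<M p<i) (sym (trans eq at-c))) (c′ p<i)
        ... | inj₂ refl = trans (cong (arrs s 4 [ regs s 8 ∸ suc i ↦ arrs s 4 i ]) (sym at-c))
                                (trans (lookup-updated (arrs s 4) (regs s 8 ∸ suc i)) (c i<N))
        b₂ : ∀ {p} → p < suc i → (arrs s 1 [ regs s 8 ∸ i ↦ arrs s 1 i ]) (M ∸ p) ≡ B p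
        b₂ {p} (s≤s p≤i) with m≤n⇒m<n∨m≡n p≤i
        ... | inj₁ p<i = trans (lookup-other (arrs s 1) λ eq → <⇒≢ (∸-monoʳ-< p<i (<⇒≤ i<M)) (sym (trans eq at-b))) (b′ p<i)
        ... | inj₂ refl = trans (cong (arrs s 1 [ regs s 8 ∸ i ↦ arrs s 1 i ]) (sym at-b))
                                (trans (lookup-updated (arrs s 1) (regs s 8 ∸ i)) (b (<⇒≤ i<N)))

    RetargetInv : ℕ → State Char → Set
    RetargetInv i s = regs s 1 ≡ N × regs s 8 ≡ M × regs s 2 ≡ i × (∀ {p} → p < i → arrs s 5 (mirror M p) ≡ M ∸ arrs s 6 p)

    retarget-exec : ∀ {s} → regs s 1 ≡ N → regs s 8 ≡ M → Exec retarget s (6 + N * 18)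
      (λ s → ∀ p → p < N → arrs s 5 (mirror M p) ≡ M ∸ arrs s 6 p)
    retarget-exec N≡ M≡ =
      weaken ≤-refl (λ (_ , _ , _ , f) p → f {p})
        (assign⨾ (<W z≤n) (for N 14 RetargetInv
          (λ i<N inv@(N≡ , _ , i≡ , _) → counting N≡ i≡ i<N , step i<N inv)
          (λ (N≡ , _ , i≡ , _) → counted N≡ i≡)
          z≤n (N≡ , M≡ , refl , λ ())))
      where
      step : ∀ {i s} → i < N → RetargetInv i s →
        Exec retarget-step s 14 (RetargetInv (suc i))
      step {i} {s} i<N (N≡ , M≡ , refl , f) =
        exec (seq (store (≤M⇒<W (≤-trans (m∸n≤m (regs s 8) (arrs s 6 i)) (≤-reflexive M≡)))) (assign (<W i<N)))
             (≤ᵇ⇒≤ _ _ tt) (N≡ , M≡ , refl , f′)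
        where
        i<M = ≤-trans i<N (m≤m+n N N)
        at : regs s 8 ∸ suc i ≡ mirror M i
        at = cong (_∸ suc i) M≡
        v = regs s 8 ∸ arrs s 6 i
        f′ : ∀ {p} → p < suc i → (arrs s 5 [ regs s 8 ∸ suc i ↦ v ]) (mirror M p) ≡ M ∸ arrs s 6 p
        f′ {p} (s≤s p≤i) with m≤n⇒m<n∨m≡n p≤i
        ... | inj₁ p<i = trans (lookup-other (arrs s 5) λ eq → <⇒≢ (mirror-anti i<M p<i) (sym (trans eq at))) (f p<i)
        ... | inj₂ refl = trans (cong (arrs s 5 [ regs s 8 ∸ suc i ↦ v ]) (sym at))
                                (trans (lookup-updated (arrs s 5) (regs s 8 ∸ suc i)) (cong (_∸ arrs s 6 i) M≡))

    kept-by : (ℕ → ℕ) → ℕ → ℕ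
    kept-by K p = K (mirror M p)

    -- `ps` lists the positions written so far; together with the kept ones from `i` on they make up
    -- the full list.
    WriteInv : (ℕ → ℕ) → ℕ → State Char → Set
    WriteInv K i s = regs s 1 ≡ N × regs s 8 ≡ M × regs s 2 ≡ i × arrs s 7 ≡ K ×
      ∃[ ps ] Pointwise AtPosition (output s) ps × ps ++ keptFrom (kept-by K) i (N ∸ i) ≡ keptFrom (kept-by K) 0 N

    write-exec : ∀ {s} → regs s 1 ≡ N → regs s 8 ≡ M → output s ≡ [] → Exec write s (6 + N * 19)
      (λ s′ → Pointwise AtPosition (output s′) (keptFrom (kept-by (arrs s 7)) 0 N))
    write-exec {s} N≡ M≡ out≡ =
      weaken ≤-refl (λ (_ , _ , _ , _ , ps , pw , eq) → subst (Pointwise AtPosition _)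
                       (trans (sym (++-identityʳ ps)) (trans (cong (λ n → ps ++ keptFrom (kept-by (arrs s 7)) N n) (sym (n∸n≡0 N))) eq)) pw)
        (assign⨾ (<W z≤n) (for N 15 (WriteInv (arrs s 7))
          (λ i<N inv@(N≡ , _ , i≡ , _) → counting N≡ i≡ i<N , step i<N inv)
          (λ (N≡ , _ , i≡ , _) → counted N≡ i≡)
          z≤n (N≡ , M≡ , refl , refl , [] , subst (λ o → Pointwise AtPosition o []) (sym out≡) [] , refl)))
      where
      step : ∀ {K i s} → i < N → WriteInv K i s → Exec write-step s 15 (WriteInv K (suc i))
      step {i = i} {s} i<N (N≡ , M≡ , refl , refl , ps , pw , eq)
        with subst (λ m → keptFrom (kept-by (arrs s 7)) i m ≡ keptFrom (kept-by (arrs s 7)) i (N ∸ i)) (+-∸-assoc 1 i<N) refl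
      ... | split with kept-by (arrs s 7) i ≟ 0
      ...   | yes z = exec (seq (if-true (test-≡ (trans (cong (λ m → arrs s 7 (m ∸ suc i)) M≡) z)) skip) (assign (<W i<N)))
                        (≤ᵇ⇒≤ _ _ tt) (N≡ , M≡ , refl , refl , ps , pw , trans (cong (ps ++_) split) eq)
      ...   | no nz with ‼-just tape i<N
      ...     | x , tape-i = exec (seq (if-false (test-≢ (λ z → nz (trans (cong (λ m → arrs s 7 (m ∸ suc i)) (sym M≡)) z))) (emit tape-i))
                                       (assign (<W i<N)))
                        (≤ᵇ⇒≤ _ _ tt)
                        ( N≡ , M≡ , refl , refl , ps ++ i ∷ [] , Pointwise.++⁺ pw (tape-i ∷ [])
                        , trans (++-assoc ps (i ∷ []) _) (trans (cong (ps ++_) split) eq))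

    -- The initial zeros are carried to the first sweep by framing, so no time is spent on clearing
    -- arrays.
    Blank : State Char → Set
    Blank s = (∀ e → arrs s 6 e ≡ 0) × (∀ e → arrs s 7 e ≡ 0) × (∀ c → arrs s 8 c ≡ 0) × output s ≡ []

    Measured Identified Ordered Classified : State Char → Set
    Measured s = regs s 1 ≡ N × Boundaries A (arrs s 1) × (∀ p → arrs s 1 p ≤ 1) × Blank s
    Identified s = Measured s × (∀ {p} → p < N → arrs s 2 p ≡ p) × (∀ {p} → p < N → arrs s 5 p ≡ p)
    Ordered s = Measured s × (∀ {p} → p < N → arrs s 5 p ≡ p) ×
      (∀ {p q} → p ≤ q → q < N → Sorting._≼_ isSTO tape W (arrs s 2 p) (arrs s 2 q)) ×
      Sorting.Permutation isSTO tape W (arrs s 2)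
    Classified s = Measured s × (∀ {p} → p < N → arrs s 5 p ≡ p) ×
      Classes tape (arrs s 4) × (∀ {p} → p < N → arrs s 4 p ≤ N)

    record Mirrored (cls B : ℕ → ℕ) : Set where
      field
        boundaries : Boundaries A B
        classes    : Classes tape cls
        cls≤N      : ∀ {p} → p < N → cls p ≤ N
        cls-mirror : ∀ {p} → p < N → cls (mirror M p) ≡ cls p
        B-mirror   : ∀ {p} → p ≤ N → B (M ∸ p) ≡ B p

      B-start : B 0 ≢ 0
      B-start = Boundaries.at-offset boundaries z≤n

      B-end : B N ≢ 0
      B-end z = Boundaries.at-offset boundaries ≤-refl (trans (cong B (offset-all A)) z)

    Mirroredₛ Reflected SweptOnce Retargeted SweptTwice : State Char → Set
    Mirroredₛ s = regs s 1 ≡ N × regs s 8 ≡ M × output s ≡ [] × Mirrored (arrs s 4) (arrs s 1)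
    Reflected s = Mirroredₛ s × (∀ {p} → p < N → arrs s 5 p ≡ p) × Blank s
    SweptOnce s = Mirroredₛ s × Swept 0 N (arrs s 4) (arrs s 1) (arrs s 5) (arrs s 6) (arrs s 7) × (∀ c → arrs s 8 c ≡ 0)
    Retargeted s = Mirroredₛ s × (∀ c → arrs s 8 c ≡ 0) ×
      -- Array 5 has been overwritten by now, so the targets of the first sweep survive only as a
      -- quantified function.
      (∃[ F₁ ] Swept 0 N (arrs s 4) (arrs s 1) F₁ (arrs s 6) (arrs s 7)) ×
      (∀ {p} → p < N → arrs s 5 (mirror M p) ≡ M ∸ arrs s 6 p)
    SweptTwice s = Mirroredₛ s × ∃[ F₁ ] ∃[ G₁ ] ∃[ K₁ ]
      TwoSweeps N (arrs s 4) (arrs s 1) F₁ G₁ K₁ (arrs s 5) (arrs s 6) (arrs s 7)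

    measured : Exec measure (initial A) (7 + k * 17) Measured
    measured = weaken ≤-refl (λ {s} ((N≡ , bd , ≤1) , fr) → finish s N≡ bd ≤1 fr) (framed measure-exec)
      where
      finish : ∀ s → regs s 1 ≡ N → Boundaries A (arrs s 1) → (∀ p → arrs s 1 p ≤ 1) → Frame measure (initial A) s → Measured s
      finish s N≡ bd ≤1 (frame a r o) rewrite a 6 refl | a 7 refl | a 8 refl | o refl =
        N≡ , bd , ≤1 , (λ _ → refl) , (λ _ → refl) , (λ _ → refl) , refl

    identified : ∀ {s} → Measured s → Exec identity s (6 + N * 14) Identified
    identified {s} ms@(N≡ , _) = weaken ≤-refl (λ {s′} ((a , f) , fr) → finish s′ a f fr) (framed (identity-exec N≡))
      where
      finish : ∀ s′ → (∀ {p} → p < N → arrs s′ 2 p ≡ p) → (∀ {p} → p < N → arrs s′ 5 p ≡ p) → Frame identity s s′ → Identified s′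
      finish s′ id₂ id₅ (frame a r o)
        rewrite r 1 refl | a 1 refl | a 6 refl | a 7 refl | a 8 refl | o refl = ms , id₂ , id₅

    ordered : ∀ {s} L → N ≤ 2 ^ L → Identified s → Exec sort-positions s (Sorting.SortRuns.sort-cost isSTO tape W M<W L) Ordered
    ordered {s} L N≤ (ms@(N≡ , _) , id₂ , id₅) =
      weaken ≤-refl (λ {s′} ((le , perm) , fr) → finish s′ le perm fr)
        (framed (Sorting.SortRuns.sort-exec isSTO tape W M<W L N≤ N≡ id₂ 1<W))
      where
      finish : ∀ s′ → (∀ {p q} → p ≤ q → q < N → Sorting._≼_ isSTO tape W (arrs s′ 2 p) (arrs s′ 2 q)) →
               Sorting.Permutation isSTO tape W (arrs s′ 2) → Frame sort-positions s s′ → Ordered s′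
      finish s′ le perm (frame a r o)
        rewrite r 1 refl | a 1 refl | a 5 refl | a 6 refl | a 7 refl | a 8 refl | o refl = ms , id₅ , le , perm

    classified : ∀ {s} → Ordered s → Exec classify s (Sorting.SortRuns.classify-cost isSTO tape W M<W) Classified
    classified {s} (ms@(N≡ , _) , id₅ , le , perm) =
      weaken ≤-refl (λ {s′} ((cl , cls≤) , fr) → finish s′ cl cls≤ fr)
        (framed (Sorting.SortRuns.classify-exec isSTO tape W M<W N≡ le perm))
      where
      finish : ∀ s′ → Classes tape (arrs s′ 4) → (∀ {p} → p < N → arrs s′ 4 p ≤ N) → Frame classify s s′ → Classified s′
      finish s′ cl cls≤ (frame a r o)
        rewrite r 1 refl | a 1 refl | a 5 refl | a 6 refl | a 7 refl | a 8 refl | o refl = ms , id₅ , cl , cls≤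

    reflected : ∀ {s} → Classified s → Exec reflect s (10 + N * 23) Reflected
    reflected {s} ((N≡ , bd , ≤1 , blank) , id₅ , cl , cls≤) =
      weaken ≤-refl (λ {s′} ((M≡ , c , b , c-mirror , b-mirror) , fr) → finish s′ M≡ c b (λ {p} → c-mirror {p}) (λ {p} → b-mirror {p}) fr)
        (framed (reflect-exec N≡ cls≤ ≤1))
      where
      finish : ∀ s′ → regs s′ 8 ≡ M → (∀ {p} → p < N → arrs s′ 4 p ≡ arrs s 4 p) → (∀ {p} → p ≤ N → arrs s′ 1 p ≡ arrs s 1 p) →
        (∀ {p} → p < N → arrs s′ 4 (mirror M p) ≡ arrs s′ 4 p) → (∀ {p} → p ≤ N → arrs s′ 1 (M ∸ p) ≡ arrs s′ 1 p) →
        Frame reflect s s′ → Reflected s′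
      finish s′ M≡ c b c-mirror b-mirror (frame a r o)
        rewrite r 1 refl | a 5 refl | a 6 refl | a 7 refl | a 8 refl | o refl =
        (N≡ , M≡ , proj₂ (proj₂ (proj₂ blank)) , mirrored) , id₅ , blank
        where
        mirrored : Mirrored (arrs s′ 4) (arrs s′ 1)
        mirrored = record
          { boundaries = record
              { at-offset = λ i≤k z → Boundaries.at-offset bd i≤k (trans (sym (b (offset-≤ A i≤k))) z)
              ; only-offset = λ p≤N n → Boundaries.only-offset bd p≤N (λ z → n (trans (b p≤N) z)) }
          ; classes = record
              { sound = λ p<N q<N eq → Classes.sound cl p<N q<N (trans (sym (c p<N)) (trans eq (c q<N)))
              ; complete = λ p<N q<N eq → trans (c p<N) (trans (Classes.complete cl p<N q<N eq) (sym (c q<N))) }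
          ; cls≤N = λ p<N → ≤-trans (≤-reflexive (c p<N)) (cls≤ p<N)
          ; cls-mirror = c-mirror
          ; B-mirror = b-mirror }

    swept-once : ∀ {s} → Reflected s → Exec first-sweep s (4 + sweep-cost N) SweptOnce
    swept-once {s} ((N≡ , M≡ , out≡ , mr) , id₅ , G≡0 , K≡0 , heads , _) =
      weaken ≤-refl (λ {s′} (p , fr) → finish s′ p fr)
        (framed (assign⨾ (<W z≤n) (assign⨾ (<W (≤-reflexive N≡))
          (subst (λ n → Exec sweep s₁ (sweep-cost n) (λ s′ →
                    Swept 0 n (arrs s 4) (arrs s 1) (arrs s 5) (arrs s′ 6) (arrs s′ 7) × (∀ c → arrs s′ 8 c ≡ 0))) N≡
            (sweep-exec {s₁} (subst (λ n → Setup 0 n (arrs s 4) (arrs s 1) (arrs s 5)) (sym N≡) setup)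
              z≤n heads (λ {e} _ → G≡0 e) (λ {e} _ → K≡0 e))))))
      where
      open Mirrored mr
      s₁ : State Char
      s₁ = ⟪ regs s [ 10 ↦ 0 ] [ 11 ↦ regs s 1 ] , arrs s , output s ⟫
      setup : Setup 0 N (arrs s 4) (arrs s 1) (arrs s 5)
      setup = record
        { targets = record
            { lo-boundary = B-start ; hi-boundary = B-end ; F-lower = λ _ _ → z≤n
            ; F-upper = λ _ u → subst (_< N) (sym (id₅ u)) u
            ; F-class = λ _ u → cong (arrs s 4) (id₅ u)
            ; F-mono = λ {e} _ u _ → subst₂ _<_ (sym (id₅ (<-trans (n<1+n e) u))) (sym (id₅ u)) (n<1+n e) }
        ; hi<W = <W ≤-refl
        ; cls<W = λ u → <W (cls≤N u) }
      finish : ∀ s′ → Swept 0 N (arrs s 4) (arrs s 1) (arrs s 5) (arrs s′ 6) (arrs s′ 7) × (∀ c → arrs s′ 8 c ≡ 0) →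
               Frame first-sweep s s′ → SweptOnce s′
      finish s′ (sw , heads) (frame a r o)
        rewrite r 1 refl | r 8 refl | a 1 refl | a 4 refl | a 5 refl | o refl = (N≡ , M≡ , out≡ , mr) , sw , heads

    retargeted : ∀ {s} → SweptOnce s → Exec retarget s (6 + N * 18) Retargeted
    retargeted {s} (ms@(N≡ , M≡ , _) , sw , heads) =
      weaken ≤-refl (λ {s′} (f , fr) → finish s′ (λ {p} → f p) fr) (framed (retarget-exec N≡ M≡))
      where
      finish : ∀ s′ → (∀ {p} → p < N → arrs s′ 5 (mirror M p) ≡ M ∸ arrs s′ 6 p) → Frame retarget s s′ → Retargeted s′
      finish s′ f (frame a r o)
        rewrite r 1 refl | r 8 refl | a 1 refl | a 4 refl | a 6 refl | a 7 refl | a 8 refl | o refl =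
        ms , heads , (_ , sw) , f

    swept-twice : ∀ {s} → Retargeted s → Exec second-sweep s (4 + sweep-cost M) SweptTwice
    swept-twice {s} (ms@(N≡ , M≡ , _ , mr) , heads , (F₁ , sw) , F₂≡) =
      weaken ≤-refl (λ {s′} (p , fr) → finish s′ p fr)
        (framed (assign⨾ (<W (≤-reflexive N≡)) (assign⨾ (≤M⇒<W (≤-reflexive M≡))
          (subst₂ (λ n m → Exec sweep s₁ (sweep-cost m) (λ s′ →
                    Swept n m (arrs s 4) (arrs s 1) (arrs s 5) (arrs s′ 6) (arrs s′ 7) × (∀ c → arrs s′ 8 c ≡ 0))) N≡ M≡
            (sweep-exec {s₁} (subst₂ (λ n m → Setup n m (arrs s 4) (arrs s 1) (arrs s 5)) (sym N≡) (sym M≡) setup)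
              (subst₂ _≤_ (sym N≡) (sym M≡) (m≤m+n N N)) heads
              (λ l → Swept.G-above sw (subst (_≤ _) N≡ l))
              (λ l → K≡0 (subst (_≤ _) N≡ l)))))))
      where
      open Mirrored mr
      s₁ : State Char
      s₁ = ⟪ regs s [ 10 ↦ regs s 1 ] [ 11 ↦ regs s 8 ] , arrs s , output s ⟫
      K≡0 : ∀ {e} → N ≤ e → arrs s 7 e ≡ 0
      K≡0 {e} l with arrs s 7 e ≟ 0
      ... | yes z = z
      ... | no n = ⊥-elim (<⇒≱ (Swept.keep< sw z≤n n) l)
      cls-bound : ∀ {e} → e < M → arrs s 4 e ≤ N
      cls-bound {e} u with e <? N
      ... | yes e<N = cls≤N e<N
      ... | no e≮N = let e′<N = mirror-lower (≮⇒≥ e≮N) u in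
        ≤-trans (≤-reflexive (trans (cong (arrs s 4) (sym (mirror-mirror u))) (cls-mirror e′<N))) (cls≤N e′<N)
      setup : Setup N M (arrs s 4) (arrs s 1) (arrs s 5)
      setup = record
        { targets = mirrored-targets sw cls-mirror B-mirror F₂≡ B-start B-end
        ; hi<W = M<W
        ; cls<W = λ u → <W (cls-bound u) }
      finish : ∀ s′ → Swept N M (arrs s 4) (arrs s 1) (arrs s 5) (arrs s′ 6) (arrs s′ 7) × (∀ c → arrs s′ 8 c ≡ 0) →
               Frame second-sweep s s′ → SweptTwice s′
      finish s′ (sw₂ , _) (frame a r o)
        rewrite r 1 refl | r 8 refl | a 1 refl | a 4 refl | a 5 refl | o refl =
        ms , F₁ , arrs s 6 , arrs s 7 , record
          { first = sw ; second = sw₂ ; cls-mirror = cls-mirror ; B-mirror = B-mirror ; F₂-mirror = F₂≡ }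

    written : ∀ {s} → SweptTwice s → Exec write s (6 + N * 19) (λ s′ → MinimalCommonSupersequence A (output s′))
    written ((N≡ , M≡ , out≡ , mr) , _ , _ , _ , sweeps) =
      weaken ≤-refl (λ pw → two-sweeps-minimal A sweeps (Mirrored.boundaries mr) (Mirrored.classes mr) pw) (write-exec N≡ M≡ out≡)

    -- Adding up the costs

    module _ {L X : ℕ} (N≤2^L : N ≤ 2 ^ L) (1≤X : 1 ≤ X) (k≤X : k ≤ X) (N≤X : N ≤ X) (L≤X : L ≤ X) (LN≤X : L * N ≤ X) where

      private
        -- A wrapper from which the factor b can be inferred.
        record Execₓ (P : Program) (s : State Char) (b : ℕ) (Post : State Char → Set) : Set where
          constructor within
          field
            unscaled : Exec P s (b * X) Post

        infixr 3 _⨾ₓ_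
        _⨾ₓ_ : ∀ {P Q s b c} {Mid Post : State Char → Set} → Execₓ P s b Mid →
               (∀ {s′} → Mid s′ → Execₓ Q s′ c Post) → Execₓ (P ⨾ Q) s (b + c) Post
        _⨾ₓ_ {b = b} {c} (within p) q =
          within (weaken (≤-reflexive (sym (*-distribʳ-+ X b c))) (λ r → r) (p ⨾ₑ λ m → Execₓ.unscaled (q m)))

        linear : ∀ a b {v} → v ≤ X → a + v * b ≤ (a + b) * X
        linear a b {v} v≤X = begin
          a + v * b      ≡⟨ cong₂ _+_ (sym (*-identityʳ a)) (*-comm v b) ⟩
          a * 1 + b * v  ≤⟨ +-mono-≤ (*-monoʳ-≤ a 1≤X) (*-monoʳ-≤ b v≤X) ⟩
          a * X + b * X  ≡⟨ sym (*-distribʳ-+ X a b) ⟩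
          (a + b) * X    ∎
          where open ≤-Reasoning

        -- 202 = 68 + 64 + 70 is the cost per position, and 420 = 16 + 2 * 202; the doubled range
        -- accommodates the second sweep, where `h` is N + N.
        sweep-linear : ∀ {h} → h ≤ X + X → 4 + sweep-cost h ≤ 420 * X
        sweep-linear {h} h≤ = begin
          4 + sweep-cost h                ≡⟨ solve 1 (λ h → con 16 :+ (h :* con 68 :+ (h :* con 64 :+ h :* con 70))
                                                       := con 16 :+ con 202 :* h) refl h ⟩
          16 + 202 * h                    ≤⟨ +-mono-≤ (*-monoʳ-≤ 16 1≤X) (*-monoʳ-≤ 202 h≤) ⟩
          16 * X + 202 * (X + X)          ≡⟨ solve 1 (λ x → con 16 :* x :+ con 202 :* (x :+ x) := con 420 :* x) refl X ⟩
          420 * X                         ∎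
          where
          open ≤-Reasoning
          open +-*-Solver

        sort-linear : Sorting.SortRuns.sort-cost isSTO tape W M<W L ≤ 98 * X
        sort-linear = begin
          6 + L * (4 + (18 + (N * 58 + N * 12)))  ≡⟨ solve 2 (λ l n → con 6 :+ l :* (con 4 :+ (con 18 :+ (n :* con 58 :+ n :* con 12)))
                                                               := con 6 :+ con 22 :* l :+ con 70 :* (l :* n)) refl L N ⟩
          6 + 22 * L + 70 * (L * N)               ≤⟨ +-mono-≤ (+-mono-≤ (*-monoʳ-≤ 6 1≤X) (*-monoʳ-≤ 22 L≤X)) (*-monoʳ-≤ 70 LN≤X) ⟩
          6 * X + 22 * X + 70 * X                 ≡⟨ solve 1 (λ x → con 6 :* x :+ con 22 :* x :+ con 70 :* x := con 98 :* x) refl X ⟩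
          98 * X                                  ∎
          where
          open ≤-Reasoning
          open +-*-Solver

        scaled : ∀ {P s b} c {Post : State Char → Set} → b ≤ c * X → Exec P s b Post → Execₓ P s c Post
        scaled c le e = within (weaken le (λ p → p) e)

        -- 1112 is the sum of the factors of the nine phases.
        phases : Execₓ minimal-supersequence (initial A) 1112 (λ s → MinimalCommonSupersequence A (output s))
        phases =
          scaled 24 (linear 7 17 k≤X) measured ⨾ₓ λ m →
          scaled 20 (linear 6 14 N≤X) (identified m) ⨾ₓ λ i →
          scaled 98 sort-linear (ordered L N≤2^L i) ⨾ₓ λ o →
          scaled 48 (linear 8 40 N≤X) (classified o) ⨾ₓ λ c →
          scaled 33 (linear 10 23 N≤X) (reflected c) ⨾ₓ λ r →
          scaled 420 (sweep-linear (≤-trans N≤X (m≤m+n X X))) (swept-once r) ⨾ₓ λ s →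
          scaled 24 (linear 6 18 N≤X) (retargeted s) ⨾ₓ λ t →
          scaled 420 (sweep-linear (+-mono-≤ N≤X N≤X)) (swept-twice t) ⨾ₓ λ u →
          scaled 25 (linear 6 19 N≤X) (written u)

      minimal-supersequence-exec : Exec minimal-supersequence (initial A) (1112 * X) (λ s → MinimalCommonSupersequence A (output s))
      minimal-supersequence-exec = Execₓ.unscaled phases

length-concat-≤ : ∀ {Char : Set} {k n} (A : Vec (List Char) k) → (∀ i → length (lookup A i) ≤ n) →
                  length (concat (toList A)) ≤ k * n
length-concat-≤ []      short = z≤n
length-concat-≤ (l ∷ A) short =
  ≤-trans (≤-reflexive (length-++ l)) (+-mono-≤ (short zero) (length-concat-≤ A (λ i → short (suc i))))

-- The positions of tape and mirror image go up to twice `k * n`, which may exceed `2 + k * n`; its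
-- square always suffices.
word-bound : ∀ {v} m → v ≤ m + m → v < (2 + m) ^ 2
word-bound {v} m v≤ = begin-strict
  v                      ≤⟨ v≤ ⟩
  m + m                  <⟨ +-mono-<-≤ (s≤s (m≤n+m m 1)) (≤-trans (m≤n+m m 2) (m≤m+n (2 + m) _)) ⟩
  2 + m + (2 + m + m * (2 + m))  ≡⟨ cong ((2 + m) *_) (sym (*-identityʳ (2 + m))) ⟩
  (2 + m) ^ 2            ∎
  where open ≤-Reasoning

mainTheorem14 : ∃[ P ] ∃[ w ] ∃[ c ]
    ({Char : Set} {_<_ : Rel Char 0ℓ} (isSTO : IsStrictTotalOrder _≡_ _<_)
    (k n : ℕ) → 1 ≤ k → 1 ≤ n →
    (A : Vec (List Char) k) → ((i : Fin k) → length (lookup A i) ≤ n) →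
    ∃[ t ] ∃[ C ]
    (Computes isSTO ((2 + k * n) ^ w) P A t C
    × MinimalCommonSupersequence A C
    × t ≤ c * (1 ⊔ k * n * (⌈log₂ k ⌉ + ⌈log₂ n ⌉))))
mainTheorem14 = minimal-supersequence , 2 , 1112 , computes
  where
  computes : {Char : Set} {_<_ : Rel Char 0ℓ} (isSTO : IsStrictTotalOrder _≡_ _<_)
    (k n : ℕ) → 1 ≤ k → 1 ≤ n →
    (A : Vec (List Char) k) → ((i : Fin k) → length (lookup A i) ≤ n) →
    ∃[ t ] ∃[ C ]
    (Computes isSTO ((2 + k * n) ^ 2) minimal-supersequence A t C
    × MinimalCommonSupersequence A C
    × t ≤ 1112 * (1 ⊔ k * n * (⌈log₂ k ⌉ + ⌈log₂ n ⌉)))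
  computes isSTO k n 1≤k 1≤n A short = time , output end , record { final = end ; run = run ; result = refl } , post , cost
    where
    L = ⌈log₂ k ⌉ + ⌈log₂ n ⌉
    X = 1 ⊔ k * n * L
    N = length (concat (toList A))

    1≤kn : 1 ≤ k * n
    1≤kn = *-mono-≤ 1≤k 1≤n

    N≤kn : N ≤ k * n
    N≤kn = length-concat-≤ A short

    k≤kn : k ≤ k * n
    k≤kn = m≤m*n k n {{>-nonZero 1≤n}}

    -- The sum of the two rounded logarithms therefore serves as the number of merge levels.
    kn≤2^L : k * n ≤ 2 ^ L
    kn≤2^L = ≤-trans (*-mono-≤ (n≤2^⌈log₂n⌉ k) (n≤2^⌈log₂n⌉ n)) (≤-reflexive (sym (^-distribˡ-+-* 2 ⌈log₂ k ⌉ ⌈log₂ n ⌉)))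

    kn≤X : k * n ≤ X
    kn≤X = by L refl
      where
      -- If `L` is 0, then `k * n ≤ 2 ^ 0` and the 1 in the maximum covers the linear cost;
      -- otherwise the factor `L` only enlarges `k * n`.
      by : ∀ l → L ≡ l → k * n ≤ X
      by zero    L≡ = ≤-trans kn≤2^L (≤-trans (≤-reflexive (cong (2 ^_) L≡)) (m≤m⊔n 1 (k * n * L)))
      by (suc l) L≡ = ≤-trans (≤-trans (m≤m*n (k * n) (suc l)) (≤-reflexive (cong (k * n *_) (sym L≡)))) (m≤n⊔m 1 (k * n * L))

    open Phases isSTO A ((2 + k * n) ^ 2)
    open Runs (word-bound (k * n) (+-mono-≤ N≤kn N≤kn)) (word-bound (k * n) (≤-trans k≤kn (m≤m+n _ _)))
              (word-bound (k * n) (≤-trans 1≤kn (m≤m+n _ _)))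
    open Execution.Exec
      (minimal-supersequence-exec {L} {X} (≤-trans N≤kn kn≤2^L) (m≤m⊔n 1 (k * n * L)) (≤-trans k≤kn kn≤X) (≤-trans N≤kn kn≤X)
        (≤-trans (m≤n*m L (k * n) {{>-nonZero 1≤kn}}) (m≤n⊔m 1 (k * n * L)))
        (≤-trans (*-monoʳ-≤ L N≤kn) (≤-trans (≤-reflexive (*-comm L (k * n))) (m≤n⊔m 1 (k * n * L)))))
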